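{- The measure $\ell$ is incomparable with the repetitiveness measures $\delta,\gamma,b,v,c,g_{rl},z,z_{no},z_e$ and $r$; that is, for each $\mu\in\{\delta,\gamma,b,v,c,g_{rl},z,z_{no},z_e,r\}$ there exists a string family on which $\ell=o(\mu)$, and there exists a string family on which $\mu=o(\ell)$. On the other hand, it holds (for every string family) that $\ell=O(g)$ and $\ell=\Omega(\nu)$ (these two bounds being known from earlier work).
   Context: A string family is an infinite set of finite strings of unbounded length; asymptotic notation on a family refers to strings $w$ of the family with $n=|w|\to\infty$ (with constants uniform over the family). $w[i:j]$ denotes the substring of $w$ from position $i$ to position $j$ (positions start at 1), and $w[:i]=w[1:i]$. L-systems: an L-system is a tuple $(\Sigma,\varphi,\tau,s,d,n)$, where $\Sigma$ is a finite alphabet, $\varphi:\Sigma^*\to\Sigma^*$ is a non-erasing monoid endomorphism (each rule $a\to\varphi(a)$, $a\in\Sigma$, has $|\varphi(a)|\ge 1$), $\tau:\Sigma^*\to\Sigma^*$ is a coding (a morphism with $|\tau(a)|=1$ for all $a\in\Sigma$), $s\in\Sigma^+$ is the axiom, and $d\ge 0$, $n\ge 1$ are integers. It generates the unique string $\tau(\varphi^d(s))[1:n]$ of length $n$. It is always assumed that $d=n^{O(1)}$ and $|\Sigma|=n^{O(1)}$ (space is measured in $O(\log n)$-bit words). The size of the L-system is $\sum_{a\in\Sigma}|\varphi(a)|+|s|+|\Sigma|+2$. The measure $\ell(w)$ is the size of the smallest L-system generating $w$. NU-systems: a NU-system is a tuple $(V,R,\tau,s,d,n)$ (alphabet, rules,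 coding, axiom, number of levels, prefix length) that generates a unique string in a similar way to an L-system, except that the right-hand sides of its rules (and the axiom) may also contain extraction symbols of the form $a(k)[i:j]$ with $a\in V$, whose meaning is: generate the $k$-th level from $a$, then extract its substring from position $i$ to position $j$, and finally apply the coding to the resulting substring. The indexes in the system (levels, interval endpoints) must be at most $n$, so that they fit in an $O(\log n)$-bit word, and the system must not produce any loops when extracting a prefix from some level. Its size is defined analogously to that of L-systems, with each extraction symbol $a(k)[i:j]$ counted as having length 4. The measure $\nu(w)$ is the size of the smallest NU-system generating $w$. Other measures of a string $w$ of length $n$ ($\gamma$, $v$ and $c$ are given by their standard definitions from the literature): - $\delta(w)=\max\{P_w(k)/k : 1\le k\le n\}$, where $P_w(k)$ is the number of distinct substrings of $w$ of length $k$. - $\gamma(w)$ is the size of the smallest string attractor of $w$: a set $\Gamma\subseteq[1..n]$ of positions such that every non-empty substring of $w$ has an occurrence $w[i:j]$ with $i\le p\le j$ for some $p\in\Gamma$. - $b(w)$ is the size (number of phrases) of the smallest bidirectional macro-scheme for $w$: a factorization of $w$ into non-empty phrases where each phrase of length greater than 1 has a copy in $w$ starting at a different position, in such a way that $w$ can be recovered by following these pointers (phrases of length 1 may be stored explicitly). - $v(w)$ is the number of phrases of the lex-parse: $w$ is parsed left to right, the phrase starting at position $i$ having length equal to the longest common prefix of the suffix $w[i:n]$ and the suffix of $w$ immediately preceding it in lexicographic order, or being a single explicit symbol if that length is 0 or there is no preceding suffix. - A straight-line program (SLP) is a deterministic context-free grammar whose language is a single string; its size is the sum of the lengths of its right-hand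 sides. $g(w)$ is the size of the smallest SLP generating $w$. A run-length SLP (RLSLP) also allows constant-size rules $A\to a^m$, $m>1$ ($a$ a grammar symbol). $g_{rl}(w)$ is the size of the smallest RLSLP generating $w$. - $c(w)$ is the size of the smallest collage system generating $w$: an RLSLP which additionally allows constant-size truncation rules $A\to B^{[t]}$ and $A\to {}^{[t]}B$ (the prefix, respectively suffix, of length $t$ of the expansion of $B$). - $z(w)$, $z_{no}(w)$, $z_e(w)$ are the numbers of phrases of the following greedy left-to-right parsings $w=w_1w_2\cdots w_k$, in which each phrase is the longest non-empty prefix of the remaining suffix satisfying a condition, or a single symbol if there is none. Lempel-Ziv ($z$): the phrase has a copy starting inside some previous phrase. LZ-no ($z_{no}$): the phrase has a copy fully contained in the concatenation of the previous phrases. LZ-End ($z_e$): the phrase has an occurrence in the concatenation of the previous phrases that ends at the end of a previous phrase. - $r(w)$ is the number of maximal runs of equal symbols in the Burrows-Wheeler transform of $w$, i.e. in the concatenation of the last symbols of the lexicographically sorted rotations of $w$. -}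

module Defs where

open import Data.Empty using (⊥)
open import Data.Fin using (Fin; toℕ)
open import Data.Fin.Subset using (Subset; ∣_∣) renaming (_∈_ to _∈ˢ_)
open import Data.Integer using (+_)
open import Data.List
  using (List; []; _∷_; _++_; length; map; foldr; take; drop; concat; concatMap;
         replicate; upTo; tabulate; lookup; deduplicate; derun; mapMaybe; last)
open import Data.List.Membership.Propositional using (_∈_)
open import Data.List.NonEmpty using (List⁺; toList)
import Data.List.NonEmpty as List⁺
open import Data.List.Properties using (≡-dec)
open import Data.List.Relation.Binary.Lex.NonStrict using (≤-decTotalOrder)
open import Data.List.Relation.Binary.Lex.Strict using (Lex-<)
open import Data.List.Relation.Binary.Pointwise using (Pointwise)
open import Data.List.Relation.Unary.All using (All)
import Data.List.Sort as Sort
open import Data.Nat using (ℕ; zero; suc; _+_; _∸_; _^_; _≤_; _<_; _≟_)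
open import Data.Nat.GeneralisedArithmetic using (fold)
open import Data.Nat.ListAction using (sum)
import Data.Nat.Properties as ℕₚ
open import Data.Product using (_×_; _,_; ∃; ∃-syntax; Σ-syntax)
open import Data.Rational using (ℚ; 0ℚ; _/_; _⊔_)
import Data.Rational as ℚ
open import Data.Unit using (⊤)
open import Function using (_↣_; Injection)
open import Relation.Binary.PropositionalEquality using (_≡_; _≢_)
open import Relation.Nullary using (¬_)

String : Set
String = List ℕ

-- The substring of length l that starts after the first i symbols of w (so i is
-- a 0-based position).  It is shorter than l when i + l exceeds the length of w;
-- the definitions below always bound i + l where that matters.
factor : String → ℕ → ℕ → String
factor w i l = take l (drop i w)

_<ˡᵉˣ_ : String → String → Set
_<ˡᵉˣ_ = Lex-< _≡_ _<_

-- A measure is given by its graph: μ w q says that μ(w) = q.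
Measure : Set₁
Measure = String → ℚ → Set

natural : (String → ℕ → Set) → Measure
natural f w q = ∃[ m ] f w m × q ≡ + m / 1

IsMinimum : (ℕ → Set) → ℕ → Set
IsMinimum P m = P m × (∀ k → P k → m ≤ k)

record StringFamily : Set₁ where
  field
    Member    : String → Set
    unbounded : ∀ N → ∃[ w ] Member w × N ≤ length w

open StringFamily public

_=o[_]_ : Measure → StringFamily → Measure → Set
f =o[ F ] g = ∀ (ε : ℚ) → 0ℚ ℚ.< ε → ∃[ N ]
  (∀ w → Member F w → N ≤ length w → ∀ p q → f w p → g w q → p ℚ.≤ ε ℚ.* q)

_=O[_]_ : Measure → StringFamily → Measure → Set
f =O[ F ] g = Σ[ C ∈ ℚ ] ∃[ N ]
  (∀ w → Member F w → N ≤ length w → ∀ p q → f w p → g w q → p ℚ.≤ C ℚ.* q)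

_=Ω[_]_ : Measure → StringFamily → Measure → Set
f =Ω[ F ] g = g =O[ F ] f

-- The alphabet is a finite set of symbols from ℕ, listed without repetition.
record LSystem : Set where
  field
    σ       : ℕ
    symbols : Fin σ ↣ ℕ
    φ       : Fin σ → List⁺ (Fin σ)
    τ       : Fin σ → Fin σ
    axiom   : List⁺ (Fin σ)
    d n     : ℕ
    1≤n     : 1 ≤ n

level : ∀ {A : Set} → (A → List⁺ A) → List A → ℕ → List A
level φ s d = fold s (concatMap (λ a → toList (φ a))) d

module _ (L : LSystem) where
  open LSystem L

  LGenerates : String → Set
  LGenerates w =
      n ≡ length w
    × n ≤ length (level φ (toList axiom) d)
    × w ≡ take n (map (λ a → Injection.to symbols (τ a)) (level φ (toList axiom) d))

  lSize : ℕ
  lSize = sum (tabulate λ a → List⁺.length (φ a)) + List⁺.length axiom + σ + 2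

-- The standing assumption d, |Σ| = n^O(1), with e the constant in the exponent.
-- For e ≥ 1 it is met by a system generating w, of length n ≥ 1, with axiom w.
LBounded : ℕ → LSystem → Set
LBounded e L = d ≤ n ^ e × σ ≤ n ^ e
  where open LSystem L

ℓ : ℕ → Measure
ℓ e = natural λ w → IsMinimum λ k →
  ∃[ L ] LBounded e L × LGenerates L w × lSize L ≡ k

-- ext a k i j is the extraction a(k)[i:j].
data Item (V : Set) : Set where
  letter : V → Item V
  ext    : (a : V) (k i j : ℕ) → Item V

itemSize : ∀ {V} → Item V → ℕ
itemSize (letter _)    = 1
itemSize (ext _ _ _ _) = 4

ItemBounded : ∀ {V} → ℕ → Item V → Set
ItemBounded n (letter _)    = ⊤
ItemBounded n (ext a k i j) = k ≤ n × 1 ≤ i × i ≤ j × j ≤ n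

-- One symbol position of a right-hand side: either a symbol, or a reference to
-- the p-th symbol of the k-th level from a.
data Cell (V : Set) : Set where
  lit : V → Cell V
  ref : (a : V) (k p : ℕ) → Cell V

itemCells : ∀ {V} → Item V → List (Cell V)
itemCells (letter a)    = lit a ∷ []
itemCells (ext a k i j) = map (λ t → ref a k (i + t)) (upTo (suc j ∸ i))

cells : ∀ {V} → List⁺ (Item V) → List (Cell V)
cells α = concatMap itemCells (toList α)

record NUSystem : Set where
  field
    σ       : ℕ
    symbols : Fin σ ↣ ℕ
    rule    : Fin σ → List⁺ (Item (Fin σ))
    τ       : Fin σ → Fin σ
    axiom   : List⁺ (Item (Fin σ))
    d n     : ℕ
    1≤n     : 1 ≤ n

module _ (N : NUSystem) where
  open NUSystem N

  -- Resolves x c : the cell x evaluates to the symbol c.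
  -- At a k p c   : the p-th symbol (from 1) of the k-th level from a is c.
  -- To locate position p of level k + 1, a prefix xs of level k is generated whose
  -- right-hand sides reach position p; only the cell at that position is then
  -- followed.  The definition being inductive, looping extractions have no value.
  mutual
    data Resolves : Cell (Fin σ) → Fin σ → Set where
      lit : ∀ {a} → Resolves (lit a) a
      ref : ∀ {a k p c} → At a k p c → Resolves (ref a k p) (τ c)

    data At (a : Fin σ) : ℕ → ℕ → Fin σ → Set where
      zero : At a 0 1 a
      suc  : ∀ {k c} (xs : List (Fin σ)) →
             (∀ i → At a k (suc (toℕ i)) (lookup xs i)) →
             let ys = concatMap (λ x → cells (rule x)) xs in
             (q : Fin (length ys)) → Resolves (lookup ys q) c →
             At a (suc k) (suc (toℕ q)) c

  Evaluates : List⁺ (Item (Fin σ)) → List⁺ (Fin σ) → Set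
  Evaluates α u = Pointwise Resolves (cells α) (toList u)

  NUGenerates : String → Set
  NUGenerates w = Σ[ φ ∈ (Fin σ → List⁺ (Fin σ)) ] ∃[ s ]
      (∀ a → Evaluates (rule a) (φ a))
    × Evaluates axiom s
    × n ≡ length w
    × n ≤ length (level φ (toList s) d)
    × w ≡ take n (map (λ a → Injection.to symbols (τ a)) (level φ (toList s) d))

  nuSize : ℕ
  nuSize = sum (tabulate λ a → itemsSize (rule a)) + itemsSize axiom + σ + 2
    where
    itemsSize : List⁺ (Item (Fin σ)) → ℕ
    itemsSize α = sum (map itemSize (toList α))

-- d and the alphabet are bounded polynomially, as for L-systems; the indexes
-- inside extraction symbols are at most n.
NUBounded : ℕ → NUSystem → Set
NUBounded e N =
    d ≤ n ^ e × σ ≤ n ^ e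
  × (∀ a → All (ItemBounded n) (toList (rule a)))
  × All (ItemBounded n) (toList axiom)
  where open NUSystem N

ν : ℕ → Measure
ν e = natural λ w → IsMinimum λ k →
  ∃[ N ] NUBounded e N × NUGenerates N w × nuSize N ≡ k

distinctFactors : String → ℕ → ℕ
distinctFactors w k =
  length (deduplicate (≡-dec _≟_) (map (λ i → factor w i k) (upTo (suc (length w) ∸ k))))

δ : Measure
δ w q = q ≡ foldr _⊔_ 0ℚ
  (map (λ k → + distinctFactors w (suc k) / suc k) (upTo (length w)))

IsAttractor : (w : String) → Subset (length w) → Set
IsAttractor w Γ = ∀ i l → 1 ≤ l → i + l ≤ length w →
  ∃[ j ] j + l ≤ length w × factor w j l ≡ factor w i l
       × (∃[ p ] p ∈ˢ Γ × j ≤ toℕ p × toℕ p < j + l)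

γ : Measure
γ = natural λ w → IsMinimum λ k → ∃[ Γ ] IsAttractor w Γ × ∣ Γ ∣ ≡ k

data Phrase : Set where
  explicit : ℕ → Phrase
  copy     : (source len : ℕ) → Phrase

-- Factorizes w i ps : the phrases ps factorize the suffix of w at position i.
data Factorizes (w : String) : ℕ → List Phrase → Set where
  done     : Factorizes w (length w) []
  explicit : ∀ {i a ps} → factor w i 1 ≡ a ∷ [] → Factorizes w (suc i) ps →
             Factorizes w i (explicit a ∷ ps)
  copy     : ∀ {i s l ps} → 1 ≤ l → s ≢ i →
             i + l ≤ length w → s + l ≤ length w → factor w i l ≡ factor w s l →
             Factorizes w (i + l) ps →
             Factorizes w i (copy s l ∷ ps)

data Pointer : Set where
  symbol : ℕ → Pointer
  goto   : ℕ → Pointer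

pointers : Phrase → List Pointer
pointers (explicit a) = symbol a ∷ []
pointers (copy s l)   = map (λ t → goto (s + t)) (upTo l)

-- Recovers ps x a : following the pointers of ps from x ends in the symbol a.
data Recovers (ps : List Phrase) : Pointer → ℕ → Set where
  symbol : ∀ {a} → Recovers ps (symbol a) a
  goto   : ∀ {a} (i : Fin (length (concatMap pointers ps))) →
           Recovers ps (lookup (concatMap pointers ps) i) a →
           Recovers ps (goto (toℕ i)) a

IsMacroScheme : String → List Phrase → Set
IsMacroScheme w ps =
  Factorizes w 0 ps × Pointwise (Recovers ps) (concatMap pointers ps) w

b : Measure
b = natural λ w → IsMinimum λ k → ∃[ ps ] IsMacroScheme w ps × length ps ≡ k

ImmediatelyPrecedes : String → ℕ → ℕ → Set
ImmediatelyPrecedes w j i =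
    j < length w
  × drop j w <ˡᵉˣ drop i w
  × (∀ k → k < length w → ¬ (drop j w <ˡᵉˣ drop k w × drop k w <ˡᵉˣ drop i w))

-- LCP u v l : the longest common prefix of u and v has length l.
data LCP : String → String → ℕ → Set where
  leftEnd  : ∀ {v} → LCP [] v 0
  rightEnd : ∀ {u} → LCP u [] 0
  differ   : ∀ {x y u v} → x ≢ y → LCP (x ∷ u) (y ∷ v) 0
  agree    : ∀ {x u v l} → LCP u v l → LCP (x ∷ u) (x ∷ v) (suc l)

-- LexParse w i k : the lex-parse of w has k phrases from position i on, where i
-- is the start of a phrase.
data LexParse (w : String) : ℕ → ℕ → Set where
  done     : LexParse w (length w) 0
  copy     : ∀ {i j l k} → i < length w →
             ImmediatelyPrecedes w j i → LCP (drop i w) (drop j w) l → 1 ≤ l →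
             LexParse w (i + l) k → LexParse w i (suc k)
  explicit : ∀ {i k} → i < length w →
             (∀ j → ImmediatelyPrecedes w j i → LCP (drop i w) (drop j w) 0) →
             LexParse w (suc i) k → LexParse w i (suc k)

v : Measure
v = natural λ w k → LexParse w 0 k

data Symbol (m : ℕ) : Set where
  term : ℕ → Symbol m
  var  : Fin m → Symbol m

data Rule (m : ℕ) : Set where
  concatenation : List⁺ (Symbol m) → Rule m
  power         : Symbol m → (k : ℕ) → 1 < k → Rule m
  prefix suffix : Fin m → (t : ℕ) → Rule m

-- The constant size of the run-length and truncation rules is taken to be 2.
ruleSize : ∀ {m} → Rule m → ℕ
ruleSize (concatenation α) = List⁺.length α
ruleSize (power _ _ _)     = 2
ruleSize (prefix _ _)      = 2
ruleSize (suffix _ _)      = 2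

data Kind : Set where
  slp rlslp collage : Kind

Allowed : ∀ {m} → Kind → Rule m → Set
Allowed _       (concatenation _) = ⊤
Allowed slp     (power _ _ _)     = ⊥
Allowed _       (power _ _ _)     = ⊤
Allowed collage (prefix _ _)      = ⊤
Allowed _       (prefix _ _)      = ⊥
Allowed collage (suffix _ _)      = ⊤
Allowed _       (suffix _ _)      = ⊥

record Grammar (κ : Kind) : Set where
  field
    m       : ℕ
    rule    : Fin m → Rule m
    allowed : ∀ A → Allowed κ (rule A)
    start   : Fin m

module _ {κ : Kind} (G : Grammar κ) where
  open Grammar G

  -- Each variable has a single rule, so a variable expands to at most one string,
  -- and to none if its derivation loops.
  mutual
    data Expands : Symbol m → String → Set where
      term : ∀ {a} → Expands (term a) (a ∷ [])
      var  : ∀ {A u} → RuleExpands (rule A) u → Expands (var A) u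

    data SeqExpands : List (Symbol m) → String → Set where
      []  : SeqExpands [] []
      _∷_ : ∀ {X Xs u us} → Expands X u → SeqExpands Xs us →
            SeqExpands (X ∷ Xs) (u ++ us)

    data RuleExpands : Rule m → String → Set where
      concatenation : ∀ {α u} → SeqExpands (toList α) u →
                      RuleExpands (concatenation α) u
      power         : ∀ {X k 1<k u} → Expands X u →
                      RuleExpands (power X k 1<k) (concat (replicate k u))
      prefix        : ∀ {B t u} → Expands (var B) u → t ≤ length u →
                      RuleExpands (prefix B t) (take t u)
      suffix        : ∀ {B t u} → Expands (var B) u → t ≤ length u →
                      RuleExpands (suffix B t) (drop (length u ∸ t) u)

  grammarSize : ℕ
  grammarSize = sum (tabulate λ A → ruleSize (rule A))

smallestGrammar : Kind → Measure
smallestGrammar κ = natural λ w → IsMinimum λ k →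
  Σ[ G ∈ Grammar κ ] Expands G (var (Grammar.start G)) w × grammarSize G ≡ k

g gᵣₗ c : Measure
g   = smallestGrammar slp
gᵣₗ = smallestGrammar rlslp
c   = smallestGrammar collage

-- A condition on a phrase of length l starting at position i, given the end
-- positions of the previous phrases (a phrase w[s..e) has end position e).
PhraseCondition : Set₁
PhraseCondition = (ends : List ℕ) (i l : ℕ) → Set

-- GreedyParse w C es i k : the greedy parsing of w under C has k phrases from
-- position i on, where the phrases before i end at the positions es.
data GreedyParse (w : String) (C : PhraseCondition) : List ℕ → ℕ → ℕ → Set where
  done   : ∀ {es} → GreedyParse w C es (length w) 0
  phrase : ∀ {es i l k} → 1 ≤ l → i + l ≤ length w → C es i l →
           (∀ l′ → i + l′ ≤ length w → C es i l′ → l′ ≤ l) →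
           GreedyParse w C (i + l ∷ es) (i + l) k → GreedyParse w C es i (suc k)
  single : ∀ {es i k} → i < length w →
           (∀ l → 1 ≤ l → i + l ≤ length w → ¬ C es i l) →
           GreedyParse w C (suc i ∷ es) (suc i) k → GreedyParse w C es i (suc k)

greedy : (String → PhraseCondition) → Measure
greedy C = natural λ w k → GreedyParse w (C w) [] 0 k

z zₙₒ zₑ : Measure
z   = greedy λ w es i l → ∃[ j ] j < i × factor w j l ≡ factor w i l
zₙₒ = greedy λ w es i l → ∃[ j ] j + l ≤ i × factor w j l ≡ factor w i l
zₑ  = greedy λ w es i l → ∃[ j ] j + l ∈ es × factor w j l ≡ factor w i l

open Sort (≤-decTotalOrder ℕₚ.≤-decTotalOrder) using (sort)

bwt : String → String
bwt w = mapMaybe last (sort (map (λ i → drop i w ++ take i w) (upTo (length w))))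

r : Measure
r = natural λ w k → k ≡ length (derun _≟_ (bwt w))

measures : List Measure
measures = δ ∷ γ ∷ b ∷ v ∷ c ∷ gᵣₗ ∷ z ∷ zₙₒ ∷ zₑ ∷ r ∷ []

{-# OPTIONS --safe #-}
module Submission where

-- ℓ versus small: the system s → s t, t → a t, a → a (read with s = t = 1 and a = 0) generates
-- 1 1 0 1 0 0 1 ⋯ 0^(m-1) 1 with bounded size.  This word contains all markers 1 0^j 1 with
-- j < m, and the boundary between two consecutive positions meets at most one of them.  In a
-- parsing some occurrence of each marker crosses a phrase boundary, in a grammar it crosses a
-- junction of a right-hand side, and in the sorted rotations those starting with 0^j 1 end both
-- in 0 and in 1; so each measure is at least linear in m.  For δ the factors of length k
-- starting with 0^i 1 0^j 1 number order k².
--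
-- ℓ versus large: among the words 0^r₀ 1 0^r₁ 1 ⋯ 0^rₜ 1 with r₀ of order 2^t above the other rᵢ,
-- every measure is O(t), but there are 2^(t²) of them, whereas the L-systems of size h t with
-- d and n at most 2^O(t h) number only 2^O(h t log (h t)).  Hence one of them has ℓ ≥ h t.

-- Each family is chosen before the exponent `e`. On the first one the constant 11 serves all `e`.
-- On the second, word number `h` resists the systems of every exponent up to `h`, so a fixed `e`
-- loses only finitely many indices. For the counting, `t` must outgrow `h` times the bit length of
-- `h * t`; the choice t = 64 · 8^h makes that of order h², which `t` exceeds.
--
-- The long first run is a store of zeros: every later run is a copy of a part of it, and its
-- suffixes precede the later ones in the lexicographic order. Building it costs the greedy parsings
-- about log r₀, which is of order t and so within the budget. Each later run carries t bits of
-- information, whence t² bits in all.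
--
-- Symbols are arbitrary naturals, so there are infinitely many L-systems of a given size. As the
-- words are binary, a system is recorded up to the names of its letters, with its final symbols
-- clamped to 0 and 1.
--
-- The bounds start from the definition of each measure instead of the known inequalities between
-- the measures; only the argument for δ ≤ γ reappears, in the upper bound for δ.

open import Defs
open import Data.Bool using (true; false; T)
open import Data.Empty using (⊥)
import Data.Fin as Fin
open import Data.Fin using (Fin; zero; suc; toℕ; fromℕ<)
import Data.Fin.Induction as FinInduction
import Data.Fin.Properties as Finₚ
open import Data.Fin.Subset using (Subset; ∣_∣; inside; outside) renaming (_∈_ to _∈ˢ_)
open import Data.Integer using (+_; -[1+_])
import Data.Integer as ℤ
import Data.Integer.Properties as ℤₚ
open import Data.List hiding (sum)
open import Data.List.Membership.Propositional using (_∈_)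
open import Data.List.Membership.Propositional.Properties
open import Data.List.NonEmpty as List⁺ using (List⁺; _∷_)
open import Data.List.Properties hiding (sum-++)
open import Data.List.Relation.Binary.Lex.Core using (base; halt; this; next)
open import Data.List.Relation.Binary.Lex.NonStrict using (≤-decTotalOrder)
import Data.List.Relation.Binary.Lex.Strict as Lex
open import Data.List.Relation.Binary.Permutation.Propositional using (↭-sym)
import Data.List.Relation.Binary.Permutation.Propositional.Properties as Permₚ
open import Data.List.Relation.Binary.Pointwise using (Pointwise; []; _∷_; ≡⇒Pointwise-≡)
  renaming (++⁺ to ++⁺-Pointwise)
open import Data.List.Relation.Unary.All as All using (All; []; _∷_)
import Data.List.Relation.Unary.All.Properties as Allₚ
open import Data.List.Relation.Unary.AllPairs using (AllPairs; []; _∷_)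
open import Data.List.Relation.Unary.Any as Any using (here; there)
import Data.List.Relation.Unary.Any.Properties as Anyₚ
import Data.List.Relation.Unary.Linked.Properties as Linkedₚ
open import Data.List.Relation.Unary.Unique.Propositional using (Unique)
import Data.List.Relation.Unary.Unique.DecPropositional.Properties as DecUniqueₚ
import Data.List.Relation.Unary.Unique.Propositional.Properties as Uniqueₚ
import Data.List.Sort as Sort
open import Data.Maybe using (just; nothing; maybe′)
open import Data.Maybe.Properties using (just-injective)
open import Data.Nat
  using (ℕ; zero; suc; _+_; _*_; _∸_; _^_; _⊓_; _≤_; _<_; z≤n; s≤s; s≤s⁻¹; NonZero; _≟_; _<?_; _≤?_)
import Data.Nat as ℕ
import Data.Nat.Coprimality as Coprimality
open import Data.Nat.GeneralisedArithmetic using (fold)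
open import Data.Nat.Induction using (<-wellFounded)
open import Data.Nat.ListAction using (sum)
open import Data.Nat.ListAction.Properties using (sum-++; sum-↭)
open import Data.Nat.Properties as ℕₚ hiding (_≟_; _<?_; _≤?_; ≤-decTotalOrder)
open import Data.Nat.Solver using (module +-*-Solver)
open import Data.Product using (_×_; _,_; ∃-syntax; Σ-syntax; proj₁; proj₂)
open import Data.Rational using (ℚ; 0ℚ; mkℚ; _/_; toℚᵘ)
import Data.Rational as ℚ
import Data.Rational.Properties as ℚₚ
import Data.Rational.Unnormalised as ℚᵘ
import Data.Rational.Unnormalised.Properties as ℚᵘₚ
open import Data.Sum using (_⊎_; inj₁; inj₂)
open import Data.Unit using (⊤; tt)
import Data.Vec as Vec
open import Function using (_∘_; id; _↣_; mk↣; Injection)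
open import Induction.WellFounded using (Acc; acc)
open import Relation.Binary using (DecTotalOrder; IsStrictPartialOrder)
open import Relation.Binary.PropositionalEquality hiding ([_])
open import Relation.Nullary using (¬_; Dec; yes; no; contradiction)
open import Data.List.Membership.DecPropositional _≟_ using (_∈?_)

-- Rational bounds and comparison of measures

/1-unnormalised : ∀ i n → toℚᵘ (i / suc n) ℚᵘ.≃ ℚᵘ.mkℚᵘ i n
/1-unnormalised i n = ℚₚ.toℚᵘ-fromℚᵘ (ℚᵘ.mkℚᵘ i n)

/-mono-≤ : ∀ a m b n → a * suc n ≤ b * suc m → + a / suc m ℚ.≤ + b / suc n
/-mono-≤ a m b n h = ℚₚ.toℚᵘ-cancel-≤ (begin
  toℚᵘ (+ a / suc m)  ≃⟨ /1-unnormalised (+ a) m ⟩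
  ℚᵘ.mkℚᵘ (+ a) m     ≤⟨ ℚᵘ.*≤* (subst₂ ℤ._≤_ (ℤₚ.pos-* a (suc n)) (ℤₚ.pos-* b (suc m)) (ℤ.+≤+ h)) ⟩
  ℚᵘ.mkℚᵘ (+ b) n     ≃⟨ ℚᵘₚ.≃-sym (/1-unnormalised (+ b) n) ⟩
  toℚᵘ (+ b / suc n)  ∎)
  where open ℚᵘₚ.≤-Reasoning

/1-mono-≤ : ∀ {a b} → a ≤ b → + a / 1 ℚ.≤ + b / 1
/1-mono-≤ {a} {b} h = /-mono-≤ a 0 b 0 (*-monoˡ-≤ 1 h)

/1≤*/1 : ∀ {ε : ℚ} {a b} → + a ℤ.* ℚ.↧ ε ℤ.≤ ℚ.↥ ε ℤ.* + b → + a / 1 ℚ.≤ ε ℚ.* (+ b / 1)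
/1≤*/1 {ε@record{ numerator = n; denominator-1 = k }} {a} {b} h = ℚₚ.toℚᵘ-cancel-≤ (begin
  toℚᵘ (+ a / 1)               ≃⟨ /1-unnormalised (+ a) 0 ⟩
  ℚᵘ.mkℚᵘ (+ a) 0              ≤⟨ ℚᵘ.*≤* cross ⟩
  toℚᵘ ε ℚᵘ.* ℚᵘ.mkℚᵘ (+ b) 0  ≃⟨ ℚᵘₚ.*-congˡ {x = toℚᵘ ε} (ℚᵘₚ.≃-sym (/1-unnormalised (+ b) 0)) ⟩
  toℚᵘ ε ℚᵘ.* toℚᵘ (+ b / 1)   ≃⟨ ℚᵘₚ.≃-sym (ℚₚ.toℚᵘ-homo-* ε (+ b / 1)) ⟩
  toℚᵘ (ε ℚ.* (+ b / 1))       ∎)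
  where
  open ℚᵘₚ.≤-Reasoning
  cross : + a ℤ.* + (suc k * 1) ℤ.≤ n ℤ.* + b ℤ.* + 1
  cross = subst₂ ℤ._≤_ (cong (λ x → + a ℤ.* + x) (sym (*-identityʳ (suc k)))) (sym (ℤₚ.*-identityʳ (n ℤ.* + b))) h

foldr-⊔-≤ : ∀ {q xs} → 0ℚ ℚ.≤ q → All (ℚ._≤ q) xs → foldr ℚ._⊔_ 0ℚ xs ℚ.≤ q
foldr-⊔-≤ 0≤q []       = 0≤q
foldr-⊔-≤ 0≤q (h ∷ hs) = ℚₚ.⊔-lub h (foldr-⊔-≤ 0≤q hs)

∈⇒≤foldr-⊔ : ∀ {q xs} → q ∈ xs → q ℚ.≤ foldr ℚ._⊔_ 0ℚ xs
∈⇒≤foldr-⊔ {xs = x ∷ xs} (here refl) = ℚₚ.p≤p⊔q x _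
∈⇒≤foldr-⊔ {xs = x ∷ xs} (there q∈)  = ℚₚ.≤-trans (∈⇒≤foldr-⊔ q∈) (ℚₚ.p≤q⊔p x _)

-- Families given by a sequence of words

sequenceFamily : (W : ℕ → String) → (∀ h → h ≤ length (W h)) → StringFamily
sequenceFamily W unb = record
  { Member    = λ w → ∃[ h ] w ≡ W h
  ; unbounded = λ N → W N , (N , refl) , unb N }

-- Exceeds the lengths of all words of smaller index. A maximum is taken because lengths are not
-- assumed to increase with the index.
lengthBound : (ℕ → String) → ℕ → ℕ
lengthBound W zero    = 0
lengthBound W (suc h) = suc (length (W h)) ℕ.⊔ lengthBound W h

long⇒index≥ : ∀ W H {h} → lengthBound W H ≤ length (W h) → H ≤ h
long⇒index≥ W zero    _  = z≤n
long⇒index≥ W (suc H) {h} le with m≤n⇒m<n∨m≡n (long⇒index≥ W H {h} (m⊔n≤o⇒n≤o (suc (length (W H))) (lengthBound W H) le))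
... | inj₁ H<h  = H<h
... | inj₂ refl = contradiction (m⊔n≤o⇒m≤o (suc (length (W H))) (lengthBound W H) le) (<⇒≱ (n<1+n _))

-- The ratio of the measures is at most c / h, which tends to 0 along the sequence. The naturals `a`
-- and `b` placed between the values let the rational measure δ stand on either side; `h₀` discards
-- words that come too early for a given exponent.
=o-sequence : ∀ {f g : Measure} W unb c .{{_ : NonZero c}} h₀ →
  (∀ {h p q} → h₀ ≤ h → f (W h) p → g (W h) q →
     ∃[ a ] ∃[ b ] p ℚ.≤ + a / 1 × + b / 1 ℚ.≤ q × h * a ≤ c * b) →
  f =o[ sequenceFamily W unb ] g
=o-sequence W unb c h₀ bound (mkℚ (+ 0) _ _) (ℚ.*<* (ℤ.+<+ ()))
=o-sequence W unb c h₀ bound (mkℚ (-[1+ _ ]) _ _) (ℚ.*<* ())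
=o-sequence W unb c h₀ bound ε@(mkℚ (+ suc n) k _) 0<ε = lengthBound W H , go
  where
  -- Since ε ≥ 1 / suc k, an index of at least c * suc k makes c / h at most ε.
  H = h₀ ℕ.⊔ c * suc k
  go : ∀ w → ∃[ h ] w ≡ W h → lengthBound W H ≤ length w → ∀ p q → _ → _ → p ℚ.≤ ε ℚ.* q
  go w (h , refl) long p q fp gq =
    let H≤h = long⇒index≥ W H long
        a , b , p≤a , b≤q , ha≤cb = bound (m⊔n≤o⇒m≤o h₀ _ H≤h) fp gq
        ak≤b : a * suc k ≤ b
        ak≤b = *-cancelˡ-≤ c (begin
          c * (a * suc k)  ≡⟨ cong (c *_) (*-comm a (suc k)) ⟩
          c * (suc k * a)  ≡⟨ sym (*-assoc c (suc k) a) ⟩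
          c * suc k * a    ≤⟨ *-monoˡ-≤ a (m⊔n≤o⇒n≤o h₀ _ H≤h) ⟩
          h * a            ≤⟨ ha≤cb ⟩
          c * b            ∎)
    in ℚₚ.≤-trans p≤a (ℚₚ.≤-trans
         (/1≤*/1 {ε} {a} {b} (subst₂ ℤ._≤_ (ℤₚ.pos-* a (suc k)) (ℤₚ.pos-* (suc n) b)
           (ℤ.+≤+ (≤-trans ak≤b (m≤n*m b (suc n))))))
         (ℚₚ.*-monoˡ-≤-nonNeg ε b≤q))
    where open ≤-Reasoning

-- The threshold 1 discards the empty word, for which no L-system can be built because its length
-- field is at least 1.
=O-natural : ∀ {f g : String → ℕ → Set} F c →
  (∀ {w a b} → 1 ≤ length w → f w a → g w b → a ≤ c * b) →
  natural f =O[ F ] natural g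
=O-natural F c bound = C , 1 , λ w _ 1≤w p q (a , fa , p≡) (b , gb , q≡) →
  subst₂ (λ p q → p ℚ.≤ C ℚ.* q) (sym p≡) (sym q≡)
    (/1≤*/1 {C} {a} {b} (subst₂ ℤ._≤_ (ℤₚ.pos-* a 1) (ℤₚ.pos-* c b)
      (ℤ.+≤+ (subst (_≤ c * b) (sym (*-identityʳ a)) (bound 1≤w fa gb)))))
  where
  C = mkℚ (+ c) 0 (Coprimality.sym (Coprimality.1-coprimeTo c))

-- Counting by charging

lookup-injective : ∀ {A : Set} {xs : List A} → Unique xs → ∀ {i j} → lookup xs i ≡ lookup xs j → i ≡ j
lookup-injective (_ ∷ _)   {zero}  {zero}  _  = refl
lookup-injective {xs = x ∷ xs} (x∉ ∷ _) {zero}  {suc j} eq = contradiction eq (All.lookup x∉ (∈-lookup j))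
lookup-injective {xs = x ∷ xs} (x∉ ∷ _) {suc i} {zero}  eq = contradiction (sym eq) (All.lookup x∉ (∈-lookup i))
lookup-injective (_ ∷ uniq) {suc i} {suc j} eq = cong suc (lookup-injective uniq eq)

-- The counting principle behind the lower bounds: `ys` are distinct objects, each charged to a
-- place in `xs`, and a place determines what is charged to it. A relation serves better than a
-- function, since many places carry no charge at all.
length-≤-by : ∀ {A B : Set} (R : A → B → Set) → (∀ {a b b′} → R a b → R a b′ → b ≡ b′) →
  (xs : List A) {ys : List B} → Unique ys →
  (∀ {y} → y ∈ ys → ∃[ a ] a ∈ xs × R a y) → length ys ≤ length xs
length-≤-by R functional xs {ys} uniq assign = Finₚ.injective⇒≤ {f = f} λ {i} {j} eq →
  lookup-injective uniq (functional (related i) (subst (λ a → R a _) (sym (same i j eq)) (related j)))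
  where
  code : ∀ i → ∃[ a ] a ∈ xs × R a (lookup ys i)
  code i = assign (∈-lookup i)
  f : Fin (length ys) → Fin (length xs)
  f i = Any.index (proj₁ (proj₂ (code i)))
  related : ∀ i → R (proj₁ (code i)) (lookup ys i)
  related i = proj₂ (proj₂ (code i))
  same : ∀ i j → f i ≡ f j → proj₁ (code i) ≡ proj₁ (code j)
  same i j eq = trans (Anyₚ.lookup-index (proj₁ (proj₂ (code i))))
    (trans (cong (lookup xs) eq) (sym (Anyₚ.lookup-index (proj₁ (proj₂ (code j))))))

-- L-systems as NU-systems

module _ (L : LSystem) where
  open LSystem L

  toNUSystem : NUSystem
  toNUSystem = record
    { σ = σ ; symbols = symbols ; rule = λ a → List⁺.map letter (φ a) ; τ = τ
    ; axiom = List⁺.map letter axiom ; d = d ; n = n ; 1≤n = 1≤n }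

  cells-letters : ∀ (as : List (Fin σ)) → concatMap itemCells (map letter as) ≡ map lit as
  cells-letters []       = refl
  cells-letters (a ∷ as) = cong (lit a ∷_) (cells-letters as)

  Evaluates-letters : ∀ as → Evaluates toNUSystem (List⁺.map letter as) as
  Evaluates-letters as = subst (λ xs → Pointwise (Resolves toNUSystem) xs (List⁺.toList as))
    (sym (cells-letters (List⁺.toList as))) (go (List⁺.toList as))
    where
    go : ∀ as → Pointwise (Resolves toNUSystem) (map lit as) as
    go []       = []
    go (a ∷ as) = lit ∷ go as

  toNUSystem-generates : ∀ {w} → LGenerates L w → NUGenerates toNUSystem w
  toNUSystem-generates (n≡ , n≤ , w≡) =
    φ , axiom , (λ a → Evaluates-letters (φ a)) , Evaluates-letters axiom , n≡ , n≤ , w≡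

  All-ItemBounded : ∀ (as : List (Fin σ)) → All (ItemBounded n) (map letter as)
  All-ItemBounded []       = []
  All-ItemBounded (a ∷ as) = tt ∷ All-ItemBounded as

  toNUSystem-bounded : ∀ {e} → LBounded e L → NUBounded e toNUSystem
  toNUSystem-bounded (d≤ , σ≤) =
    d≤ , σ≤ , (λ a → All-ItemBounded (List⁺.toList (φ a))) , All-ItemBounded (List⁺.toList axiom)

  size-letters : ∀ (as : List⁺ (Fin σ)) → sum (map itemSize (List⁺.toList (List⁺.map letter as))) ≡ List⁺.length as
  size-letters (a ∷ as) = cong suc (go as)
    where
    go : ∀ as → sum (map itemSize (map letter as)) ≡ length as
    go []       = refl
    go (a ∷ as) = cong suc (go as)

  nuSize-toNUSystem : nuSize toNUSystem ≡ lSize L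
  nuSize-toNUSystem = cong₂ (λ x y → x + y + σ + 2)
    (cong sum (tabulate-cong (λ a → size-letters (φ a)))) (size-letters axiom)

ℓ=Ων : ∀ F e → ℓ e =Ω[ F ] ν e
ℓ=Ων F e = =O-natural F 1 λ { _ (_ , ν-min) ((L , bounded , gen , refl) , _) →
  ≤-trans (ν-min _ (toNUSystem L , toNUSystem-bounded L {e} bounded , toNUSystem-generates L gen , nuSize-toNUSystem L))
          (≤-reflexive (sym (*-identityˡ _))) }

-- Grammars

module _ {κ : Kind} {G : Grammar κ} where
  open Grammar G

  mutual
    -- The number of rewriting steps after which an L-system imitating the grammar has only
    -- terminals left. Terminals have height 0 because they will be fixed by the morphism.
    height : ∀ {X u} → Expands G X u → ℕ
    height term    = 0
    height (var D) = suc (ruleHeight D)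

    seqHeight : ∀ {Xs u} → SeqExpands G Xs u → ℕ
    seqHeight []       = 0
    seqHeight (D ∷ Ds) = height D ℕ.⊔ seqHeight Ds

    ruleHeight : ∀ {R u} → RuleExpands G R u → ℕ
    ruleHeight (concatenation Ds) = seqHeight Ds
    ruleHeight (power D)          = height D
    ruleHeight (prefix D _)       = height D
    ruleHeight (suffix D _)       = height D

  mutual
    -- Rules are deterministic, so two derivations have the same shape. The equality of heights is
    -- what makes the height a function of the variable in `height≤m`.
    expands-unique : ∀ {X u u′} (D : Expands G X u) (D′ : Expands G X u′) →
      u ≡ u′ × height D ≡ height D′
    expands-unique term    term     = refl , refl
    expands-unique (var D) (var D′) with rule-unique D D′
    ... | u≡ , h≡ = u≡ , cong suc h≡

    seq-unique : ∀ {Xs u u′} (D : SeqExpands G Xs u) (D′ : SeqExpands G Xs u′) →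
      u ≡ u′ × seqHeight D ≡ seqHeight D′
    seq-unique []       []         = refl , refl
    seq-unique (D ∷ Ds) (D′ ∷ Ds′) with expands-unique D D′ | seq-unique Ds Ds′
    ... | refl , h≡ | refl , hs≡ = refl , cong₂ ℕ._⊔_ h≡ hs≡

    rule-unique : ∀ {R u u′} (D : RuleExpands G R u) (D′ : RuleExpands G R u′) →
      u ≡ u′ × ruleHeight D ≡ ruleHeight D′
    rule-unique (concatenation D)  (concatenation D′) = seq-unique D D′
    rule-unique (power D)          (power D′)     with expands-unique D D′
    ... | refl , h≡ = refl , h≡
    rule-unique (prefix D _)       (prefix D′ _)  with expands-unique D D′
    ... | refl , h≡ = refl , h≡
    rule-unique (suffix D _)       (suffix D′ _)  with expands-unique D D′
    ... | refl , h≡ = refl , h≡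

  VarOfHeight : ℕ → Set
  VarOfHeight h = ∃[ A ] ∃[ u ] Σ[ D ∈ Expands G (var A) u ] height D ≡ h

  mutual
    heights-attained : ∀ {X u} (D : Expands G X u) {i} → i < height D → VarOfHeight (suc i)
    heights-attained (var {A} {u} D) i< with m≤n⇒m<n∨m≡n i<
    ... | inj₁ (s≤s i<′) = ruleHeights-attained D i<′
    ... | inj₂ i≡        = A , u , var D , sym i≡

    seqHeights-attained : ∀ {Xs u} (D : SeqExpands G Xs u) {i} → i < seqHeight D → VarOfHeight (suc i)
    seqHeights-attained (D ∷ Ds) {i} i< with i <? height D
    ... | yes i<D = heights-attained D i<D
    ... | no  i≮D = seqHeights-attained Ds (≰⇒> λ Ds≤i → <⇒≱ i< (⊔-lub (≮⇒≥ i≮D) Ds≤i))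

    ruleHeights-attained : ∀ {R u} (D : RuleExpands G R u) {i} → i < ruleHeight D → VarOfHeight (suc i)
    ruleHeights-attained (concatenation D) i< = seqHeights-attained D i<
    ruleHeights-attained (power D)         i< = heights-attained D i<
    ruleHeights-attained (prefix D _)      i< = heights-attained D i<
    ruleHeights-attained (suffix D _)      i< = heights-attained D i<

  -- Each value up to the height is the height of a variable, and a variable has one height.
  height≤m : ∀ {X u} (D : Expands G X u) → height D ≤ m
  height≤m D = Finₚ.injective⇒≤ {f = λ i → proj₁ (at i)} λ {i} {j} → inj i j
    where
    at : (i : Fin (height D)) → VarOfHeight (suc (toℕ i))
    at i = heights-attained D (Finₚ.toℕ<n i)
    same : ∀ {h h′} (x : VarOfHeight h) (y : VarOfHeight h′) → proj₁ x ≡ proj₁ y → h ≡ h′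
    same (_ , _ , D₁ , refl) (_ , _ , D₂ , refl) refl = proj₂ (expands-unique D₁ D₂)
    inj : ∀ i j → proj₁ (at i) ≡ proj₁ (at j) → i ≡ j
    inj i j eq = Finₚ.toℕ-injective (suc-injective (same (at i) (at j) eq))

-- Levels of a morphism, finite sums and distinct symbols

module _ {A : Set} (φ : A → List⁺ A) where

  level-++ : ∀ s t d → level φ (s ++ t) d ≡ level φ s d ++ level φ t d
  level-++ s t zero    = refl
  level-++ s t (suc d) = trans (cong (concatMap _) (level-++ s t d)) (concatMap-++ _ (level φ s d) _)

  -- `fold` applies the morphism last, whereas an induction on derivations has to expand the
  -- starting symbol first.
  level-suc : ∀ s d → level φ s (suc d) ≡ level φ (concatMap (λ a → List⁺.toList (φ a)) s) d
  level-suc s zero    = refl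
  level-suc s (suc d) = cong (concatMap _) (level-suc s d)

  level-fixed : ∀ {a} → φ a ≡ a ∷ [] → ∀ d → level φ (a ∷ []) d ≡ a ∷ []
  level-fixed eq zero    = refl
  level-fixed eq (suc d) rewrite level-fixed eq d | eq = refl

sum-tabulate-+ : ∀ m n (f : Fin (m + n) → ℕ) →
  sum (tabulate f) ≡ sum (tabulate (λ i → f (i Fin.↑ˡ n))) + sum (tabulate (λ i → f (m Fin.↑ʳ i)))
sum-tabulate-+ zero    n f = refl
sum-tabulate-+ (suc m) n f = trans (cong (_+_ (f zero)) (sum-tabulate-+ m n (f ∘ suc))) (sym (+-assoc (f zero) _ _))

sum-tabulate-mono : ∀ {n} {f g : Fin n → ℕ} → (∀ i → f i ≤ g i) → sum (tabulate f) ≤ sum (tabulate g)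
sum-tabulate-mono {zero}  f≤g = z≤n
sum-tabulate-mono {suc n} f≤g = +-mono-≤ (f≤g zero) (sum-tabulate-mono (f≤g ∘ suc))

sum-tabulate-const : ∀ n {f : Fin n → ℕ} {c} → (∀ i → f i ≡ c) → sum (tabulate f) ≡ n * c
sum-tabulate-const zero    f≡ = refl
sum-tabulate-const (suc n) f≡ = cong₂ _+_ (f≡ zero) (sum-tabulate-const n (f≡ ∘ suc))

length-concat-tabulate : ∀ {A : Set} {n} (f : Fin n → List A) →
  length (concat (tabulate f)) ≡ sum (tabulate (length ∘ f))
length-concat-tabulate {n = zero}  f = refl
length-concat-tabulate {n = suc n} f = trans (length-++ (f zero)) (cong (_+_ (length (f zero))) (length-concat-tabulate (f ∘ suc)))

∈⇒≤sum : ∀ {x xs} → x ∈ xs → x ≤ sum xs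
∈⇒≤sum {xs = x ∷ xs} (here refl) = m≤m+n x _
∈⇒≤sum {xs = x ∷ xs} (there x∈)  = ≤-trans (∈⇒≤sum x∈) (m≤n+m _ x)

length-⁺map : ∀ {A B : Set} (f : A → B) xs → List⁺.length (List⁺.map f xs) ≡ List⁺.length xs
length-⁺map f (x ∷ xs) = cong suc (length-map f xs)

n≤n^e : ∀ n {e} → 1 ≤ e → n ≤ n ^ e
n≤n^e zero    _ = z≤n
n≤n^e n@(suc _) {e} 1≤e = ≤-trans (≤-reflexive (sym (^-identityʳ n))) (^-monoʳ-≤ n {1} {e} 1≤e)

distinct : String → String
distinct = deduplicate _≟_

distinct-unique : ∀ xs → Unique (distinct xs)
distinct-unique = DecUniqueₚ.deduplicate-! _≟_

distinct-length : ∀ xs → length (distinct xs) ≤ length xs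
distinct-length xs = length-≤-by _≡_ (λ p q → trans (sym p) q) xs (distinct-unique xs) λ {y} y∈ → y , ∈-deduplicate⁻ _≟_ xs y∈ , refl

-- SLPs as L-systems

rhs : ∀ {m} (R : Rule m) → Allowed slp R → List⁺ (Symbol m)
rhs (concatenation α) _ = α

terminals : ∀ {m} → List (Symbol m) → String
terminals []            = []
terminals (term a ∷ Xs) = a ∷ terminals Xs
terminals (var _ ∷ Xs)  = terminals Xs

length-terminals : ∀ {m} (Xs : List (Symbol m)) → length (terminals Xs) ≤ length Xs
length-terminals []            = z≤n
length-terminals (term a ∷ Xs) = s≤s (length-terminals Xs)
length-terminals (var _ ∷ Xs)  = m≤n⇒m≤1+n (length-terminals Xs)

module _ (G : Grammar slp) where
  open Grammar G

  rhsOf : Fin m → List⁺ (Symbol m)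
  rhsOf A = rhs (rule A) (allowed A)

  length-rhs : ∀ (R : Rule m) al → List⁺.length (rhs R al) ≡ ruleSize R
  length-rhs (concatenation α) _ = refl

  terminalsOf : Fin m → String
  terminalsOf A = terminals (List⁺.toList (rhsOf A))

  allTerminals : String
  allTerminals = distinct (concat (tabulate terminalsOf))

  #terminals : ℕ
  #terminals = length allTerminals

  #terminals≤grammarSize : #terminals ≤ grammarSize G
  #terminals≤grammarSize = ≤-trans (distinct-length (concat (tabulate terminalsOf))) (≤-trans (≤-reflexive (length-concat-tabulate terminalsOf))
    (sum-tabulate-mono λ A → ≤-trans (length-terminals (List⁺.toList (rhsOf A))) (≤-reflexive (length-rhs (rule A) (allowed A)))))

  1≤ruleSize : ∀ (R : Rule m) → 1 ≤ ruleSize R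
  1≤ruleSize (concatenation (_ ∷ _)) = s≤s z≤n
  1≤ruleSize (power _ _ _)           = s≤s z≤n
  1≤ruleSize (prefix _ _)            = s≤s z≤n
  1≤ruleSize (suffix _ _)            = s≤s z≤n

  m≤grammarSize : m ≤ grammarSize G
  m≤grammarSize = subst (_≤ grammarSize G) (trans (sum-tabulate-const m {λ _ → 1} (λ _ → refl)) (*-identityʳ m))
    (sum-tabulate-mono λ A → 1≤ruleSize (rule A))

  encodeTerminal : ∀ {a} → Dec (a ∈ allTerminals) → Fin (m + #terminals)
  encodeTerminal (yes a∈) = m Fin.↑ʳ Any.index a∈
  -- An arbitrary value: every terminal of a right-hand side belongs to `allTerminals`, as `Known`
  -- records.
  encodeTerminal (no _)   = start Fin.↑ˡ #terminals

  encode : Symbol m → Fin (m + #terminals)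
  encode (term a) = encodeTerminal (a ∈? allTerminals)
  encode (var A)  = A Fin.↑ˡ #terminals

  φ⊎ : Fin m ⊎ Fin #terminals → List⁺ (Fin (m + #terminals))
  φ⊎ (inj₁ A) = List⁺.map encode (rhsOf A)
  φ⊎ (inj₂ i) = (m Fin.↑ʳ i) ∷ []

  -- Terminals keep their own symbol; variables are named by numbers above the sum of all terminals,
  -- hence different from each of them.
  name⊎ : Fin m ⊎ Fin #terminals → ℕ
  name⊎ (inj₁ A) = suc (sum allTerminals) + toℕ A
  name⊎ (inj₂ i) = lookup allTerminals i

  name⊎-injective : ∀ x y → name⊎ x ≡ name⊎ y → x ≡ y
  name⊎-injective (inj₁ A) (inj₁ B) eq = cong inj₁ (Finₚ.toℕ-injective (+-cancelˡ-≡ (suc (sum allTerminals)) _ _ eq))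
  name⊎-injective (inj₁ A) (inj₂ j) eq = contradiction (∈⇒≤sum (∈-lookup {xs = allTerminals} j)) (<⇒≱ (subst (sum allTerminals <_) eq (m≤m+n _ (toℕ A))))
  name⊎-injective (inj₂ i) (inj₁ B) eq = contradiction (∈⇒≤sum (∈-lookup {xs = allTerminals} i)) (<⇒≱ (subst (sum allTerminals <_) (sym eq) (m≤m+n _ (toℕ B))))
  name⊎-injective (inj₂ i) (inj₂ j) eq = cong inj₂ (lookup-injective {xs = allTerminals} (distinct-unique _) eq)

  splitAt-injective : ∀ (i j : Fin (m + #terminals)) → Fin.splitAt m i ≡ Fin.splitAt m j → i ≡ j
  splitAt-injective i j eq = trans (sym (Finₚ.join-splitAt m #terminals i)) (trans (cong (Fin.join m #terminals) eq) (Finₚ.join-splitAt m #terminals j))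

  slpφ : Fin (m + #terminals) → List⁺ (Fin (m + #terminals))
  slpφ i = φ⊎ (Fin.splitAt m i)

  slpNames : Fin (m + #terminals) ↣ ℕ
  slpNames = mk↣ {to = λ i → name⊎ (Fin.splitAt m i)} λ {i} {j} eq → splitAt-injective i j (name⊎-injective _ _ eq)

  name : Fin (m + #terminals) → ℕ
  name = Injection.to slpNames

  Known : Symbol m → Set
  Known (term a) = a ∈ allTerminals
  Known (var _)  = ⊤

  known : ∀ Xs → (∀ {a} → a ∈ terminals Xs → a ∈ allTerminals) → All Known Xs
  known []            _ = []
  known (term a ∷ Xs) h = h (here refl) ∷ known Xs (h ∘ there)
  known (var _ ∷ Xs)  h = tt ∷ known Xs h

  known-rhs : ∀ A → All Known (List⁺.toList (rhsOf A))
  known-rhs A = known _ λ a∈ → ∈-deduplicate⁺ _≟_ (∈-concat⁺′ a∈ (∈-tabulate⁺ A))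

  expansion : List (Fin (m + #terminals)) → ℕ → String
  expansion s d = map name (level slpφ s d)

  mutual
    -- Every level from the height on gives the same word, because terminals are fixed points of the
    -- morphism. Hence one depth serves variables of different heights at once.
    level-expands : ∀ {X w} (D : Expands G X w) → Known X → ∀ d → height D ≤ d → expansion (encode X ∷ []) d ≡ w
    level-expands (term {a}) a∈ d _ with a ∈? allTerminals
    ... | no a∉ = contradiction a∈ a∉
    ... | yes p rewrite level-fixed slpφ {m Fin.↑ʳ Any.index p} (cong φ⊎ (Finₚ.splitAt-↑ʳ m #terminals (Any.index p))) d
                      | Finₚ.splitAt-↑ʳ m #terminals (Any.index p) = cong (_∷ []) (sym (Anyₚ.lookup-index p))
    level-expands {X} (var {A} D) _ (suc d) (s≤s h≤) = begin
      expansion (encode X ∷ []) (suc d)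
        ≡⟨ cong (map name) (level-suc slpφ _ d) ⟩
      expansion (List⁺.toList (slpφ (encode X)) ++ []) d
        ≡⟨ cong (λ s → expansion s d) (++-identityʳ _) ⟩
      expansion (List⁺.toList (slpφ (encode X))) d
        ≡⟨ cong (λ s → expansion (List⁺.toList (φ⊎ s)) d) (Finₚ.splitAt-↑ˡ m A #terminals) ⟩
      expansion (map encode (List⁺.toList (rhsOf A))) d
        ≡⟨ level-rule (rule A) (allowed A) D (known-rhs A) d h≤ ⟩
      _ ∎
      where open ≡-Reasoning

    level-rule : ∀ R al {w} (D : RuleExpands G R w) → All Known (List⁺.toList (rhs R al)) →
      ∀ d → ruleHeight D ≤ d → expansion (map encode (List⁺.toList (rhs R al))) d ≡ w
    level-rule (concatenation α) _ (concatenation D) ks d h≤ = level-seq D ks d h≤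

    level-seq : ∀ {Xs w} (D : SeqExpands G Xs w) → All Known Xs → ∀ d → seqHeight D ≤ d →
      expansion (map encode Xs) d ≡ w
    level-seq []       []       d h≤ = cong (map name) (level-[] d)
      where
      level-[] : ∀ d → level slpφ [] d ≡ []
      level-[] zero    = refl
      level-[] (suc d) = cong (concatMap _) (level-[] d)
    level-seq {X ∷ Xs} (D ∷ Ds) (k ∷ ks) d h≤ = begin
      expansion (encode X ∷ map encode Xs) d
        ≡⟨ cong (map name) (level-++ slpφ (encode X ∷ []) (map encode Xs) d) ⟩
      map name (level slpφ (encode X ∷ []) d ++ level slpφ (map encode Xs) d)
        ≡⟨ map-++ name (level slpφ (encode X ∷ []) d) _ ⟩
      expansion (encode X ∷ []) d ++ expansion (map encode Xs) d
        ≡⟨ cong₂ _++_ (level-expands D k d (m⊔n≤o⇒m≤o (height D) _ h≤)) (level-seq Ds ks d (m⊔n≤o⇒n≤o (height D) _ h≤)) ⟩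
      _ ∎
      where open ≡-Reasoning

  module _ {w} (1≤w : 1 ≤ length w) (D : Expands G (var start) w) where

    -- Depth `m` suffices by `height≤m`, and being at most the grammar size it can meet the
    -- polynomial bound on the depth.
    slpLSystem : LSystem
    slpLSystem = record { σ = m + #terminals ; symbols = slpNames ; φ = slpφ ; τ = id
      ; axiom = (start Fin.↑ˡ #terminals) ∷ [] ; d = m ; n = length w ; 1≤n = 1≤w }

    slpLSystem-generates : LGenerates slpLSystem w
    slpLSystem-generates = refl
      , ≤-reflexive (trans (cong length (sym eq)) (length-map name (level slpφ _ m)))
      , sym (trans (cong (take (length w)) eq) (take-all (length w) w ≤-refl))
      where
      eq : expansion ((start Fin.↑ˡ #terminals) ∷ []) m ≡ w
      eq = level-expands D tt m (height≤m D)

    lSize-slpLSystem : lSize slpLSystem ≤ 8 * grammarSize G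
    lSize-slpLSystem = begin
      sum (tabulate (List⁺.length ∘ slpφ)) + 1 + (m + #terminals) + 2
        ≡⟨ cong (λ x → x + 1 + (m + #terminals) + 2) (trans (sum-tabulate-+ m #terminals _) (cong₂ _+_
             (cong sum (tabulate-cong λ A → trans (cong (List⁺.length ∘ φ⊎) (Finₚ.splitAt-↑ˡ m A #terminals))
               (trans (length-⁺map encode (rhsOf A)) (length-rhs (rule A) (allowed A)))))
             (sum-tabulate-const #terminals λ i → cong (List⁺.length ∘ φ⊎) (Finₚ.splitAt-↑ʳ m #terminals i)))) ⟩
      size + #terminals * 1 + 1 + (m + #terminals) + 2
        ≤⟨ +-mono-≤ (+-mono-≤ (+-mono-≤ (+-monoʳ-≤ size (*-monoˡ-≤ 1 #terminals≤grammarSize)) 1≤size) (+-mono-≤ m≤grammarSize #terminals≤grammarSize)) (*-monoʳ-≤ 2 1≤size) ⟩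
      size + size * 1 + size + (size + size) + 2 * size
        -- The sum is 7 times the size; it is raised to 8, the constant needed when `ℓ≤8g` takes the
        -- word itself as axiom.
        ≤⟨ m≤m+n _ size ⟩
      size + size * 1 + size + (size + size) + 2 * size + size
        ≡⟨ solve 1 (λ g → g :+ g :* con 1 :+ g :+ (g :+ g) :+ con 2 :* g :+ g := con 8 :* g) refl size ⟩
      8 * size ∎
      where
      open ≤-Reasoning hiding (start)
      open +-*-Solver
      size = grammarSize G
      1≤size : 1 ≤ size
      1≤size = ≤-trans (≤-trans (s≤s z≤n) (Finₚ.toℕ<n start)) m≤grammarSize

indices : ∀ {A : Set} {ys : List A} {xs} → All (_∈ ys) xs → ∃[ js ] map (lookup ys) js ≡ xs
indices []         = [] , refl
indices (x∈ ∷ xs∈) with indices xs∈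
... | js , eq = Any.index x∈ ∷ js , cong₂ _∷_ (sym (Anyₚ.lookup-index x∈)) eq

module _ (a : ℕ) (w′ : String) where
  private
    w : String
    w = a ∷ w′

    coded : ∃[ js ] map (lookup (distinct w)) js ≡ w
    coded = indices {ys = distinct w} {xs = w} (All.tabulate (∈-deduplicate⁺ _≟_))

    axiom⁺ : Σ[ s ∈ List⁺ (Fin (length (distinct w))) ] map (lookup (distinct w)) (List⁺.toList s) ≡ w
    axiom⁺ with coded
    ... | j ∷ js , eq = j ∷ js , eq

  literalLSystem : LSystem
  literalLSystem = record { σ = length (distinct w) ; symbols = mk↣ (lookup-injective (distinct-unique w))
    ; φ = λ i → i ∷ [] ; τ = id ; axiom = proj₁ axiom⁺ ; d = 0 ; n = length w ; 1≤n = s≤s z≤n }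

  private
    length-axiom : List⁺.length (proj₁ axiom⁺) ≡ length w
    length-axiom = trans (cong suc (sym (length-map _ (List⁺.tail (proj₁ axiom⁺))))) (cong length (proj₂ axiom⁺))

  literalLSystem-generates : LGenerates literalLSystem w
  literalLSystem-generates = refl , ≤-reflexive (sym length-axiom)
    , sym (trans (cong (take (length w)) (proj₂ axiom⁺)) (take-all (length w) w ≤-refl))

  lSize-literalLSystem : lSize literalLSystem ≤ 3 * length w + 2
  lSize-literalLSystem = bound {n = length w} {k = length (distinct w)} (sum-tabulate-const (length (distinct w)) {λ _ → 1} (λ _ → refl)) length-axiom (distinct-length w)
    where
    open +-*-Solver
    bound : ∀ {n s a k} → s ≡ k * 1 → a ≡ n → k ≤ n → s + a + k + 2 ≤ 3 * n + 2
    bound {n} {k = k} refl refl k≤n = subst (k * 1 + n + k + 2 ≤_)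
      (solve 1 (λ n → n :* con 1 :+ n :+ n :+ con 2 := con 3 :* n :+ con 2) refl n)
      (+-monoˡ-≤ 2 (+-mono-≤ (+-monoˡ-≤ n (*-monoˡ-≤ 1 k≤n)) k≤n))

-- The bound σ ≤ n^e fails for the system of an SLP with many symbols, but then w itself
-- is a short enough axiom.
ℓ≤8g : ∀ {e} → 1 ≤ e → (G : Grammar slp) → ∀ {w} → 1 ≤ length w → Expands G (var (Grammar.start G)) w →
  ∃[ L ] LBounded e L × LGenerates L w × lSize L ≤ 8 * grammarSize G
ℓ≤8g {e} 1≤e G {w@(a ∷ w′)} 1≤w D with 2 * grammarSize G ≤? length w
... | yes 2g≤n = slpLSystem G 1≤w D
  , (≤-trans (≤-trans (m≤grammarSize G) (m≤n*m _ 2)) n^ , ≤-trans (+-mono-≤ (m≤grammarSize G) (≤-trans (#terminals≤grammarSize G) (m≤m+n _ 0))) n^)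
  , slpLSystem-generates G 1≤w D , lSize-slpLSystem G 1≤w D
  where
  n^ : 2 * grammarSize G ≤ length w ^ e
  n^ = ≤-trans 2g≤n (n≤n^e (length w) 1≤e)
... | no 2g≰n = literalLSystem a w′ , (z≤n , ≤-trans (distinct-length w) (n≤n^e _ 1≤e)) , literalLSystem-generates a w′
  , (begin
    lSize (literalLSystem a w′) ≤⟨ lSize-literalLSystem a w′ ⟩
    3 * length w + 2            ≤⟨ +-mono-≤ (*-monoʳ-≤ 3 (<⇒≤ n<2g)) (≤-trans (s≤s 1≤w) n<2g) ⟩
    3 * (2 * size) + 2 * size   ≡⟨ solve 1 (λ g → con 3 :* (con 2 :* g) :+ con 2 :* g := con 8 :* g) refl size ⟩
    8 * size                    ∎)
  where
  open ≤-Reasoning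
  open +-*-Solver
  size = grammarSize G
  n<2g = ≰⇒> 2g≰n

ℓ=Og : ∀ F e → 1 ≤ e → ℓ e =O[ F ] g
ℓ=Og F e 1≤e = =O-natural F 8 λ { 1≤w (_ , ℓ-min) ((G , D , refl) , _) →
  let L , bounded , gen , size = ℓ≤8g {e} 1≤e G 1≤w D in ≤-trans (ℓ-min _ (L , bounded , gen , refl)) size }

-- Markers

zeros : ℕ → String
zeros j = replicate j 0

marker : ℕ → String
marker j = 1 ∷ zeros j ++ 1 ∷ []

length-marker : ∀ j → length (marker j) ≡ 2 + j
length-marker j = cong suc (trans (length-++ (zeros j)) (trans (cong (_+ 1) (length-replicate j)) (+-comm j 1)))

-- The two ones of the marker are the nearest ones on either side of the border, with `x` zeros
-- before it and `y` after it. This is why a border determines `j`.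
Crosses : String → String → ℕ → Set
Crosses u v j = ∃[ x ] ∃[ y ] ∃[ u′ ] ∃[ v′ ]
  u ≡ u′ ++ 1 ∷ zeros x × v ≡ zeros y ++ 1 ∷ v′ × j ≡ x + y

Occurs : String → ℕ → Set
Occurs u j = ∃[ p ] ∃[ s ] u ≡ p ++ 1 ∷ zeros j ++ 1 ∷ s

lead : String → ℕ
lead (0 ∷ w) = suc (lead w)
lead _       = 0

lead-zeros : ∀ y v → lead (zeros y ++ 1 ∷ v) ≡ y
lead-zeros zero    v = refl
lead-zeros (suc y) v = cong suc (lead-zeros y v)

zeros-∷ʳ : ∀ x w → zeros x ++ 0 ∷ w ≡ 0 ∷ zeros x ++ w
zeros-∷ʳ zero    w = refl
zeros-∷ʳ (suc x) w = cong (0 ∷_) (zeros-∷ʳ x w)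

zeros-+ : ∀ x y → zeros (x + y) ≡ zeros x ++ zeros y
zeros-+ zero    y = refl
zeros-+ (suc x) y = cong (0 ∷_) (zeros-+ x y)

reverse-∷-zeros : ∀ u x → reverse (u ++ 1 ∷ zeros x) ≡ zeros x ++ 1 ∷ reverse u
reverse-∷-zeros u x = begin
  reverse (u ++ 1 ∷ zeros x)          ≡⟨ reverse-++ u _ ⟩
  reverse (1 ∷ zeros x) ++ reverse u  ≡⟨ cong (_++ reverse u) (unfold-reverse 1 (zeros x)) ⟩
  (reverse (zeros x) ∷ʳ 1) ++ reverse u  ≡⟨ ∷ʳ-++ (reverse (zeros x)) 1 _ ⟩
  reverse (zeros x) ++ 1 ∷ reverse u  ≡⟨ cong (_++ 1 ∷ reverse u) (reverse-zeros x) ⟩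
  zeros x ++ 1 ∷ reverse u            ∎
  where
  open ≡-Reasoning
  reverse-zeros : ∀ x → reverse (zeros x) ≡ zeros x
  reverse-zeros zero    = refl
  reverse-zeros (suc x) = trans (unfold-reverse 0 (zeros x)) (trans (cong (_∷ʳ 0) (reverse-zeros x))
    (trans (zeros-∷ʳ x []) (cong (0 ∷_) (++-identityʳ _))))

Crosses⇒≡ : ∀ {u v j} → Crosses u v j → j ≡ lead (reverse u) + lead v
Crosses⇒≡ (x , y , u′ , v′ , refl , refl , refl) = sym (cong₂ _+_
  (trans (cong lead (reverse-∷-zeros u′ x)) (lead-zeros x _)) (lead-zeros y v′))

Crosses-functional : ∀ {u v j k} → Crosses u v j → Crosses u v k → j ≡ k
Crosses-functional c d = trans (Crosses⇒≡ c) (sym (Crosses⇒≡ d))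

split-zeros : ∀ u {v j s} → u ++ v ≡ zeros j ++ 1 ∷ s →
  (∃[ s′ ] u ≡ zeros j ++ 1 ∷ s′) ⊎ (∃[ x ] ∃[ y ] u ≡ zeros x × v ≡ zeros y ++ 1 ∷ s × j ≡ x + y)
split-zeros []      {j = j}     eq = inj₂ (0 , j , refl , eq , refl)
split-zeros (_ ∷ u) {j = zero}  eq with ∷-injective eq
... | refl , _ = inj₁ (u , refl)
split-zeros (_ ∷ u) {j = suc j} eq with ∷-injective eq
... | refl , eq′ with split-zeros u eq′
...   | inj₁ (s′ , refl)              = inj₁ (s′ , refl)
...   | inj₂ (x , y , refl , v≡ , j≡) = inj₂ (suc x , y , refl , v≡ , cong suc j≡)

Occurs-++ : ∀ u {v j} → Occurs (u ++ v) j → Occurs u j ⊎ Occurs v j ⊎ Crosses u v j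
Occurs-++ []      o                  = inj₂ (inj₁ o)
Occurs-++ (_ ∷ u) ([] , s , eq) with ∷-injective eq
... | refl , eq′ with split-zeros u eq′
...   | inj₁ (s′ , refl)              = inj₁ ([] , s′ , refl)
...   | inj₂ (x , y , refl , v≡ , j≡) = inj₂ (inj₂ (x , y , [] , s , refl , v≡ , j≡))
Occurs-++ (a ∷ u) (_ ∷ p , s , eq) with ∷-injective eq
... | refl , eq′ with Occurs-++ u (p , s , eq′)
...   | inj₁ (p′ , s′ , refl)                          = inj₁ (a ∷ p′ , s′ , refl)
...   | inj₂ (inj₁ o)                                  = inj₂ (inj₁ o)
...   | inj₂ (inj₂ (x , y , u′ , v′ , refl , v≡ , j≡)) = inj₂ (inj₂ (x , y , a ∷ u′ , v′ , refl , v≡ , j≡))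

take-+ : ∀ {A : Set} m n (xs : List A) → take (m + n) xs ≡ take m xs ++ take n (drop m xs)
take-+ zero    n xs       = refl
take-+ (suc m) n []       = sym (take-[] n)
take-+ (suc m) n (x ∷ xs) = cong (x ∷_) (take-+ m n xs)

take-++-≤ : ∀ {A : Set} (xs ys : List A) → take (length xs) (xs ++ ys) ≡ xs
take-++-≤ []       ys = refl
take-++-≤ (x ∷ xs) ys = cong (x ∷_) (take-++-≤ xs ys)

drop-++-≡ : ∀ {A : Set} (xs ys : List A) → drop (length xs) (xs ++ ys) ≡ ys
drop-++-≡ []       ys = refl
drop-++-≡ (x ∷ xs) ys = drop-++-≡ xs ys

take-drop-take : ∀ {A : Set} t k l (xs : List A) → t + k ≤ l → take k (drop t (take l xs)) ≡ take k (drop t xs)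
take-drop-take t       zero    l       xs       _       = refl
take-drop-take zero    (suc k) (suc l) []       _       = refl
take-drop-take zero    (suc k) (suc l) (x ∷ xs) (s≤s h) = cong (x ∷_) (take-drop-take 0 k l xs h)
take-drop-take (suc t) (suc k) (suc l) []       _       = refl
take-drop-take (suc t) (suc k) (suc l) (x ∷ xs) (s≤s h) = take-drop-take t (suc k) l xs h

subfactor : ∀ {w} i s {l} t {k} → t + k ≤ l → factor w i l ≡ factor w s l → factor w (i + t) k ≡ factor w (s + t) k
subfactor {w} i s {l} t {k} h eq = begin
  take k (drop (i + t) w)         ≡⟨ cong (take k) (sym (drop-drop i t w)) ⟩
  take k (drop t (drop i w))      ≡⟨ sym (take-drop-take t k l (drop i w) h) ⟩
  take k (drop t (factor w i l))  ≡⟨ cong (take k ∘ drop t) eq ⟩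
  take k (drop t (factor w s l))  ≡⟨ take-drop-take t k l (drop s w) h ⟩
  take k (drop t (drop s w))      ≡⟨ cong (take k) (drop-drop s t w) ⟩
  take k (drop (s + t) w)         ∎
  where open ≡-Reasoning

length-factor : ∀ w p l → length (factor w p l) ≡ l ⊓ (length w ∸ p)
length-factor w p l = trans (length-take l (drop p w)) (cong (l ⊓_) (length-drop p w))

MarkerAt : String → ℕ → ℕ → Set
MarkerAt w p j = factor w p (2 + j) ≡ marker j

MarkerAt⇒≤ : ∀ {w p j} → MarkerAt w p j → p + (2 + j) ≤ length w
MarkerAt⇒≤ {w} {p} {j} eq = subst (_≤ length w) (+-comm (2 + j) p)
  (m≤o∸n⇒m+n≤o (2 + j) (<⇒≤ (m∸n≢0⇒n<m {length w} {p} λ z → contradiction (subst (2 + j ≤_) z le) λ ())) le)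
  where
  le : 2 + j ≤ length w ∸ p
  le = m⊓n≡m⇒m≤n (trans (sym (length-factor w p (2 + j))) (trans (cong length eq) (length-marker j)))

-- The marker occupies positions `p` to `p + suc j`, so these `x` are exactly the borders with its
-- first one on the left and its last one on the right.
MarkerAt-Crosses : ∀ {w p j} → MarkerAt w p j → ∀ {x} → p < x → x ≤ p + suc j → Crosses (take x w) (drop x w) j
MarkerAt-Crosses {w} {p} {j} eq {x} p<x x≤ with m≤n⇒∃[o]m+o≡n p<x
... | i , refl with m≤n⇒∃[o]m+o≡n (s≤s⁻¹ (+-cancelˡ-≤ p _ _ (subst (_≤ p + suc j) (sym (+-suc p i)) x≤)))
...   | y , refl = i , y , take p w , drop (2 + i + y) (drop p w) , take≡ , drop≡ , refl
  where
  open ≡-Reasoning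
  rest = drop (2 + i + y) (drop p w)
  drop-p : drop p w ≡ (1 ∷ zeros i) ++ zeros y ++ 1 ∷ rest
  drop-p = begin
    drop p w                                 ≡⟨ sym (take++drop≡id (2 + i + y) (drop p w)) ⟩
    factor w p (2 + i + y) ++ rest           ≡⟨ cong (_++ rest) eq ⟩
    (1 ∷ zeros (i + y) ++ 1 ∷ []) ++ rest    ≡⟨ cong (1 ∷_) (++-assoc (zeros (i + y)) (1 ∷ []) rest) ⟩
    1 ∷ zeros (i + y) ++ 1 ∷ rest            ≡⟨ cong (λ u → 1 ∷ u ++ 1 ∷ rest) (zeros-+ i y) ⟩
    1 ∷ (zeros i ++ zeros y) ++ 1 ∷ rest     ≡⟨ cong (1 ∷_) (++-assoc (zeros i) (zeros y) _) ⟩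
    1 ∷ zeros i ++ zeros y ++ 1 ∷ rest       ∎
  si≡ : suc i ≡ length (1 ∷ zeros i)
  si≡ = cong suc (sym (length-replicate i))
  take≡ : take (suc p + i) w ≡ take p w ++ 1 ∷ zeros i
  take≡ = begin
    take (suc p + i) w                   ≡⟨ cong (λ k → take k w) (sym (+-suc p i)) ⟩
    take (p + suc i) w                   ≡⟨ take-+ p (suc i) w ⟩
    take p w ++ take (suc i) (drop p w)  ≡⟨ cong (take p w ++_) (trans (cong₂ take si≡ drop-p) (take-++-≤ (1 ∷ zeros i) _)) ⟩
    take p w ++ 1 ∷ zeros i              ∎
  drop≡ : drop (suc p + i) w ≡ zeros y ++ 1 ∷ rest
  drop≡ = begin
    drop (suc p + i) w       ≡⟨ cong (λ k → drop k w) (sym (+-suc p i)) ⟩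
    drop (p + suc i) w       ≡⟨ sym (drop-drop p (suc i) w) ⟩
    drop (suc i) (drop p w)  ≡⟨ trans (cong₂ drop si≡ drop-p) (drop-++-≡ (1 ∷ zeros i) _) ⟩
    zeros y ++ 1 ∷ rest      ∎

HasMarkers : String → ℕ → Set
HasMarkers w m = ∀ {j} → j < m → Occurs w j

Occurs⇒MarkerAt : ∀ {w j} → Occurs w j → ∃[ p ] MarkerAt w p j
Occurs⇒MarkerAt {w} {j} (p , s , refl) = length p , (begin
  take (2 + j) (drop (length p) (p ++ 1 ∷ zeros j ++ 1 ∷ s))
    ≡⟨ cong₂ take (sym (length-marker j)) (trans (drop-++-≡ p _) (cong (1 ∷_) (sym (++-assoc (zeros j) (1 ∷ []) s)))) ⟩
  take (length (marker j)) (marker j ++ s)  ≡⟨ take-++-≤ (marker j) s ⟩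
  marker j                                  ∎)
  where open ≡-Reasoning

markers≤ : ∀ {A : Set} {m} (R : A → ℕ → Set) → (∀ {a j k} → R a j → R a k → j ≡ k) → (xs : List A) →
  (∀ {j} → j < m → ∃[ a ] a ∈ xs × R a j) → m ≤ length xs
markers≤ {m = m} R functional xs assign = subst (_≤ length xs) (length-upTo m)
  (length-≤-by R functional xs (Uniqueₚ.upTo⁺ m) (λ j∈ → assign (∈-upTo⁻ j∈)))

-- Attractors

elements : ∀ {n} → Subset n → List ℕ
elements Vec.[]             = []
elements (inside  Vec.∷ Γ) = 0 ∷ map suc (elements Γ)
elements (outside Vec.∷ Γ) = map suc (elements Γ)

length-elements : ∀ {n} (Γ : Subset n) → length (elements Γ) ≡ ∣ Γ ∣
length-elements Vec.[]             = refl
length-elements (inside  Vec.∷ Γ) = cong suc (trans (length-map ℕ.suc (elements Γ)) (length-elements Γ))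
length-elements (outside Vec.∷ Γ) = trans (length-map ℕ.suc (elements Γ)) (length-elements Γ)

∈-elements : ∀ {n} {Γ : Subset n} {p} → p ∈ˢ Γ → toℕ p ∈ elements Γ
∈-elements {Γ = inside Vec.∷ Γ}   Vec.here      = here refl
∈-elements {Γ = inside Vec.∷ Γ}   (Vec.there h) = there (∈-map⁺ suc (∈-elements h))
∈-elements {Γ = outside Vec.∷ Γ} (Vec.there h) = ∈-map⁺ suc (∈-elements h)

CrossesAt : String → ℕ → ℕ → Set
CrossesAt w x j = Crosses (take x w) (drop x w) j

-- The boundary crossed by a marker containing p is p itself, or suc p if the marker starts at p.
markers≤2attractor : ∀ {w m} → HasMarkers w m → ∀ Γ → IsAttractor w Γ → m ≤ 2 * ∣ Γ ∣
markers≤2attractor {w} {m} markers Γ attractor =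
  subst (m ≤_) length≡ (markers≤ (CrossesAt w) Crosses-functional boundaries assign)
  where
  boundaries : List ℕ
  boundaries = elements Γ ++ map suc (elements Γ)
  length≡ : length boundaries ≡ 2 * ∣ Γ ∣
  length≡ = trans (length-++ (elements Γ)) (cong₂ _+_ (length-elements Γ)
    (trans (length-map ℕ.suc (elements Γ)) (trans (length-elements Γ) (sym (+-identityʳ _)))))
  assign : ∀ {j} → j < m → ∃[ x ] x ∈ boundaries × CrossesAt w x j
  assign {j} j<m with Occurs⇒MarkerAt (markers j<m)
  ... | i , marker-i with attractor i (2 + j) (s≤s z≤n) (MarkerAt⇒≤ marker-i)
  ...   | i′ , _ , eq , p , p∈ , i′≤p , p< with m≤n⇒m<n∨m≡n i′≤p
  ...     | inj₁ i′<p = toℕ p , ∈-++⁺ˡ (∈-elements p∈)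
            , MarkerAt-Crosses (trans eq marker-i) i′<p (s≤s⁻¹ (subst (toℕ p <_) (+-suc i′ (suc j)) p<))
  ...     | inj₂ i′≡p = suc (toℕ p) , ∈-++⁺ʳ (elements Γ) (∈-map⁺ suc (∈-elements p∈))
            , MarkerAt-Crosses (trans eq marker-i) (s≤s i′≤p) (subst (λ k → suc k ≤ _) i′≡p
                (subst (_≤ i′ + suc j) (+-comm i′ 1) (+-monoʳ-≤ i′ (s≤s z≤n))))

-- Parsings with well-founded copies

-- The common form of lex-parses, greedy parsings and macro-schemes, with the list of phrase ends.
-- The relation expresses why copying is not circular: it will be the order of suffixes, the order
-- of positions, or the pointer relation of the scheme.
data Parse (w : String) (_⊏_ : ℕ → ℕ → Set) : ℕ → List ℕ → Set where
  done   : Parse w _⊏_ (length w) []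
  single : ∀ {i es} → Parse w _⊏_ (suc i) es → Parse w _⊏_ i (suc i ∷ es)
  copy   : ∀ {i l es} s → factor w i l ≡ factor w s l →
           (∀ {t} → t < l → (s + t) ⊏ (i + t)) →
           Parse w _⊏_ (i + l) es → Parse w _⊏_ i (i + l ∷ es)

module _ {w : String} {_⊏_ : ℕ → ℕ → Set} where

  -- Either a phrase border lies directly after `p`, or `p` is in a copied phrase ending at `e`. In
  -- the second case `s` is the source of `p` itself, and the copy is valid as far as `e`.
  Located : List ℕ → ℕ → Set
  Located es p = suc p ∈ es
    ⊎ ∃[ e ] ∃[ s ] e ∈ es × p < e × s ⊏ p × (∀ {k} → p + k ≤ e → factor w p k ≡ factor w s k)

  Located-∷ : ∀ {e es p} → Located es p → Located (e ∷ es) p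
  Located-∷ (inj₁ p∈)                = inj₁ (there p∈)
  Located-∷ (inj₂ (e , s , e∈ , h)) = inj₂ (e , s , there e∈ , h)

  locate : ∀ {i es p} → Parse w _⊏_ i es → i ≤ p → p < length w → Located es p
  locate done i≤p p<w = contradiction i≤p (<⇒≱ p<w)
  locate (single P) i≤p p<w with m≤n⇒m<n∨m≡n i≤p
  ... | inj₁ i<p  = Located-∷ (locate P i<p p<w)
  ... | inj₂ refl = inj₁ (here refl)
  locate {i} {p = p} (copy {l = l} s eq desc P) i≤p p<w with i + l ≤? p
  ... | yes e≤p = Located-∷ (locate P e≤p p<w)
  ... | no  e≰p with m≤n⇒∃[o]m+o≡n i≤p
  ...   | t , refl = inj₂ (i + l , s + t , here refl , ≰⇒> e≰p , desc (+-cancelˡ-< i t l (≰⇒> e≰p))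
            , λ {k} h → subfactor {w} i s t (+-cancelˡ-≤ i _ _ (subst (_≤ i + l) (+-assoc i t k) h)) eq)

  -- Following the copies of a marker inside phrases leads to an occurrence across a boundary.
  marker-boundary : ∀ {es p j} → Parse w _⊏_ 0 es → Acc _⊏_ p → MarkerAt w p j →
    ∃[ x ] x ∈ es × CrossesAt w x j
  marker-boundary {p = p} {j} P (acc rec) at
    with locate P z≤n (<-≤-trans (m<m+n p (s≤s z≤n)) (MarkerAt⇒≤ at))
  ... | inj₁ p∈ = suc p , p∈ , MarkerAt-Crosses at ≤-refl (subst (_≤ p + suc j) (+-comm p 1) (+-monoʳ-≤ p (s≤s z≤n)))
  ... | inj₂ (e , s , e∈ , p<e , s⊏p , same) with e ≤? p + suc j
  ...   | yes e≤ = e , e∈ , MarkerAt-Crosses at p<e e≤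
  ...   | no  e≰ = marker-boundary P (rec s⊏p) (trans (sym (same (subst (_≤ e) (sym (+-suc p (suc j))) (≰⇒> e≰)))) at)

  markers≤parse : ∀ {m es} → HasMarkers w m → (∀ {p} → p < length w → Acc _⊏_ p) → Parse w _⊏_ 0 es → m ≤ length es
  markers≤parse {es = es} markers wf P = markers≤ (CrossesAt w) Crosses-functional es λ j<m →
    let p , at = Occurs⇒MarkerAt (markers j<m)
    in marker-boundary P (wf (<-≤-trans (m<m+n p (s≤s z≤n)) (MarkerAt⇒≤ at))) at

-- The lexicographic order of suffixes

lex-trans : ∀ {x y z} → x <ˡᵉˣ y → y <ˡᵉˣ z → x <ˡᵉˣ z
lex-trans = Lex.<-transitive isEquivalence <-resp₂-≡ <-trans

lex-irrefl : ∀ {x} → ¬ x <ˡᵉˣ x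
lex-irrefl = Lex.<-irreflexive <-irrefl (≡⇒Pointwise-≡ refl)

lex-tail : ∀ {a x y} → (a ∷ x) <ˡᵉˣ (a ∷ y) → x <ˡᵉˣ y
lex-tail (this a<a)   = contradiction a<a (<-irrefl refl)
lex-tail (next _ x<y) = x<y

SuffixOrder : (String → String → Set) → String → ℕ → ℕ → Set
SuffixOrder _⊲_ w i j = i < length w × j < length w × drop i w ⊲ drop j w

-- A strict partial order on finitely many positions is well-founded. The order is a parameter
-- because it is needed in both directions: downwards to follow the copies of a lex-parse, upwards
-- to reach an immediate predecessor.
suffixOrder-wellFounded : ∀ (_⊲_ : String → String → Set) → (∀ {x} → ¬ x ⊲ x) → (∀ {x y z} → x ⊲ y → y ⊲ z → x ⊲ z) →
  ∀ w {i} → i < length w → Acc (SuffixOrder _⊲_ w) i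
suffixOrder-wellFounded _⊲_ irrefl trans w i< =
  subst (Acc _) (Finₚ.toℕ-fromℕ< i<) (transfer (FinInduction.spo-wellFounded spo (fromℕ< i<)))
  where
  _⊏_ : Fin (length w) → Fin (length w) → Set
  i ⊏ j = drop (toℕ i) w ⊲ drop (toℕ j) w
  spo : IsStrictPartialOrder _≡_ _⊏_
  spo = record { isEquivalence = isEquivalence ; irrefl = λ { refl → irrefl } ; trans = trans
               ; <-resp-≈ = (λ { refl h → h }) , λ { refl h → h } }
  transfer : ∀ {i} → Acc _⊏_ i → Acc (SuffixOrder _⊲_ w) (toℕ i)
  transfer {i} (acc rec) = acc λ { {j} (j< , _ , lt) → subst (Acc _) (Finₚ.toℕ-fromℕ< j<)
    (transfer (rec (subst (λ j → drop j w ⊲ drop (toℕ i) w) (sym (Finₚ.toℕ-fromℕ< j<)) lt))) }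

-- Lower bounds for v, z, zₙₒ, zₑ and b

LCP⇒take≡ : ∀ {x y l} → LCP x y l → take l x ≡ take l y
LCP⇒take≡ leftEnd    = refl
LCP⇒take≡ rightEnd   = refl
LCP⇒take≡ (differ _) = refl
LCP⇒take≡ (agree h)  = cong (_ ∷_) (LCP⇒take≡ h)

-- Cancelling equal first symbols preserves the order. So not only the start of a lex-parse phrase
-- but each of its positions points to a smaller suffix, which moreover is still nonempty.
LCP-lex : ∀ {x y l} → LCP x y l → y <ˡᵉˣ x → ∀ {t} → t < l → t < length y × drop t y <ˡᵉˣ drop t x
LCP-lex (agree h) y<x {zero}  _       = s≤s z≤n , y<x
LCP-lex (agree h) y<x {suc t} (s≤s t<) = let t<y , lt = LCP-lex h (lex-tail y<x) t< in s≤s t<y , lt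

LCP≤length : ∀ {x y l} → LCP x y l → l ≤ length x
LCP≤length leftEnd    = z≤n
LCP≤length rightEnd   = z≤n
LCP≤length (differ _) = z≤n
LCP≤length (agree h)  = s≤s (LCP≤length h)

+<length : ∀ {w : String} {i t} → i < length w → t < length (drop i w) → i + t < length w
+<length {w} {i} {t} i< t< = subst (_≤ length w) (cong suc (+-comm t i))
  (m≤o∸n⇒m+n≤o (suc t) (<⇒≤ i<) (subst (t <_) (length-drop i w) t<))

lexParse⇒Parse : ∀ {w i k} → LexParse w i k → ∃[ es ] Parse w (SuffixOrder _<ˡᵉˣ_ w) i es × length es ≡ k
lexParse⇒Parse done = [] , done , refl
lexParse⇒Parse {w} (copy {i} {j} i< (j< , j≺i , _) lcp _ P) = let es , P′ , eq = lexParse⇒Parse P in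
  _ , copy j (LCP⇒take≡ lcp) (λ {t} t< → let t<y , lt = LCP-lex lcp j≺i t< in
        +<length {w} j< t<y
      , +<length {w} i< (<-≤-trans t< (LCP≤length lcp))
      , subst₂ _<ˡᵉˣ_ (drop-drop j t w) (drop-drop i t w) lt) P′
  , cong suc eq
lexParse⇒Parse (explicit _ _ P) = let es , P′ , eq = lexParse⇒Parse P in _ , single P′ , cong suc eq

markers≤v : ∀ {w m k} → HasMarkers w m → LexParse w 0 k → m ≤ k
markers≤v {w} markers P = let es , P′ , eq = lexParse⇒Parse P in
  subst (_ ≤_) eq (markers≤parse markers (suffixOrder-wellFounded _<ˡᵉˣ_ lex-irrefl lex-trans w) P′)

-- What the three greedy conditions have in common. The bound on `es` and the positive length serve
-- LZ-End, where an earlier end has to yield an earlier start.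
EarlierCopy : String → PhraseCondition → Set
EarlierCopy w C = ∀ {es i l} → All (_≤ i) es → 1 ≤ l → C es i l → ∃[ s ] s < i × factor w s l ≡ factor w i l

greedy⇒Parse : ∀ {w C} → EarlierCopy w C → ∀ {es₀ i k} → All (_≤ i) es₀ → GreedyParse w C es₀ i k →
  ∃[ es ] Parse w _<_ i es × length es ≡ k
greedy⇒Parse earlier _ done = [] , done , refl
greedy⇒Parse earlier es≤ (phrase {i = i} {l} 1≤l _ cond _ P) =
  let s , s<i , eq = earlier es≤ 1≤l cond
      es , P′ , k≡ = greedy⇒Parse earlier (≤-refl ∷ All.map (λ e≤ → ≤-trans e≤ (m≤m+n i l)) es≤) P
  in _ , copy s (sym eq) (λ {t} _ → +-monoˡ-< t s<i) P′ , cong suc k≡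
greedy⇒Parse earlier es≤ (single _ _ P) =
  let es , P′ , k≡ = greedy⇒Parse earlier (≤-refl ∷ All.map m≤n⇒m≤1+n es≤) P
  in _ , single P′ , cong suc k≡

markers≤greedy : ∀ {w C m k} → EarlierCopy w C → HasMarkers w m → GreedyParse w C [] 0 k → m ≤ k
markers≤greedy earlier markers P = let es , P′ , k≡ = greedy⇒Parse earlier [] P in
  subst (_ ≤_) k≡ (markers≤parse markers (λ _ → <-wellFounded _) P′)

-- Named so that the three parsings can be treated uniformly; `greedy` of each is `z`, `zₙₒ`, `zₑ`
-- by definition.
Condition-z Condition-zₙₒ Condition-zₑ : String → PhraseCondition
Condition-z   w es i l = ∃[ j ] j < i × factor w j l ≡ factor w i l
Condition-zₙₒ w es i l = ∃[ j ] j + l ≤ i × factor w j l ≡ factor w i l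
Condition-zₑ  w es i l = ∃[ j ] j + l ∈ es × factor w j l ≡ factor w i l

earlier-z : ∀ w → EarlierCopy w (Condition-z w)
earlier-z w _ _ c = c

earlier-zₙₒ : ∀ w → EarlierCopy w (Condition-zₙₒ w)
earlier-zₙₒ w _ 1≤l (j , j+l≤i , eq) = j , <-≤-trans (m<m+n j 1≤l) j+l≤i , eq

earlier-zₑ : ∀ w → EarlierCopy w (Condition-zₑ w)
earlier-zₑ w es≤ 1≤l (j , j+l∈ , eq) = j , <-≤-trans (m<m+n j 1≤l) (All.lookup es≤ j+l∈) , eq

-- Pointers of macro-schemes

Nth : ∀ {A : Set} → List A → ℕ → A → Set
Nth xs i x = head (drop i xs) ≡ just x

Nth-functional : ∀ {A : Set} {xs : List A} {i x y} → Nth xs i x → Nth xs i y → x ≡ y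
Nth-functional p q = just-injective (trans (sym p) q)

Nth-lookup : ∀ {A : Set} (xs : List A) i → Nth xs (toℕ i) (lookup xs i)
Nth-lookup (x ∷ xs) zero    = refl
Nth-lookup (x ∷ xs) (suc i) = Nth-lookup xs i

Nth-++ : ∀ {A : Set} (xs : List A) {ys t x} → Nth ys t x → Nth (xs ++ ys) (length xs + t) x
Nth-++ []       h = h
Nth-++ (_ ∷ xs) h = Nth-++ xs h

Nth-applyUpTo : ∀ {A : Set} (f : ℕ → A) {l t} ys → t < l → Nth (applyUpTo f l ++ ys) t (f t)
Nth-applyUpTo f {suc l} {zero}  ys _        = refl
Nth-applyUpTo f {suc l} {suc t} ys (s≤s t<) = Nth-applyUpTo (f ∘ suc) ys t<

module _ (w : String) (ps : List Phrase) where

  Follows : ℕ → ℕ → Set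
  Follows x y = Nth (concatMap pointers ps) y (goto x)

  -- Pointers follow no order given in advance; the finite chain that recovers a symbol is itself
  -- the proof that its position is accessible.
  recovers⇒Acc : ∀ {P a y} → Recovers ps P a → Nth (concatMap pointers ps) y P → Acc Follows y
  recovers⇒Acc {y = y} symbol     nth = acc λ f → contradiction (Nth-functional {xs = concatMap pointers ps} {y} nth f) λ ()
  recovers⇒Acc {y = y} (goto i R) nth = acc λ f → step (Nth-functional {xs = concatMap pointers ps} {y} nth f)
    where
    step : ∀ {x} → goto (toℕ i) ≡ goto x → Acc Follows x
    step refl = recovers⇒Acc R (Nth-lookup (concatMap pointers ps) i)

  Pointwise-Nth : ∀ {Ps : List Pointer} {u} → Pointwise (Recovers ps) Ps u → ∀ {y} → y < length u →
    ∃[ P ] ∃[ a ] Nth Ps y P × Recovers ps P a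
  Pointwise-Nth (R ∷ _)  {zero}  _        = _ , _ , refl , R
  Pointwise-Nth (_ ∷ Rs) {suc y} (s≤s y<) = Pointwise-Nth Rs y<

  -- `pre` holds the pointers of the phrases already passed. Its length is the current position, so
  -- pointer `t` of a copy is pointer `i + t` of the whole scheme.
  factorizes⇒Parse : ∀ {i} pre qs → concatMap pointers ps ≡ pre ++ concatMap pointers qs → length pre ≡ i →
    Factorizes w i qs → ∃[ es ] Parse w Follows i es × length es ≡ length qs
  factorizes⇒Parse pre [] _ _ done = [] , done , refl
  factorizes⇒Parse {i} pre (explicit a ∷ qs) eq len (explicit _ F) =
    let es , P , k≡ = factorizes⇒Parse (pre ∷ʳ symbol a) qs (trans eq (sym (∷ʳ-++ pre _ _)))
                        (trans (length-++ pre) (trans (+-comm _ 1) (cong suc len))) F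
    in _ , single P , cong suc k≡
  factorizes⇒Parse {i} pre (copy s l ∷ qs) eq len (copy _ _ _ _ same F) =
    let es , P , k≡ = factorizes⇒Parse (pre ++ pointers (copy s l)) qs (trans eq (sym (++-assoc pre _ _)))
                        (trans (length-++ pre) (cong₂ _+_ len (trans (length-map (λ t → goto (s + t)) (upTo l)) (length-upTo l)))) F
    in _ , copy s same (λ {t} t< → subst₂ (λ Q y → Nth Q y (goto (s + t))) (sym eq) (cong (_+ t) len)
         (Nth-++ pre (subst (λ Q → Nth (Q ++ _) t _) (sym (map-upTo (λ t → goto (s + t)) l)) (Nth-applyUpTo (λ t → goto (s + t)) _ t<)))) P
       , cong suc k≡

markers≤b : ∀ {w m ps} → HasMarkers w m → IsMacroScheme w ps → m ≤ length ps
markers≤b {w} {ps = ps} markers (F , Rs) =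
  let es , P , k≡ = factorizes⇒Parse w ps [] ps refl refl F in
  subst (_ ≤_) k≡ (markers≤parse markers
    (λ p< → let _ , _ , nth , R = Pointwise-Nth w ps Rs p< in recovers⇒Acc w ps R nth) P)

-- Lower bound for grammars

Occurs-short : ∀ {a j} → ¬ Occurs (a ∷ []) j
Occurs-short {j = zero}  ([] , s , ())
Occurs-short {j = suc j} ([] , s , ())
Occurs-short             (_ ∷ [] , s , ())
Occurs-short             (_ ∷ _ ∷ _ , s , ())

Occurs-[] : ∀ {j} → ¬ Occurs [] j
Occurs-[] ([] , s , ())
Occurs-[] (_ ∷ _ , s , ())

Occurs-++ˡ : ∀ {u v j} → Occurs u j → Occurs (u ++ v) j
Occurs-++ˡ {v = v} {j} (p , s , refl) = p , s ++ v , trans (++-assoc p _ v) (cong (λ x → p ++ 1 ∷ x) (++-assoc (zeros j) (1 ∷ s) v))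

Occurs-++ʳ : ∀ u {v j} → Occurs v j → Occurs (u ++ v) j
Occurs-++ʳ u (p , s , refl) = u ++ p , s , sym (++-assoc u p _)

Occurs-take : ∀ t {u j} → Occurs (take t u) j → Occurs u j
Occurs-take t {u} o = subst (λ u → Occurs u _) (take++drop≡id t u) (Occurs-++ˡ o)

Occurs-drop : ∀ t {u j} → Occurs (drop t u) j → Occurs u j
Occurs-drop t {u} o = subst (λ u → Occurs u _) (take++drop≡id t u) (Occurs-++ʳ (take t u) o)

Crosses-++ˡ : ∀ u {v w j} → Crosses v w j → Crosses (u ++ v) w j
Crosses-++ˡ u (x , y , v′ , w′ , refl , w≡ , j≡) = x , y , u ++ v′ , w′ , sym (++-assoc u v′ _) , w≡ , j≡

¬Crosses-[] : ∀ {u j} → ¬ Crosses u [] j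
¬Crosses-[] (_ , zero  , _ , _ , _ , () , _)
¬Crosses-[] (_ , suc _ , _ , _ , _ , () , _)

lead-++ : ∀ u {v s} → lead ((u ++ 1 ∷ v) ++ s) ≡ lead (u ++ 1 ∷ v)
lead-++ []          = refl
lead-++ (0 ∷ u)     = cong suc (lead-++ u)
lead-++ (suc _ ∷ u) = refl

-- The copies behind a border differ in number, whence the `s`. But a crossing puts a one into `u`,
-- so the marker ends within the very next copy and does not depend on `s`: a power contributes one
-- marker, whatever its exponent.
Occurs-power : ∀ k {u j} → Occurs (concat (replicate k u)) j → Occurs u j ⊎ ∃[ s ] Crosses u (u ++ s) j
Occurs-power zero    o = contradiction o Occurs-[]
Occurs-power (suc k) {u} o with Occurs-++ u o
... | inj₁ o′        = inj₁ o′
... | inj₂ (inj₁ o′) = Occurs-power k o′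
Occurs-power (suc zero)    {u} o | inj₂ (inj₂ c) = contradiction c ¬Crosses-[]
Occurs-power (suc (suc k)) {u} o | inj₂ (inj₂ c) = inj₂ (_ , c)

module _ {κ : Kind} (G : Grammar κ) where
  open Grammar G

  -- The markers a rule contributes: those across the boundary after symbol q of a
  -- concatenation, or across the boundary of two copies in a power.
  Contributes : Rule m → ℕ → ℕ → Set
  Contributes (concatenation α) q j = ∃[ u ] ∃[ v ]
    SeqExpands G (take (suc q) (List⁺.toList α)) u × SeqExpands G (drop (suc q) (List⁺.toList α)) v × Crosses u v j
  Contributes (power X _ _) q j = ∃[ u ] ∃[ s ] Expands G X u × Crosses u (u ++ s) j
  Contributes (prefix _ _)  q j = ⊥
  Contributes (suffix _ _)  q j = ⊥

  Contributes-functional : ∀ R {q j k} → Contributes R q j → Contributes R q k → j ≡ k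
  Contributes-functional (concatenation α) (_ , _ , D , E , c) (_ , _ , D′ , E′ , c′)
    with refl ← proj₁ (seq-unique D D′) | refl ← proj₁ (seq-unique E E′) = Crosses-functional c c′
  Contributes-functional (power X _ _) (u , s , D , c) (_ , s′ , D′ , c′) with refl ← proj₁ (expands-unique D D′) =
    trans (Crosses⇒≡ c) (trans (cong (_+_ (lead (reverse u))) (same c)) (sym (Crosses⇒≡ c′)))
    where
    same : ∀ {u v j} → Crosses u v j → lead (u ++ s) ≡ lead (u ++ s′)
    same (x , _ , u′ , _ , refl , _) = trans (lead-++ u′) (sym (lead-++ u′))

  Contributed : ℕ → Set
  Contributed j = ∃[ A ] ∃[ q ] q < ruleSize (rule A) × Contributes (rule A) q j

  SeqContributes : List (Symbol m) → ℕ → Set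
  SeqContributes Xs j = ∃[ q ] q < length Xs × ∃[ u ] ∃[ v ]
    SeqExpands G (take (suc q) Xs) u × SeqExpands G (drop (suc q) Xs) v × Crosses u v j

  mutual
    -- The marker is followed down the derivation until a junction splits it. Truncation rules are
    -- passed through, since an occurrence in a prefix or suffix is one in the full expansion.
    contributed : ∀ {X u j} → Expands G X u → Occurs u j → Contributed j
    contributed term        o = contradiction o Occurs-short
    contributed (var {A} D) o with rule-contributed D o
    ... | inj₁ (q , q< , c) = A , q , q< , c
    ... | inj₂ c            = c

    rule-contributed : ∀ {R u j} → RuleExpands G R u → Occurs u j →
      (∃[ q ] q < ruleSize R × Contributes R q j) ⊎ Contributed j
    rule-contributed (concatenation Ds) o = seq-contributed Ds o
    rule-contributed (power {k = k} D)  o with Occurs-power k o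
    ... | inj₁ o′      = inj₂ (contributed D o′)
    ... | inj₂ (s , c) = inj₁ (0 , s≤s z≤n , _ , s , D , c)
    rule-contributed (prefix {t = t} D _)         o = inj₂ (contributed D (Occurs-take t o))
    rule-contributed (suffix {t = t} {u = u} D _) o = inj₂ (contributed D (Occurs-drop (length u ∸ t) o))

    seq-contributed : ∀ {Xs u j} → SeqExpands G Xs u → Occurs u j → SeqContributes Xs j ⊎ Contributed j
    seq-contributed []       o = contradiction o Occurs-[]
    seq-contributed (_∷_ {u = u} D Ds) o with Occurs-++ u o
    ... | inj₁ o′        = inj₂ (contributed D o′)
    ... | inj₂ (inj₂ c)  = inj₁ (0 , s≤s z≤n , _ , _ , D ∷ [] , Ds , subst (λ u → Crosses u _ _) (sym (++-identityʳ u)) c)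
    ... | inj₂ (inj₁ o′) with seq-contributed Ds o′
    ...   | inj₁ (q , q< , _ , _ , E , F , c) = inj₁ (suc q , s≤s q< , _ , _ , D ∷ E , F , Crosses-++ˡ u c)
    ...   | inj₂ c = inj₂ c

  markers≤grammar : ∀ {X w n} → HasMarkers w n → Expands G X w → n ≤ grammarSize G
  markers≤grammar {n = n} markers D = subst (n ≤_) length≡ (markers≤ R functional codes assign)
    where
    codesOf : Fin m → List (Fin m × ℕ)
    codesOf A = map (A ,_) (upTo (ruleSize (rule A)))
    codes : List (Fin m × ℕ)
    codes = concat (tabulate codesOf)
    length≡ : length codes ≡ grammarSize G
    length≡ = trans (length-concat-tabulate codesOf) (cong sum (tabulate-cong λ A →
      trans (length-map (A ,_) (upTo (ruleSize (rule A)))) (length-upTo _)))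
    R : Fin m × ℕ → ℕ → Set
    R (A , q) = Contributes (rule A) q
    functional : ∀ {a j k} → R a j → R a k → j ≡ k
    functional {A , _} = Contributes-functional (rule A)
    assign : ∀ {j} → j < n → ∃[ a ] a ∈ codes × R a j
    assign j< with contributed D (markers j<)
    ... | A , q , q< , c = (A , q) , ∈-concat⁺′ (∈-map⁺ (A ,_) (∈-upTo⁺ q<)) (∈-tabulate⁺ A) , c

-- Words given by their run lengths

blocks : List ℕ → String
blocks []       = []
blocks (r ∷ rs) = zeros r ++ 1 ∷ blocks rs

-- The leading one turns the first run into a marker too. Two consecutive runs are exposed because δ
-- counts factors meeting both and r compares an occurrence of 0^j 1 in each; the later runs
-- guarantee enough length to the right.
blocks-at : ∀ f {m j} → suc j < m → ∃[ p ] ∃[ rs ]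
    1 ∷ blocks (applyUpTo f m) ≡ p ++ 1 ∷ zeros (f j) ++ 1 ∷ zeros (f (suc j)) ++ 1 ∷ blocks rs
  × (∀ {t} → suc j < t → t < m → f t ∈ rs)
blocks-at f {suc (suc m)} {zero}  _        = [] , applyUpTo (λ t → f (2 + t)) m , refl , later
  where
  later : ∀ {t} → 1 < t → t < 2 + m → f t ∈ applyUpTo (λ t → f (2 + t)) m
  later {suc zero}    (s≤s ()) _
  later {suc (suc t)} _ (s≤s (s≤s t<m)) = ∈-applyUpTo⁺ (λ t → f (2 + t)) t<m
blocks-at f {suc m} {suc j} (s≤s j<) with blocks-at (f ∘ suc) j<
... | p , rs , eq , later = 1 ∷ zeros (f 0) ++ p , rs
  , cong (1 ∷_) (trans (cong (zeros (f 0) ++_) eq) (sym (++-assoc (zeros (f 0)) p _)))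
  , λ { {suc t} (s≤s j<t) (s≤s t<m) → later j<t t<m }

∈⇒<length-blocks : ∀ {r rs} → r ∈ rs → r < length (blocks rs)
∈⇒<length-blocks {rs = r ∷ rs} (here refl) = subst (r <_) (sym (length-++ (zeros r)))
  (subst (λ n → r < n + suc (length (blocks rs))) (sym (length-replicate r)) (m<m+n r (s≤s z≤n)))
∈⇒<length-blocks {rs = r ∷ rs} (there r∈) = <-≤-trans (∈⇒<length-blocks r∈)
  (≤-trans (n≤1+n _) (≤-trans (m≤n+m _ (length (zeros r))) (≤-reflexive (sym (length-++ (zeros r))))))

growing : ℕ → String
growing m = 1 ∷ blocks (upTo m)

growing-markers : ∀ m → HasMarkers (growing (suc m)) m
growing-markers m {j} j< with blocks-at id (s≤s j<)
... | p , _ , eq , _ = p , _ , eq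

m≤length-growing : ∀ m → m ≤ length (growing m)
m≤length-growing zero    = z≤n
m≤length-growing (suc m) = ≤-trans (∈⇒<length-blocks (∈-upTo⁺ ≤-refl)) (n≤1+n _)

-- Lower bound for δ

twoRuns : ℕ → ℕ → String
twoRuns i j = zeros i ++ 1 ∷ zeros j ++ 1 ∷ []

length-twoRuns : ∀ i j → length (twoRuns i j) ≡ i + (2 + j)
length-twoRuns i j = trans (length-++ (zeros i)) (cong₂ _+_ (length-replicate i) (length-marker j))

twoRuns-++ : ∀ i j s → twoRuns i j ++ s ≡ zeros i ++ 1 ∷ zeros j ++ 1 ∷ s
twoRuns-++ i j s = trans (++-assoc (zeros i) _ s) (cong (λ x → zeros i ++ 1 ∷ x) (++-assoc (zeros j) (1 ∷ []) s))

twoRuns-functional : ∀ {i i′ j j′ s s′} → twoRuns i j ++ s ≡ twoRuns i′ j′ ++ s′ → i ≡ i′ × j ≡ j′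
twoRuns-functional {i} {i′} {j} {j′} {s} {s′} eq₀ = i≡ , j≡ i≡ eq
  where
  eq : zeros i ++ 1 ∷ zeros j ++ 1 ∷ s ≡ zeros i′ ++ 1 ∷ zeros j′ ++ 1 ∷ s′
  eq = trans (sym (twoRuns-++ i j s)) (trans eq₀ (twoRuns-++ i′ j′ s′))
  i≡ : i ≡ i′
  i≡ = trans (sym (lead-zeros i _)) (trans (cong lead eq) (lead-zeros i′ _))
  j≡ : i ≡ i′ → zeros i ++ 1 ∷ zeros j ++ 1 ∷ s ≡ zeros i′ ++ 1 ∷ zeros j′ ++ 1 ∷ s′ → j ≡ j′
  j≡ refl eq = trans (sym (lead-zeros j s)) (trans (cong lead (∷-injectiveʳ (++-cancelˡ (zeros i) _ _ eq))) (lead-zeros j′ s′))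

take-≥-++ : ∀ {A : Set} (xs ys : List A) k → length xs ≤ k → ∃[ s ] take k (xs ++ ys) ≡ xs ++ s
take-≥-++ []       ys k       _        = take k ys , refl
take-≥-++ (x ∷ xs) ys (suc k) (s≤s h) = let s , eq = take-≥-++ xs ys k h in s , cong (x ∷_) eq

factors : String → ℕ → List String
factors w k = map (λ i → factor w i k) (upTo (suc (length w) ∸ k))

-- The factor starts `i` zeros before the end of run `j` and contains all of run `suc j`. The last
-- run, of m - 1 ≥ k zeros, leaves room for `k` symbols.
growing-twoRuns : ∀ {m k i j} → i ≤ j → i + (3 + j) ≤ k → k < m → 2 + j < m →
  ∃[ s ] twoRuns i (suc j) ++ s ∈ factors (growing m) k
growing-twoRuns {m} {k} {i} {j} i≤j fits k<m j<m with m≤n⇒∃[o]m+o≡n i≤j | blocks-at id {m} {j} (<-trans (n<1+n _) j<m)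
... | o , refl | p , rs , eq , later = let s , take≡ = take-≥-++ (twoRuns i (suc j)) (blocks rs) k (subst (_≤ k) (sym (length-twoRuns i (suc j))) fits) in
    s , subst (_∈ factors (growing m) k) (trans (cong (take k) drop≡) take≡) (∈-map⁺ (λ q → factor (growing m) q k) (∈-upTo⁺ start<))
  where
  open ≡-Reasoning
  q = length (p ++ 1 ∷ zeros o)
  w≡ : growing m ≡ (p ++ 1 ∷ zeros o) ++ twoRuns i (suc j) ++ blocks rs
  w≡ = begin
    growing m
      ≡⟨ eq ⟩
    p ++ 1 ∷ zeros (i + o) ++ 1 ∷ zeros (suc j) ++ 1 ∷ blocks rs
      ≡⟨ cong (λ z → p ++ 1 ∷ z ++ 1 ∷ zeros (suc j) ++ 1 ∷ blocks rs) (trans (cong zeros (+-comm i o)) (zeros-+ o i)) ⟩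
    p ++ 1 ∷ (zeros o ++ zeros i) ++ 1 ∷ zeros (suc j) ++ 1 ∷ blocks rs
      ≡⟨ cong (λ z → p ++ 1 ∷ z) (++-assoc (zeros o) (zeros i) _) ⟩
    p ++ 1 ∷ zeros o ++ zeros i ++ 1 ∷ zeros (suc j) ++ 1 ∷ blocks rs
      ≡⟨ sym (++-assoc p (1 ∷ zeros o) _) ⟩
    (p ++ 1 ∷ zeros o) ++ zeros i ++ 1 ∷ zeros (suc j) ++ 1 ∷ blocks rs
      ≡⟨ cong ((p ++ 1 ∷ zeros o) ++_) (sym (twoRuns-++ i (suc j) (blocks rs))) ⟩
    (p ++ 1 ∷ zeros o) ++ twoRuns i (suc j) ++ blocks rs ∎
  drop≡ : drop q (growing m) ≡ twoRuns i (suc j) ++ blocks rs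
  drop≡ = trans (cong (drop q) w≡) (drop-++-≡ (p ++ 1 ∷ zeros o) _)
  k≤rest : ∀ {m} → k < m → 2 + j < m → (∀ {t} → suc j < t → t < m → t ∈ rs) → k ≤ length (twoRuns i (suc j) ++ blocks rs)
  k≤rest {suc m} (s≤s k≤m) (s≤s j<m) later = ≤-trans k≤m (≤-trans (<⇒≤ (∈⇒<length-blocks (later j<m ≤-refl)))
    (≤-trans (m≤n+m _ (length (twoRuns i (suc j)))) (≤-reflexive (sym (length-++ (twoRuns i (suc j)))))))
  start< : q < suc (length (growing m)) ∸ k
  start< = m+n≤o⇒m≤o∸n (suc q) (s≤s (subst (q + k ≤_) (sym (trans (cong length w≡) (length-++ (p ++ 1 ∷ zeros o))))
    (+-monoʳ-≤ q (k≤rest k<m j<m later))))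

length-cartesianProduct : ∀ {A B : Set} (xs : List A) (ys : List B) → length (cartesianProduct xs ys) ≡ length xs * length ys
length-cartesianProduct []       ys = refl
length-cartesianProduct (x ∷ xs) ys = trans (length-++ (map (x ,_) ys)) (cong₂ _+_ (length-map (x ,_) ys) (length-cartesianProduct xs ys))

-- With `i` below `H` and run index `H + j`, the run always supplies `i` zeros. The longest prefix
-- to be told apart has (H - 1) + 1 + 2H + 1 = 3H + 1 symbols, which fixes the factor length.
growing-distinctFactors : ∀ H → H * H ≤ distinctFactors (growing (2 + 3 * H)) (suc (3 * H))
growing-distinctFactors H = subst (_≤ length (deduplicate (≡-dec _≟_) (factors w k))) length≡
  (length-≤-by R functional _ {pairs} (Uniqueₚ.cartesianProduct⁺ (Uniqueₚ.upTo⁺ H) (Uniqueₚ.upTo⁺ H)) assign)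
  where
  open +-*-Solver
  w = growing (2 + 3 * H)
  k = suc (3 * H)
  pairs : List (ℕ × ℕ)
  pairs = cartesianProduct (upTo H) (upTo H)
  length≡ : length pairs ≡ H * H
  length≡ = trans (length-cartesianProduct (upTo H) (upTo H)) (cong₂ _*_ (length-upTo H) (length-upTo H))
  R : String → ℕ × ℕ → Set
  R x (i , j) = ∃[ s ] x ≡ twoRuns i (suc (H + j)) ++ s
  functional : ∀ {x a b} → R x a → R x b → a ≡ b
  functional {a = i , j} {i′ , j′} (s , refl) (s′ , eq) with twoRuns-functional {i} {i′} {suc (H + j)} {suc (H + j′)} eq
  ... | refl , j≡ = cong (i ,_) (+-cancelˡ-≡ H j j′ (suc-injective j≡))
  assign : ∀ {a} → a ∈ pairs → ∃[ x ] x ∈ deduplicate (≡-dec _≟_) (factors w k) × R x a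
  assign {i , j} a∈ = let i∈ , j∈ = ∈-cartesianProduct⁻ (upTo H) (upTo H) a∈
                          i<H = ∈-upTo⁻ i∈
                          j<H = ∈-upTo⁻ j∈
                          H+H≤3H = +-monoʳ-≤ H (m≤m+n H (H + 0))
                          s , x∈ = growing-twoRuns {2 + 3 * H} {k} {i} {H + j} (≤-trans (<⇒≤ i<H) (m≤m+n H j)) (fits i<H j<H) ≤-refl
                                     (s≤s (s≤s (<-≤-trans (+-monoʳ-< H j<H) H+H≤3H)))
                      in _ , ∈-deduplicate⁺ (≡-dec _≟_) x∈ , s , refl
    where
    fits : ∀ {i j} → i < H → j < H → i + (3 + (H + j)) ≤ suc (3 * H)
    fits {i} {j} i<H j<H = subst₂ _≤_
      (solve 3 (λ i j H → con 1 :+ i :+ (con 1 :+ j :+ (H :+ con 1)) := i :+ (con 3 :+ (H :+ j))) refl i j H)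
      (solve 1 (λ H → H :+ (H :+ (H :+ con 1)) := con 1 :+ con 3 :* H) refl H)
      (+-mono-≤ i<H (+-monoˡ-≤ (H + 1) j<H))

-- Runs of the Burrows–Wheeler transform

lexOrder : DecTotalOrder _ _ _
lexOrder = ≤-decTotalOrder ℕₚ.≤-decTotalOrder

open Sort lexOrder using (sort; sort-↭; sort-↗)

rotations : String → List String
rotations w = map (λ i → drop i w ++ take i w) (upTo (length w))

rotation∈ : ∀ x y → y ≢ [] → y ++ x ∈ rotations (x ++ y)
rotation∈ x y y≢[] = subst (_∈ rotations (x ++ y)) (cong₂ _++_ (drop-++-≡ x y) (take-++-≤ x y))
  (∈-map⁺ (λ i → drop i (x ++ y) ++ take i (x ++ y)) (∈-upTo⁺ (subst (length x <_) (sym (length-++ x)) (m<m+n _ (positive y y≢[])))))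
  where
  positive : ∀ (y : String) → y ≢ [] → 1 ≤ length y
  positive []      y≢[] = contradiction refl y≢[]
  positive (_ ∷ _) _    = s≤s z≤n

-- The default 0 concerns only the empty word, which is never a rotation.
lastSymbol : String → ℕ
lastSymbol w = maybe′ id 0 (last w)

lastSymbol-∷ʳ : ∀ x a → lastSymbol (x ∷ʳ a) ≡ a
lastSymbol-∷ʳ []          a = refl
lastSymbol-∷ʳ (_ ∷ [])    a = refl
lastSymbol-∷ʳ (_ ∷ y ∷ x) a = lastSymbol-∷ʳ (y ∷ x) a

mapMaybe-last : ∀ {L} → All (_≢ []) L → mapMaybe last L ≡ map lastSymbol L
mapMaybe-last []                     = refl
mapMaybe-last (_∷_ {x = x} x≢[] h) with last x in eq
... | just a  = cong (a ∷_) (mapMaybe-last h)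
... | nothing = contradiction (last≡nothing x eq) x≢[]
  where
  last≡nothing : ∀ (x : String) → last x ≡ nothing → x ≡ []
  last≡nothing []          _  = refl
  last≡nothing (_ ∷ y ∷ x) eq = contradiction (last≡nothing (y ∷ x) eq) λ ()

sortedRotations : String → List String
sortedRotations w = sort (rotations w)

rotations-nonempty : ∀ w → All (_≢ []) (rotations w)
rotations-nonempty w = Allₚ.map⁺ (All.tabulate λ {i} i∈ eq → contradiction
  (subst (suc i ≤_) (trans (sym (length-rotation i (<⇒≤ (∈-upTo⁻ i∈)))) (cong length eq)) (∈-upTo⁻ i∈)) λ ())
  where
  length-rotation : ∀ i → i ≤ length w → length (drop i w ++ take i w) ≡ length w
  length-rotation i i≤ = trans (length-++ (drop i w)) (trans (+-comm (length (drop i w)) _)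
    (trans (sym (length-++ (take i w))) (cong length (take++drop≡id i w))))

bwt≡ : ∀ w → bwt w ≡ map lastSymbol (sortedRotations w)
bwt≡ w = mapMaybe-last (Permₚ.All-resp-↭ (↭-sym (sort-↭ (rotations w))) (rotations-nonempty w))

module _ {A : Set} (f : A → ℕ) where

  -- The elements after which a new run of `f` begins. They are kept as elements, not merely
  -- counted, so that markers can be charged to their keys.
  changes : List A → List A
  changes []           = []
  changes (x ∷ [])     = []
  changes (x ∷ xs@(y ∷ _)) with f x ℕ.≡ᵇ f y | changes xs
  ... | true  | cs = cs
  ... | false | cs = x ∷ cs

  length-changes : ∀ xs → length (changes xs) ≤ length (derun _≟_ (map f xs))
  length-changes []           = z≤n
  length-changes (x ∷ [])     = z≤n
  length-changes (x ∷ xs@(y ∷ _)) with f x ℕ.≡ᵇ f y | length-changes xs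
  ... | true  | le = le
  ... | false | le = s≤s le

  changes-∷ : ∀ x {c xs} → c ∈ changes xs → c ∈ changes (x ∷ xs)
  changes-∷ x {xs = y ∷ xs} c∈ with f x ℕ.≡ᵇ f y
  ... | true  = c∈
  ... | false = there c∈

  -- Equal keys are contiguous, so two elements with the same key and different values
  -- enclose a change at that key.
  module _ (key : A → ℕ) where
    Descending : List A → Set
    Descending = AllPairs (λ x y → key y ≤ key x)

    change-from-head : ∀ {x y xs} → Descending (x ∷ xs) → y ∈ xs → key x ≡ key y → f x ≢ f y →
      ∃[ c ] c ∈ changes (x ∷ xs) × key c ≡ key y
    change-from-head {x} {y} {z ∷ xs} ((kz≤kx ∷ _) ∷ (z≥ ∷ desc)) y∈ kx≡ky fx≢fy with f x ℕ.≡ᵇ f z in eq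
    ... | false = x , here refl , kx≡ky
    ... | true  = continue y∈
      where
      fx≡fz : f x ≡ f z
      fx≡fz = ≡ᵇ⇒≡ (f x) (f z) (subst T (sym eq) tt)
      continue : y ∈ z ∷ xs → ∃[ c ] c ∈ changes (z ∷ xs) × key c ≡ key y
      continue (here refl) = contradiction fx≡fz fx≢fy
      continue (there y∈)  = change-from-head (z≥ ∷ desc) y∈
        -- `z` lies between `x` and `y` in the sorted list, so it shares their key.
        (≤-antisym (≤-trans kz≤kx (≤-reflexive kx≡ky)) (All.lookup z≥ y∈)) (fx≢fy ∘ trans fx≡fz)

    change-between : ∀ {x y xs} → Descending xs → x ∈ xs → y ∈ xs → key x ≡ key y → f x ≢ f y →
      ∃[ c ] c ∈ changes xs × key c ≡ key y
    change-between desc (here refl) (here refl) _  fx≢fy = contradiction refl fx≢fy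
    change-between desc (here refl) (there y∈)  k≡ fx≢fy = change-from-head desc y∈ k≡ fx≢fy
    change-between desc (there x∈)  (here refl) k≡ fx≢fy =
      let c , c∈ , kc≡ = change-from-head desc x∈ (sym k≡) (fx≢fy ∘ sym) in c , c∈ , trans kc≡ k≡
    change-between {xs = z ∷ xs} (_ ∷ desc) (there x∈) (there y∈) k≡ fx≢fy =
      let c , c∈ , kc≡ = change-between desc x∈ y∈ k≡ fx≢fy in c , changes-∷ z {xs = xs} c∈ , kc≡

-- More leading zeros make a word smaller, except that a word of zeros alone precedes its longer
-- extensions; the one in `x` excludes this.
lead-antitone : ∀ {x y} → 1 ∈ x → DecTotalOrder._≤_ lexOrder x y → lead y ≤ lead x
lead-antitone ()          (base _)
lead-antitone ()          halt
lead-antitone _           (this {y = zero} (x≤0 , x≢0)) = contradiction (n≤0⇒n≡0 x≤0) x≢0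
lead-antitone _           (this {y = suc _} _)          = z≤n
lead-antitone (there 1∈) (next {zero} refl x≤y)  = s≤s (lead-antitone 1∈ x≤y)
lead-antitone _           (next {suc _} refl x≤y) = z≤n

sortedRotations-descending : ∀ {w} → 1 ∈ w → Descending lastSymbol lead (sortedRotations w)
sortedRotations-descending {w} 1∈w = go
  (Permₚ.All-resp-↭ (↭-sym (sort-↭ (rotations w))) (Allₚ.map⁺ (All.tabulate λ {i} _ → 1∈rotation i)))
  (Linkedₚ.Linked⇒AllPairs (DecTotalOrder.trans lexOrder) (sort-↗ (rotations w)))
  where
  1∈rotation : ∀ i → 1 ∈ drop i w ++ take i w
  1∈rotation i with ∈-++⁻ (take i w) (subst (1 ∈_) (sym (take++drop≡id i w)) 1∈w)
  ... | inj₁ 1∈ = ∈-++⁺ʳ (drop i w) 1∈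
  ... | inj₂ 1∈ = ∈-++⁺ˡ 1∈
  go : ∀ {L} → All (1 ∈_) L → AllPairs (DecTotalOrder._≤_ lexOrder) L → Descending lastSymbol lead L
  go []         []           = []
  go (1∈ ∷ 1∈s) (x≤ ∷ pairs) = All.map (lead-antitone 1∈) x≤ ∷ go 1∈s pairs

growing-r : ∀ m → m ≤ length (derun _≟_ (bwt (growing (suc m))))
growing-r m = subst (λ u → m ≤ length (derun _≟_ u)) (sym (bwt≡ w)) (≤-trans
  (markers≤ (λ c j → lead c ≡ j) (λ p q → trans (sym p) q) (changes lastSymbol (sortedRotations w)) assign)
  (length-changes lastSymbol (sortedRotations w)))
  where
  w = growing (suc m)
  assign : ∀ {j} → j < m → ∃[ c ] c ∈ changes lastSymbol (sortedRotations w) × lead c ≡ j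
  assign {j} j< with blocks-at id (s≤s j<)
  ... | p , rs , eq , _ =
    let c , c∈ , lead≡ = change-between lastSymbol lead (sortedRotations-descending (here refl))
                           (rotated (p ∷ʳ 1) y₁ split₁ (nonempty j)) (rotated x₂ (zeros j ++ 1 ∷ blocks rs) split₂ (nonempty j))
                           (trans (trans (cong lead (++-assoc (zeros j) _ _)) (lead-zeros j _)) (sym lead₂)) last≢
    in c , c∈ , trans lead≡ lead₂
    where
    -- The rotation at run `j` comes after a one. The other starts one zero into run `suc j`, so it
    -- also begins with 0^j 1 but comes after a zero.
    y₁ = zeros j ++ 1 ∷ zeros (suc j) ++ 1 ∷ blocks rs
    x₂ = (p ++ 1 ∷ zeros j ++ 1 ∷ []) ∷ʳ 0
    split₁ : w ≡ (p ∷ʳ 1) ++ y₁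
    split₁ = trans eq (sym (∷ʳ-++ p 1 _))
    split₂ : w ≡ x₂ ++ zeros j ++ 1 ∷ blocks rs
    split₂ = trans eq (sym (trans (∷ʳ-++ (p ++ 1 ∷ zeros j ++ 1 ∷ []) 0 _)
      (trans (++-assoc p _ _) (cong (λ x → p ++ 1 ∷ x) (++-assoc (zeros j) (1 ∷ []) _)))))
    rotated : ∀ x y → w ≡ x ++ y → y ≢ [] → y ++ x ∈ sortedRotations w
    rotated x y w≡ y≢[] = Permₚ.∈-resp-↭ (↭-sym (sort-↭ (rotations w))) (subst (λ u → y ++ x ∈ rotations u) (sym w≡) (rotation∈ x y y≢[]))
    nonempty : ∀ j {u} → zeros j ++ 1 ∷ u ≢ []
    nonempty zero    ()
    nonempty (suc _) ()
    lead₂ : lead ((zeros j ++ 1 ∷ blocks rs) ++ x₂) ≡ j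
    lead₂ = trans (cong lead (++-assoc (zeros j) _ _)) (lead-zeros j _)
    last≢ : lastSymbol (y₁ ++ p ∷ʳ 1) ≢ lastSymbol ((zeros j ++ 1 ∷ blocks rs) ++ x₂)
    last≢ eq = contradiction (trans (sym (trans (cong lastSymbol (sym (++-assoc y₁ p _))) (lastSymbol-∷ʳ (y₁ ++ p) 1)))
      (trans eq (trans (cong lastSymbol (sym (++-assoc (zeros j ++ 1 ∷ blocks rs) (p ++ 1 ∷ zeros j ++ 1 ∷ []) _)))
        (lastSymbol-∷ʳ ((zeros j ++ 1 ∷ blocks rs) ++ (p ++ 1 ∷ zeros j ++ 1 ∷ [])) 0)))) λ ()

-- ℓ is bounded on the growing words

growingLSystem : (d n : ℕ) → 1 ≤ n → LSystem
growingLSystem d n 1≤n = record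
  { σ = 3 ; symbols = mk↣ {to = toℕ} Finₚ.toℕ-injective ; φ = φ ; τ = τ
  ; axiom = suc (suc zero) ∷ [] ; d = d ; n = n ; 1≤n = 1≤n }
  where
  φ : Fin 3 → List⁺ (Fin 3)
  φ zero             = zero ∷ []
  φ (suc zero)       = zero ∷ suc zero ∷ []
  φ (suc (suc zero)) = suc (suc zero) ∷ suc zero ∷ []
  τ : Fin 3 → Fin 3
  τ zero             = zero
  τ (suc zero)       = suc zero
  τ (suc (suc zero)) = suc zero

module _ (d n : ℕ) (1≤n : 1 ≤ n) where
  open LSystem (growingLSystem d n 1≤n) using (φ; τ; axiom)

  letterBlocks : List ℕ → List (Fin 3)
  letterBlocks []       = []
  letterBlocks (r ∷ rs) = replicate r zero ++ suc zero ∷ letterBlocks rs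

  φ-letterBlocks : ∀ rs → concatMap (λ a → List⁺.toList (φ a)) (letterBlocks rs) ≡ letterBlocks (map suc rs)
  φ-letterBlocks []       = refl
  φ-letterBlocks (r ∷ rs) = go r
    where
    go : ∀ r → concatMap (λ a → List⁺.toList (φ a)) (letterBlocks (r ∷ rs)) ≡ letterBlocks (suc r ∷ map suc rs)
    go zero    = cong (λ x → zero ∷ suc zero ∷ x) (φ-letterBlocks rs)
    go (suc r) = cong (zero ∷_) (go r)

  growing-level : ∀ d → level φ (List⁺.toList axiom) d ≡ suc (suc zero) ∷ letterBlocks (upTo d)
  growing-level zero    = refl
  growing-level (suc d) = trans (cong (concatMap (λ a → List⁺.toList (φ a))) (growing-level d))
    (cong (λ x → suc (suc zero) ∷ suc zero ∷ x) (trans (φ-letterBlocks (upTo d)) (cong letterBlocks (map-upTo suc d))))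

  map-letterBlocks : ∀ rs → map (λ a → toℕ (τ a)) (letterBlocks rs) ≡ blocks rs
  map-letterBlocks []           = refl
  map-letterBlocks (zero ∷ rs)  = cong (1 ∷_) (map-letterBlocks rs)
  map-letterBlocks (suc r ∷ rs) = cong (0 ∷_) (map-letterBlocks (r ∷ rs))

-- 11 = 5 + 1 + 3 + 2, from rules, axiom, letters and the constant of the size. The offset 2 makes
-- the word long enough for an alphabet of 3 letters.
growing-ℓ≤11 : ∀ {e} → 1 ≤ e → ∀ m → ∃[ L ] LBounded e L × LGenerates L (growing (2 + m)) × lSize L ≡ 11
growing-ℓ≤11 {e} 1≤e m = L
  , (≤-trans (m≤length-growing (2 + m)) (n≤n^e n 1≤e) , ≤-trans (s≤s (s≤s (s≤s z≤n))) (n≤n^e n 1≤e))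
  , (refl , ≤-reflexive (trans (cong length (sym eq)) (length-map (λ a → toℕ (LSystem.τ L a)) final))
    , sym (trans (cong (take n) eq) (take-all n (growing (2 + m)) ≤-refl)))
  , refl
  where
  n = length (growing (2 + m))
  L = growingLSystem (2 + m) n (s≤s z≤n)
  final : List (Fin 3)
  final = level (LSystem.φ L) (suc (suc zero) ∷ []) (2 + m)
  eq : map (λ a → toℕ (LSystem.τ L a)) final ≡ growing (2 + m)
  eq = trans (cong (map (λ a → toℕ (LSystem.τ L a))) (growing-level (2 + m) n (s≤s z≤n) (2 + m)))
    (cong (1 ∷_) (map-letterBlocks (2 + m) n (s≤s z≤n) (upTo (2 + m))))

-- 16 h² factors of length 1 + 12h make δ at least h.
W : ℕ → String
W h = growing (2 + 3 * (4 * h))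

-- Growth of the measures along the first family

GrowsOnW : Measure → Set
GrowsOnW μ = ∀ h {q} → μ (W h) q → + h / 1 ℚ.≤ q

h≤1+12h : ∀ h → h ≤ 1 + 3 * (4 * h)
h≤1+12h h = m≤n⇒m≤1+n (≤-trans (m≤n*m h 4) (m≤n*m (4 * h) 3))

W-unbounded : ∀ h → h ≤ length (W h)
W-unbounded h = ≤-trans (h≤1+12h h) (≤-trans (n≤1+n _) (m≤length-growing (2 + 3 * (4 * h))))

δ-grows : GrowsOnW δ
δ-grows h refl = ℚₚ.≤-trans (/-mono-≤ h 0 (distinctFactors (W h) k) (3 * (4 * h)) bound)
  (∈⇒≤foldr-⊔ (∈-map⁺ (λ k → + distinctFactors (W h) (suc k) / suc k) (∈-upTo⁺ {i = 3 * (4 * h)} k≤)))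
  where
  open +-*-Solver
  open ≤-Reasoning
  k = suc (3 * (4 * h))
  k≤ : k ≤ length (W h)
  k≤ = ≤-trans (n≤1+n k) (m≤length-growing (2 + 3 * (4 * h)))
  bound : h * k ≤ distinctFactors (W h) k * 1
  bound = begin
    h * k                        ≤⟨ square h ⟩
    4 * h * (4 * h)              ≤⟨ growing-distinctFactors (4 * h) ⟩
    distinctFactors (W h) k      ≡⟨ sym (*-identityʳ _) ⟩
    distinctFactors (W h) k * 1  ∎
    where
    square : ∀ h → h * suc (3 * (4 * h)) ≤ 4 * h * (4 * h)
    square zero    = z≤n
    square h@(suc _) = begin
      h * suc (3 * (4 * h))              ≤⟨ *-monoʳ-≤ h (+-monoˡ-≤ (3 * (4 * h)) {1} {h} (s≤s z≤n)) ⟩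
      h * (h + 3 * (4 * h))              ≤⟨ m≤m+n _ (3 * (h * h)) ⟩
      h * (h + 3 * (4 * h)) + 3 * (h * h) ≡⟨ solve 1 (λ h → h :* (h :+ con 3 :* (con 4 :* h)) :+ con 3 :* (h :* h) := con 4 :* h :* (con 4 :* h)) refl h ⟩
      4 * h * (4 * h) ∎

W-markers : ∀ h → HasMarkers (W h) (1 + 3 * (4 * h))
W-markers h = growing-markers (1 + 3 * (4 * h))

γ-grows : GrowsOnW γ
γ-grows h (_ , ((Γ , attractor , refl) , _) , refl) = /1-mono-≤ {h} {∣ Γ ∣} (*-cancelˡ-≤ 2
  (≤-trans (≤-trans (*-monoʳ-≤ 2 (m≤n*m h 6)) (≤-trans (≤-reflexive (twelve h)) (n≤1+n _)))
    (markers≤2attractor (W-markers h) Γ attractor)))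
  where
  open +-*-Solver
  twelve : ∀ h → 2 * (6 * h) ≡ 3 * (4 * h)
  twelve = solve 1 (λ h → con 2 :* (con 6 :* h) := con 3 :* (con 4 :* h)) refl

b-grows : GrowsOnW b
b-grows h (_ , ((ps , scheme , refl) , _) , refl) = /1-mono-≤ (≤-trans (h≤1+12h h) (markers≤b (W-markers h) scheme))

v-grows : GrowsOnW v
v-grows h (_ , parse , refl) = /1-mono-≤ (≤-trans (h≤1+12h h) (markers≤v (W-markers h) parse))

smallestGrammar-grows : ∀ κ → GrowsOnW (smallestGrammar κ)
smallestGrammar-grows κ h (_ , ((G , D , refl) , _) , refl) = /1-mono-≤ (≤-trans (h≤1+12h h) (markers≤grammar G (W-markers h) D))

greedy-grows : ∀ C → (∀ w → EarlierCopy w (C w)) → GrowsOnW (greedy C)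
greedy-grows C earlier h (_ , parse , refl) = /1-mono-≤ (≤-trans (h≤1+12h h) (markers≤greedy (earlier (W h)) (W-markers h) parse))

r-grows : GrowsOnW r
r-grows h (_ , refl , refl) = /1-mono-≤ (≤-trans (h≤1+12h h) (growing-r (1 + 3 * (4 * h))))

measures-grow : All GrowsOnW measures
measures-grow = δ-grows ∷ γ-grows ∷ b-grows ∷ v-grows ∷ smallestGrammar-grows collage ∷ smallestGrammar-grows rlslp
  ∷ greedy-grows Condition-z earlier-z ∷ greedy-grows Condition-zₙₒ earlier-zₙₒ ∷ greedy-grows Condition-zₑ earlier-zₑ
  ∷ r-grows ∷ []

ℓ=o : ∀ {μ} → GrowsOnW μ → ∃[ F ] (∀ e → 1 ≤ e → ℓ e =o[ F ] μ)
ℓ=o {μ} grows = sequenceFamily W W-unbounded , λ e 1≤e → =o-sequence {ℓ e} {μ} W W-unbounded 11 0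
  λ { {h} _ (k , (_ , ℓ-min) , refl) μq → k , h , ℚₚ.≤-refl , grows h μq
    , subst (h * k ≤_) (*-comm h 11) (*-monoʳ-≤ h (ℓ-min 11 (growing-ℓ≤11 {e} 1≤e (3 * (4 * h))))) }

-- Upper bounds for γ and δ

sum-zeros-++ : ∀ r w → sum (zeros r ++ w) ≡ sum w
sum-zeros-++ zero    w = refl
sum-zeros-++ (suc r) w = sum-zeros-++ r w

-- The words are binary, so `sum` counts ones and thus runs. It is the currency in which phrases and
-- runs are paid below.
sum-blocks : ∀ rs → sum (blocks rs) ≡ length rs
sum-blocks []       = refl
sum-blocks (r ∷ rs) = trans (sum-zeros-++ r _) (cong suc (sum-blocks rs))

-- The normal form of suffixes on which several upper bounds rest; it exists because the word ends
-- in a one.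
drop-blocks : ∀ {M rs} → All (_≤ M) rs → ∀ i → i < length (blocks rs) →
  ∃[ c ] ∃[ y ] c ≤ M × drop i (blocks rs) ≡ zeros c ++ 1 ∷ y
drop-blocks {rs = zero ∷ rs}  (_ ∷ _)   zero    _        = 0 , blocks rs , z≤n , refl
drop-blocks {rs = zero ∷ rs}  (_ ∷ h)   (suc i) (s≤s i<) = drop-blocks h i i<
drop-blocks {rs = suc r ∷ rs} (r≤ ∷ _)  zero    _        = suc r , blocks rs , r≤ , refl
drop-blocks {rs = suc r ∷ rs} (r≤ ∷ h)  (suc i) (s≤s i<) = drop-blocks {rs = r ∷ rs} (<⇒≤ r≤ ∷ h) i i<

take-zeros-++ : ∀ {l r} w → l ≤ r → take l (zeros r ++ w) ≡ zeros l
take-zeros-++ w z≤n     = refl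
take-zeros-++ w (s≤s h) = cong (0 ∷_) (take-zeros-++ w h)

support : (w : String) → Subset (length w)
support []          = Vec.[]
support (zero ∷ w)  = outside Vec.∷ support w
support (suc _ ∷ w) = inside Vec.∷ support w

∣support∣≤sum : ∀ w → ∣ support w ∣ ≤ sum w
∣support∣≤sum []          = z≤n
∣support∣≤sum (zero ∷ w)  = ∣support∣≤sum w
∣support∣≤sum (suc a ∷ w) = s≤s (≤-trans (∣support∣≤sum w) (m≤n+m _ a))

∈-support : ∀ w i c {y} → drop i w ≡ zeros c ++ 1 ∷ y → ∃[ p ] toℕ p ≡ i + c × p ∈ˢ support w
∈-support []          zero    zero    ()
∈-support []          zero    (suc _) ()
∈-support []          (suc _) zero    ()
∈-support []          (suc _) (suc _) ()
∈-support (_ ∷ w)     zero    zero    refl = zero , refl , Vec.here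
∈-support (_ ∷ w)     zero    (suc c) eq with ∷-injective eq
... | refl , eq′ = let p , p≡ , p∈ = ∈-support w zero c eq′ in suc p , cong suc p≡ , Vec.there p∈
∈-support (zero ∷ w)  (suc i) c       eq = let p , p≡ , p∈ = ∈-support w i c eq in suc p , cong suc p≡ , Vec.there p∈
∈-support (suc _ ∷ w) (suc i) c       eq = let p , p≡ , p∈ = ∈-support w i c eq in suc p , cong suc p≡ , Vec.there p∈

attractorOfBlocks : ∀ R rs → Subset (length (blocks (suc R ∷ rs)))
attractorOfBlocks R rs = inside Vec.∷ support (blocks (R ∷ rs))

-- A factor of zeros occurs at the beginning, any other factor contains a one.
blocks-attractor : ∀ {R rs} → All (_≤ suc R) rs → IsAttractor (blocks (suc R ∷ rs)) (attractorOfBlocks R rs)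
blocks-attractor {R} {rs} rs≤ i l 1≤l i+l≤n
  with drop-blocks {rs = suc R ∷ rs} (≤-refl ∷ rs≤) i (<-≤-trans (m<m+n i 1≤l) i+l≤n)
... | c , y , c≤ , eq with l ≤? c
...   | yes l≤c = 0 , ≤-trans (m≤n+m l i) i+l≤n
        , trans (take-zeros-++ {l} {suc R} _ (≤-trans l≤c c≤)) (sym (trans (cong (take l) eq) (take-zeros-++ _ l≤c)))
        , zero , Vec.here , z≤n , 1≤l
...   | no l≰c = let p , p≡ , p∈ = ∈-support (blocks (suc R ∷ rs)) i c eq in
        i , i+l≤n , refl , p , larger p∈
        , subst (i ≤_) (sym p≡) (m≤m+n i c) , subst (_< i + l) (sym p≡) (+-monoʳ-< i (≰⇒> l≰c))
  where
  larger : ∀ {p} → p ∈ˢ support (blocks (suc R ∷ rs)) → p ∈ˢ attractorOfBlocks R rs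
  larger (Vec.there p∈) = Vec.there p∈

∣attractorOfBlocks∣≤ : ∀ R rs → ∣ attractorOfBlocks R rs ∣ ≤ 2 + length rs
∣attractorOfBlocks∣≤ R rs = s≤s (≤-trans (∣support∣≤sum (blocks (R ∷ rs))) (≤-reflexive (sum-blocks (R ∷ rs))))

-- The argument for δ ≤ γ: a factor of length `l` is determined by an attractor position inside one
-- of its occurrences together with the offset, below `l`, of that position.
distinctFactors≤attractor : ∀ {w Γ} → IsAttractor w Γ → ∀ l → 1 ≤ l → distinctFactors w l ≤ ∣ Γ ∣ * l
distinctFactors≤attractor {w} {Γ} attractor l 1≤l = subst (distinctFactors w l ≤_) length≡
  (length-≤-by (λ (p , o) x → x ≡ factor w (p ∸ o) l) (λ p q → trans p (sym q)) codes
    (DecUniqueₚ.deduplicate-! (≡-dec _≟_) (factors w l)) assign)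
  where
  codes : List (ℕ × ℕ)
  codes = cartesianProduct (elements Γ) (upTo l)
  length≡ : length codes ≡ ∣ Γ ∣ * l
  length≡ = trans (length-cartesianProduct (elements Γ) (upTo l)) (cong₂ _*_ (length-elements Γ) (length-upTo l))
  assign : ∀ {x} → x ∈ deduplicate (≡-dec _≟_) (factors w l) → ∃[ c ] c ∈ codes × x ≡ factor w (proj₁ c ∸ proj₂ c) l
  assign x∈ with ∈-map⁻ _ (∈-deduplicate⁻ (≡-dec _≟_) (factors w l) x∈)
  ... | i , i∈ , refl with attractor i l 1≤l (i+l≤n i (∈-upTo⁻ i∈))
    where
    i+l≤n : ∀ i → i < suc (length w) ∸ l → i + l ≤ length w
    i+l≤n i i< = s≤s⁻¹ (m≤o∸n⇒m+n≤o (suc i) (<⇒≤ (m∸n≢0⇒n<m {suc (length w)} {l} λ z → contradiction (subst (i <_) z i<) λ ())) i<)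
  ...   | j , _ , eq , p , p∈ , j≤p , p< = (toℕ p , toℕ p ∸ j)
          , ∈-cartesianProduct⁺ (∈-elements p∈) (∈-upTo⁺ (+-cancelˡ-< j _ _ (subst (_< j + l) (sym (m+[n∸m]≡n j≤p)) p<)))
          , trans (sym eq) (cong (λ j → factor w j l) (sym (m∸[m∸n]≡n j≤p)))

δ≤attractor : ∀ {w q Γ} → IsAttractor w Γ → δ w q → q ℚ.≤ + ∣ Γ ∣ / 1
δ≤attractor {w} {Γ = Γ} attractor refl = foldr-⊔-≤ (/1-mono-≤ {0} {∣ Γ ∣} z≤n)
  (Allₚ.map⁺ {xs = upTo (length w)} (All.tabulate λ {k} _ → /-mono-≤ (distinctFactors w (suc k)) k ∣ Γ ∣ 0
    (≤-trans (≤-reflexive (*-identityʳ _)) (distinctFactors≤attractor {w} {Γ} attractor (suc k) (s≤s z≤n)))))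

-- Upper bound for b

Nth⇒lookup : ∀ {A : Set} (xs : List A) i {x} → Nth xs i x → ∃[ f ] toℕ f ≡ i × lookup xs f ≡ x
Nth⇒lookup (x ∷ xs) zero    refl = zero , refl , refl
Nth⇒lookup (x ∷ xs) (suc i) nth  = let f , f≡ , eq = Nth⇒lookup xs i nth in suc f , cong suc f≡ , eq

recovers-goto : ∀ {ps i P a} → Nth (concatMap pointers ps) i P → Recovers ps P a → Recovers ps (goto i) a
recovers-goto {ps} {i} nth R with Nth⇒lookup (concatMap pointers ps) i nth
... | f , refl , refl = goto f R

blockPhrases : List ℕ → List Phrase
blockPhrases []       = []
blockPhrases (r ∷ rs) = copy 0 r ∷ explicit 1 ∷ blockPhrases rs

length-blockPhrases : ∀ rs → length (blockPhrases rs) ≡ 2 * length rs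
length-blockPhrases []       = refl
length-blockPhrases (r ∷ rs) = trans (cong (_+_ 2) (length-blockPhrases rs)) (sym (*-suc 2 (length rs)))

-- Only the first zero of the first run is explicit. The rest of that run is a copy overlapping
-- itself with shift 1, and every other run is copied from position 0.
blocksScheme : ℕ → List ℕ → List Phrase
blocksScheme R rs = explicit 0 ∷ copy 0 R ∷ explicit 1 ∷ blockPhrases rs

length-zeros-++ : ∀ (p : String) r {u} → length (p ++ zeros r ++ u) ≡ length p + r + length u
length-zeros-++ p r {u} = trans (length-++ p) (trans (cong (_+_ (length p)) (trans (length-++ (zeros r)) (cong (_+ length u) (length-replicate r))))
  (sym (+-assoc (length p) r (length u))))

module _ (R : ℕ) (1≤R : 1 ≤ R) {rs : List ℕ} (rs-bounds : All (λ r → 1 ≤ r × r ≤ R) rs) where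
  private
    w : String
    w = blocks (suc R ∷ rs)
    ps : List Phrase
    ps = blocksScheme R rs

  factor-zeros : ∀ p {r u} → w ≡ p ++ zeros r ++ u → factor w (length p) r ≡ zeros r
  factor-zeros p {r} w≡ = trans (cong (take r) (trans (cong (drop (length p)) w≡) (drop-++-≡ p _))) (take-zeros-++ _ ≤-refl)

  factorizes-blockPhrases : ∀ p rs → 1 ≤ length p → w ≡ p ++ blocks rs → All (λ r → 1 ≤ r × r ≤ R) rs →
    Factorizes w (length p) (blockPhrases rs)
  factorizes-blockPhrases p []       1≤p w≡ _ = subst (λ i → Factorizes w i []) (cong length (trans w≡ (++-identityʳ p))) done
  factorizes-blockPhrases p (r ∷ rs) 1≤p w≡ ((1≤r , r≤R) ∷ rest) =
    copy 1≤r (<⇒≢ 1≤p) i+r≤n (≤-trans (m≤n+m r (length p)) i+r≤n)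
      (trans (factor-zeros p w≡) (sym (take-zeros-++ {r} {suc R} _ (m≤n⇒m≤1+n r≤R))))
      (subst (λ i → Factorizes w i _) i≡
        (explicit (trans (cong (take 1) (trans (cong (drop (length (p ++ zeros r))) w≡₁) (drop-++-≡ (p ++ zeros r) _))) refl)
          (subst (λ i → Factorizes w i (blockPhrases rs)) (trans (length-++ (p ++ zeros r)) (+-comm _ 1))
            (factorizes-blockPhrases ((p ++ zeros r) ∷ʳ 1) rs (subst (1 ≤_) (sym (length-++ (p ++ zeros r))) (m≤n+m 1 _))
              (trans w≡₁ (sym (∷ʳ-++ (p ++ zeros r) 1 _))) rest))))
    where
    w≡₁ : w ≡ (p ++ zeros r) ++ 1 ∷ blocks rs
    w≡₁ = trans w≡ (sym (++-assoc p (zeros r) _))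
    i≡ : length (p ++ zeros r) ≡ length p + r
    i≡ = trans (length-++ p) (cong (_+_ (length p)) (length-replicate r))
    i+r≤n : length p + r ≤ length w
    i+r≤n = subst (length p + r ≤_) (sym (trans (cong length w≡) (length-zeros-++ p r))) (m≤m+n _ _)

  blocksScheme-factorizes : Factorizes w 0 ps
  blocksScheme-factorizes = explicit refl (copy 1≤R (λ ()) 1+R≤n (<⇒≤ 1+R≤n)
    (trans (take-zeros-++ {R} {R} _ ≤-refl) (sym (take-zeros-++ {R} {suc R} _ (n≤1+n R))))
    (explicit {a = 1} (cong (take 1) (trans (cong (λ i → drop i w) (sym (length-replicate (suc R)))) (drop-++-≡ (zeros (suc R)) _)))
      (subst (λ i → Factorizes w i (blockPhrases rs)) (trans (length-++ (zeros (suc R))) (trans (+-comm _ 1) (cong suc (length-replicate (suc R)))))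
        (factorizes-blockPhrases (zeros (suc R) ∷ʳ 1) rs (s≤s z≤n) (sym (∷ʳ-++ (zeros (suc R)) 1 _)) rs-bounds))))
    where
    1+R≤n : suc R ≤ length w
    1+R≤n = ≤-trans (m≤m+n (suc R) _) (≤-reflexive (sym (length-zeros-++ [] (suc R))))

  -- Within the first run each pointer goes back by one position, down to the explicit zero.
  recovers-zero : ∀ {x} → x ≤ R → Recovers ps (goto x) 0
  recovers-zero {zero}  _   = recovers-goto refl symbol
  recovers-zero {suc x} x<R = recovers-goto
    (subst (λ Q → Nth (Q ++ _) x (goto x)) (sym (map-upTo goto R)) (Nth-applyUpTo goto _ x<R)) (recovers-zero (<⇒≤ x<R))

  recovers-run : ∀ {r} → r ≤ suc R → Pointwise (Recovers ps) (map goto (upTo r)) (zeros r)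
  recovers-run {r} r≤ = subst (λ Q → Pointwise (Recovers ps) Q (zeros r)) (sym (map-upTo goto r))
    (go goto r λ {t} t<r → recovers-zero (s≤s⁻¹ (≤-trans t<r r≤)))
    where
    go : ∀ f r → (∀ {t} → t < r → Recovers ps (f t) 0) → Pointwise (Recovers ps) (applyUpTo f r) (zeros r)
    go f zero    _ = []
    go f (suc r) h = h (s≤s z≤n) ∷ go (f ∘ suc) r (h ∘ s≤s)

  recovers-blocks : ∀ {rs} → All (λ r → 1 ≤ r × r ≤ R) rs → Pointwise (Recovers ps) (concatMap pointers (blockPhrases rs)) (blocks rs)
  recovers-blocks []                 = []
  recovers-blocks ((_ , r≤R) ∷ rest) = ++⁺-Pointwise (recovers-run (m≤n⇒m≤1+n r≤R)) (symbol ∷ recovers-blocks rest)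

  blocksScheme-isMacroScheme : IsMacroScheme w ps
  blocksScheme-isMacroScheme = blocksScheme-factorizes
    , symbol ∷ ++⁺-Pointwise (recovers-run (n≤1+n R)) (symbol ∷ recovers-blocks rs-bounds)

-- Upper bound for v

sum-drop : ∀ m w → sum (drop m w) ≤ sum w
sum-drop zero    w       = ≤-refl
sum-drop (suc m) []      = z≤n
sum-drop (suc m) (a ∷ w) = ≤-trans (sum-drop m w) (m≤n+m _ a)

-- Bounds the number of phrases of a lex-parse: each run of zeros and each one takes a phrase.
potential : String → ℕ
potential []          = 0
potential (zero ∷ y)  = 1 + 2 * sum y
potential (suc a ∷ y) = 2 * (suc a + sum y)

potential≤ : ∀ y → potential y ≤ 1 + 2 * sum y
potential≤ []          = z≤n
potential≤ (zero ∷ y)  = ≤-refl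
potential≤ (suc a ∷ y) = n≤1+n _

potential-drop : ∀ m y → potential (drop m y) ≤ 1 + 2 * sum y
potential-drop m y = ≤-trans (potential≤ (drop m y)) (s≤s (*-monoʳ-≤ 2 (sum-drop m y)))

potential-drop-1∷ : ∀ m y → potential (drop m (1 ∷ y)) ≤ 2 * (1 + sum y)
potential-drop-1∷ zero    y = ≤-refl
potential-drop-1∷ (suc m) y = ≤-trans (potential-drop m y) (≤-trans (n≤1+n _) (≤-reflexive (sym (*-suc 2 (sum y)))))

-- Whatever lies between two words with a common prefix has that prefix. The lower bound is negated,
-- so that the order need not be decided.
lex-between : ∀ c {x u v} → ¬ x <ˡᵉˣ (zeros c ++ u) → x <ˡᵉˣ (zeros c ++ v) → ∃[ x′ ] x ≡ zeros c ++ x′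
lex-between zero    {x} _  _          = x , refl
lex-between (suc c) x≮ halt           = contradiction halt x≮
lex-between (suc c) x≮ (next refl lt) = let x′ , eq = lex-between c (x≮ ∘ next refl) lt in x′ , cong (0 ∷_) eq

LCP-zeros : ∀ c {u v l} → LCP (zeros c ++ u) (zeros c ++ v) l → c ≤ l
LCP-zeros zero    _            = z≤n
LCP-zeros (suc c) (differ 0≢0) = contradiction refl 0≢0
LCP-zeros (suc c) (agree h)    = s≤s (LCP-zeros c h)

module _ (M : ℕ) {rs : List ℕ} (rs≤ : All (_≤ M) rs) where
  private
    w : String
    w = blocks (suc M ∷ rs)

  suffix-zeros : ∀ c → c ≤ suc M → drop (suc M ∸ c) w ≡ zeros c ++ 1 ∷ blocks rs
  suffix-zeros c c≤ = begin
    drop o w                                        ≡⟨ cong (λ n → drop o (zeros n ++ 1 ∷ blocks rs)) (sym (m∸n+n≡m c≤)) ⟩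
    drop o (zeros (o + c) ++ 1 ∷ blocks rs)         ≡⟨ cong (λ z → drop o (z ++ 1 ∷ blocks rs)) (zeros-+ o c) ⟩
    drop o ((zeros o ++ zeros c) ++ 1 ∷ blocks rs)  ≡⟨ cong (drop o) (++-assoc (zeros o) (zeros c) _) ⟩
    drop o (zeros o ++ zeros c ++ 1 ∷ blocks rs)    ≡⟨ trans (cong (λ n → drop n (zeros o ++ _)) (sym (length-replicate o))) (drop-++-≡ (zeros o) _) ⟩
    zeros c ++ 1 ∷ blocks rs                        ∎
    where
    open ≡-Reasoning
    o = suc M ∸ c

  o<length : ∀ c → suc M ∸ c < length w
  o<length c = ≤-<-trans (m∸n≤m (suc M) c) (∈⇒<length-blocks {rs = suc M ∷ rs} (here refl))

  -- The suffix 0^(c+1) 1 ⋯ of the first run precedes every later suffix 0^c 1 ⋯ .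
  module _ {i c y} (c≤M : c ≤ M) (suffix≡ : drop i w ≡ zeros c ++ 1 ∷ y) where
    private
      o = suc M ∸ suc c
      u : String
      u = 0 ∷ 1 ∷ blocks rs

    suffix-o : drop o w ≡ zeros c ++ u
    suffix-o = trans (suffix-zeros (suc c) (s≤s c≤M)) (sym (zeros-∷ʳ c _))

    o≺i : drop o w <ˡᵉˣ drop i w
    o≺i = subst₂ _<ˡᵉˣ_ (sym suffix-o) (sym suffix≡) (go c)
      where
      go : ∀ c → (zeros c ++ u) <ˡᵉˣ (zeros c ++ 1 ∷ y)
      go zero    = this (s≤s z≤n)
      go (suc c) = next refl (go c)

    agreement : ∀ {j l} → drop j w <ˡᵉˣ drop i w → ¬ drop j w <ˡᵉˣ drop o w → LCP (drop i w) (drop j w) l → c ≤ l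
    agreement {j} j≺i j⊀o lcp =
      let x′ , eq = lex-between c (j⊀o ∘ subst (drop j w <ˡᵉˣ_) (sym suffix-o)) (subst (drop j w <ˡᵉˣ_) suffix≡ j≺i)
      in LCP-zeros c (subst₂ (λ x y → LCP x y _) suffix≡ eq lcp)

    predecessor-agreement : ∀ {j l} → ImmediatelyPrecedes w j i → LCP (drop i w) (drop j w) l → c ≤ l
    predecessor-agreement {j} (_ , j≺i , immediate) = agreement {j} j≺i λ j≺o → immediate o (o<length (suc c)) (j≺o , o≺i)

    -- Going up from o towards i one reaches an immediate predecessor of i.
    ¬isolated : 1 ≤ c → ¬ (∀ j → ImmediatelyPrecedes w j i → LCP (drop i w) (drop j w) 0)
    ¬isolated 1≤c isolated = refute (suffixOrder-wellFounded (λ x y → y <ˡᵉˣ x) lex-irrefl (λ p q → lex-trans q p) w (o<length (suc c))) (o<length (suc c)) o≺i lex-irrefl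
      where
      refute : ∀ {j} → Acc (SuffixOrder (λ x y → y <ˡᵉˣ x) w) j → j < length w → drop j w <ˡᵉˣ drop i w → ¬ ¬ drop j w <ˡᵉˣ drop o w
      -- If `j` were an immediate predecessor, `isolated` would contradict `agreement`. So it is
      -- enough to refute each `k` between `j` and `i`, which is the recursive call.
      refute {j} (acc rec) j< j≺i j⊀o = <⇒≱ 1≤c (agreement {j} j≺i j⊀o (isolated j (j< , j≺i , λ k k< (j≺k , k≺i) →
        refute {k} (rec (k< , j< , j≺k)) k< k≺i λ k≺o → j⊀o (lex-trans j≺k k≺o))))

  -- From position 1 on, some suffix of the first run has one more leading zero than the current
  -- one; at position 0 there is none. By the agreement with the predecessor each phrase then takes
  -- all leading zeros, or at least the leading one.
  lexParse≤potential : ∀ {i k} → LexParse w (suc i) k → k ≤ potential (drop (suc i) w)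
  lexParse≤potential P = go P refl
    where
    step : ∀ i {l k c y} → drop (suc i) w ≡ zeros c ++ 1 ∷ y → c ≤ l → 1 ≤ l → k ≤ potential (drop (suc (i + l)) w) → suc k ≤ potential (drop (suc i) w)
    step i {suc l} {k} {zero}  {y} eq _   _ IH rewrite sym (drop-drop (suc i) (suc l) w) | eq =
      ≤-trans (s≤s (≤-trans IH (potential-drop l y))) (≤-reflexive (sym (*-suc 2 (sum y))))
    step i {l}     {k} {suc c} {y} eq c≤l _ IH with m≤n⇒∃[o]m+o≡n c≤l
    ... | m , refl rewrite sym (drop-drop (suc i) (suc c + m) w) | eq =
      s≤s (≤-trans IH (subst₂ _≤_ (cong potential (sym drop≡)) (cong (2 *_) (sym (sum-zeros-++ c (1 ∷ y)))) (potential-drop-1∷ m y)))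
      where
      drop≡ : drop (c + m) (zeros c ++ 1 ∷ y) ≡ drop m (1 ∷ y)
      drop≡ = trans (sym (drop-drop c m (zeros c ++ 1 ∷ y))) (cong (drop m)
        (trans (cong (λ n → drop n (zeros c ++ 1 ∷ y)) (sym (length-replicate c))) (drop-++-≡ (zeros c) _)))
    suffixAt : ∀ {i} → suc i < length w → ∃[ c ] ∃[ y ] c ≤ M × drop (suc i) w ≡ zeros c ++ 1 ∷ y
    suffixAt {i} i< = drop-blocks {rs = M ∷ rs} (≤-refl ∷ rs≤) i (s≤s⁻¹ i<)
    go : ∀ {i j k} → LexParse w j k → j ≡ suc i → k ≤ potential (drop (suc i) w)
    go done _ = z≤n
    go {i} (copy {j = j} i< pred lcp 1≤l P) refl =
      let c , y , c≤M , eq = suffixAt i< in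
      step i eq (predecessor-agreement {suc i} c≤M eq {j} pred lcp) 1≤l (go P refl)
    go {i} {k = suc k} (explicit i< isolated P) refl = explicit-case (suffixAt i<)
      where
      explicit-case : ∃[ c ] ∃[ y ] c ≤ M × drop (suc i) w ≡ zeros c ++ 1 ∷ y → suc k ≤ potential (drop (suc i) w)
      explicit-case (zero  , y , _   , eq) = step i {l = 1} eq z≤n ≤-refl (subst (λ j → k ≤ potential (drop (suc j) w)) (+-comm 1 i) (go P refl))
      explicit-case (suc c , y , c≤M , eq) = contradiction isolated (¬isolated {suc i} c≤M eq (s≤s z≤n))

  v≤ : ∀ {k} → LexParse w 0 k → k ≤ 4 + 2 * length rs
  v≤ P = first P
    where
    rest : ∀ {i k} → LexParse w (suc i) k → suc k ≤ 4 + 2 * length rs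
    rest {i} P = s≤s (≤-trans (lexParse≤potential P) (≤-trans (potential-drop (suc i) w)
      (≤-reflexive (cong suc (trans (cong (2 *_) (sum-blocks (suc M ∷ rs))) (*-suc 2 (length rs)))))))
    first : ∀ {k} → LexParse w 0 k → k ≤ 4 + 2 * length rs
    first (copy {l = suc l} _ _ _ _ P) = rest P
    first (explicit _ _ P)             = rest P

-- Upper bounds for z, zₙₒ and zₑ

Nth-zeros : ∀ {t r} y → t < r → Nth (zeros r ++ y) t 0
Nth-zeros {zero}  {suc r} y _         = refl
Nth-zeros {suc t} {suc r} y (s≤s t<r) = Nth-zeros y t<r

Nth-take : ∀ {l t} {x : String} {a} → t < l → Nth x t a → Nth (take l x) t a
Nth-take {suc l} {zero}  {_ ∷ _} _         h = h
Nth-take {suc l} {suc t} {_ ∷ x} (s≤s t<l) h = Nth-take {l} {t} {x} t<l h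

Nth-factor : ∀ {w i j l t a} → factor w i l ≡ factor w j l → t < l → Nth w (i + t) a → Nth w (j + t) a
Nth-factor {w} {i} {j} {l} {t} eq t<l h = subst (λ x → head x ≡ just _) (drop-drop j t w)
  (Nth-untake l t (subst (λ x → Nth x t _) eq (Nth-take {l} {t} {drop i w} t<l (subst (λ x → head x ≡ just _) (sym (drop-drop i t w)) h))))
  where
  Nth-untake : ∀ l t {x : String} {a} → Nth (take l x) t a → Nth x t a
  Nth-untake (suc l) zero    {_ ∷ _} h = h
  Nth-untake (suc l) (suc t) {_ ∷ x} h = Nth-untake l t h
  Nth-untake zero    zero    {_}     ()
  Nth-untake zero    (suc t) {_}     ()
  Nth-untake (suc l) zero    {[]}    ()
  Nth-untake (suc l) (suc t) {[]}    ()

take-suc-zeros : ∀ c y → take (suc c) (zeros c ++ 1 ∷ y) ≡ zeros c ++ 1 ∷ []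
take-suc-zeros zero    y = refl
take-suc-zeros (suc c) y = cong (0 ∷_) (take-suc-zeros c y)

module _ (M : ℕ) {rs : List ℕ} (rs≤ : All (_≤ M) rs) where
  private
    R : ℕ
    R = suc M
    w : String
    w = blocks (R ∷ rs)

  Nth-first-run : ∀ {t} → t < R → Nth w t 0
  Nth-first-run = Nth-zeros (1 ∷ blocks rs)

  Nth-R : Nth w R 1
  Nth-R = cong head (trans (cong (λ n → drop n w) (sym (length-replicate R))) (drop-++-≡ (zeros R) (1 ∷ blocks rs)))

  R<length : R < length w
  R<length = ∈⇒<length-blocks {rs = R ∷ rs} (here refl)

  zeros-factor : ∀ j l → j + l ≤ R → factor w j l ≡ zeros l
  zeros-factor j l j+l≤R = trans (cong (take l) drop≡) (take-zeros-++ (1 ∷ blocks rs) (m+n≤o⇒n≤o∸m j j+l≤R))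
    where
    drop≡ : drop j w ≡ zeros (R ∸ j) ++ 1 ∷ blocks rs
    drop≡ = trans (cong (λ j → drop j w) (sym (m∸[m∸n]≡n (≤-trans (m≤m+n j l) j+l≤R)))) (suffix-zeros M rs≤ (R ∸ j) (m∸n≤m R j))
    m+n≤o⇒n≤o∸m : ∀ m {n o} → m + n ≤ o → n ≤ o ∸ m
    m+n≤o⇒n≤o∸m m {n} {o} h = m+n≤o⇒m≤o∸n n (subst (_≤ o) (+-comm m n) h)

  -- All three parsings at once: the copies exhibited below end at a phrase end, so they satisfy
  -- even the strictest condition, that of LZ-End, while an earlier copy is all that is used of a
  -- phrase taken.
  module _ {C : PhraseCondition} (earlier : EarlierCopy w C)
    (allowed : ∀ {es i l} → All (_≤ i) es → 1 ≤ l → Condition-zₑ w es i l → C es i l) where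

    after-phrase : ∀ {i l} {es : List ℕ} → All (_≤ i) es → All (_≤ i + l) (i + l ∷ es)
    after-phrase {i} {l} es≤ = ≤-refl ∷ All.map (λ e≤ → ≤-trans e≤ (m≤m+n i l)) es≤

    after-single : ∀ {i} {es : List ℕ} → All (_≤ i) es → All (_≤ suc i) (suc i ∷ es)
    after-single es≤ = ≤-refl ∷ All.map m≤n⇒m≤1+n es≤

    -- Beyond the first run a phrase reaches past the next one, by a copy ending at suc R.
    next-one : ∀ {es i} → R < suc i → suc i < length w → All (_≤ suc i) es → suc R ∈ es →
      ∃[ c ] ∃[ y ] drop (suc i) w ≡ zeros c ++ 1 ∷ y × suc i + suc c ≤ length w × C es (suc i) (suc c)
    next-one {es} {i} R<i i<n es≤ end∈ with drop-blocks {rs = M ∷ rs} (≤-refl ∷ rs≤) i (s≤s⁻¹ i<n)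
    ... | c , y , c≤M , eq = c , y , eq
        , subst (_≤ length w) (+-comm (suc c) (suc i)) (m≤o∸n⇒m+n≤o (suc c) (<⇒≤ i<n)
            (subst (suc c ≤_) (trans (cong length (sym eq)) (length-drop (suc i) w)) c<))
        , allowed es≤ (s≤s z≤n) (R ∸ c , subst (_∈ es) (sym end≡) end∈ , factor≡)
      where
      c< : suc c ≤ length (zeros c ++ 1 ∷ y)
      c< = ≤-trans (≤-trans (s≤s (m≤m+n c (length y))) (≤-reflexive (sym (+-suc c (length y)))))
        (≤-reflexive (sym (trans (length-++ (zeros c)) (cong (_+ suc (length y)) (length-replicate c)))))
      end≡ : R ∸ c + suc c ≡ suc R
      end≡ = trans (+-suc (R ∸ c) c) (cong suc (m∸n+n≡m (m≤n⇒m≤1+n c≤M)))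
      factor≡ : factor w (R ∸ c) (suc c) ≡ factor w (suc i) (suc c)
      factor≡ = trans (cong (take (suc c)) (suffix-zeros M rs≤ c (m≤n⇒m≤1+n c≤M)))
        (trans (take-suc-zeros c (blocks rs)) (sym (trans (cong (take (suc c)) eq) (take-suc-zeros c y))))

    -- By greediness every phrase reaches through the next one, so the phrases are charged to the
    -- ones that remain.
    phrases-after : ∀ {i es k} → R < i → All (_≤ i) es → suc R ∈ es → GreedyParse w C es i k → k ≤ sum (drop i w)
    phrases-after R<i es≤ end∈ done = z≤n
    phrases-after {suc i} R<i es≤ end∈ (phrase {l = l} {k = k} 1≤l i+l≤n cond longest P)
      with next-one R<i (<-≤-trans (m<m+n (suc i) 1≤l) i+l≤n) es≤ end∈
    ... | c , y , eq , fits , Cc with m≤n⇒∃[o]m+o≡n (longest (suc c) fits Cc)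
    ...   | o , refl = subst (suc k ≤_) (sym (trans (cong sum eq) (sum-zeros-++ c (1 ∷ y)))) (s≤s (≤-trans
              (phrases-after (<-≤-trans R<i (m≤m+n (suc i) _)) (after-phrase es≤) (there end∈) P)
              (subst (λ x → sum x ≤ sum y) (sym drop≡) (sum-drop o y))))
      where
      drop≡ : drop (suc i + (suc c + o)) w ≡ drop o y
      drop≡ = trans (sym (drop-drop (suc i) (suc c + o) w)) (trans (cong (drop (suc c + o)) eq) (dropZeros c))
        where
        dropZeros : ∀ c → drop (suc c + o) (zeros c ++ 1 ∷ y) ≡ drop o y
        dropZeros zero    = refl
        dropZeros (suc c) = dropZeros c
    phrases-after {suc i} R<i es≤ end∈ (single i<n none P) with next-one R<i i<n es≤ end∈
    ... | c , y , eq , fits , Cc = contradiction Cc (none (suc c) (s≤s z≤n) fits)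

    -- The first one has no earlier occurrence, hence is a phrase by itself.
    phrases-from-R : ∀ {i es k} → i ≡ R → All (_≤ i) es → GreedyParse w C es i k → k ≤ suc (length rs)
    phrases-from-R i≡R es≤ done = z≤n
    phrases-from-R refl es≤ (phrase {l = l} 1≤l _ cond _ _) with earlier es≤ 1≤l cond
    ... | s , s<R , eq = contradiction (Nth-functional {xs = w} {s} (Nth-first-run s<R)
          (subst (λ t → Nth w t 1) (+-identityʳ s) (Nth-factor {w} {R} {s} {l} {0} (sym eq) 1≤l
            (subst (λ t → Nth w t 1) (sym (+-identityʳ R)) Nth-R)))) λ ()
    phrases-from-R refl es≤ (single _ _ P) = s≤s (≤-trans (phrases-after ≤-refl (after-single es≤) (here refl) P)
      (≤-reflexive (trans (cong sum drop≡) (sum-blocks rs))))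
      where
      drop≡ : drop (suc R) w ≡ blocks rs
      drop≡ = trans (cong (λ n → drop n w) (sym (trans (length-++ (zeros R)) (trans (+-comm (length (zeros R)) 1) (cong suc (length-replicate R))))))
        (trans (cong (drop (length (zeros R ∷ʳ 1))) (sym (∷ʳ-++ (zeros R) 1 (blocks rs)))) (drop-++-≡ (zeros R ∷ʳ 1) (blocks rs)))

    -- Within the first run the parsed prefix doubles with each phrase.
    doubling : ∀ {i es} s → 1 ≤ i → i < R → R ≤ i * 2 ^ suc s → All (_≤ i) es → i ∈ es →
      ∃[ l ] 1 ≤ l × i + l ≤ R × C es i l × (∀ {l′} → l ≤ l′ → R ≤ (i + l′) * 2 ^ s)
    doubling {i} {es} s 1≤i i<R R≤ es≤ i∈ with i + i ≤? R
    ... | yes 2i≤R = i , 1≤i , 2i≤R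
        , allowed es≤ 1≤i (0 , i∈ , trans (zeros-factor 0 i (<⇒≤ i<R)) (sym (zeros-factor i i 2i≤R)))
        , λ {l′} i≤l′ → ≤-trans R≤ (≤-trans (≤-reflexive double) (*-monoˡ-≤ (2 ^ s) (+-monoʳ-≤ i i≤l′)))
      where
      open +-*-Solver
      double : i * 2 ^ suc s ≡ (i + i) * 2 ^ s
      double = solve 2 (λ i p → i :* (con 2 :* p) := (i :+ i) :* p) refl i (2 ^ s)
    -- Fewer than `i` zeros are left in the first run; they are copied from the last zeros before
    -- `i`, so that the source ends at the phrase end `i`.
    ... | no 2i≰R with m≤n⇒∃[o]m+o≡n (<⇒≤ i<R)
    ...   | o , i+o≡R = o , 1≤o , ≤-reflexive i+o≡R
            , allowed es≤ 1≤o (i ∸ o , subst (_∈ es) (sym (m∸n+n≡m (<⇒≤ o<i))) i∈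
              , trans (zeros-factor (i ∸ o) o (subst (_≤ R) (sym (m∸n+n≡m (<⇒≤ o<i))) (<⇒≤ i<R))) (sym (zeros-factor i o (≤-reflexive i+o≡R))))
            , λ {l′} o≤l′ → ≤-trans (≤-reflexive (sym i+o≡R)) (≤-trans (+-monoʳ-≤ i o≤l′) (m≤m*n (i + l′) (2 ^ s) {{m^n≢0 2 s}}))
      where
      1≤o : 1 ≤ o
      1≤o = +-cancelˡ-< i 0 o (subst₂ _<_ (sym (+-identityʳ i)) (sym i+o≡R) i<R)
      o<i : o < i
      o<i = +-cancelˡ-< i o i (subst (_< i + i) (sym i+o≡R) (≰⇒> 2i≰R))

    -- `s` bounds the doublings still needed to fill the first run; each later run then costs one
    -- phrase, and so does the one closing the first run.
    phrases-from : ∀ s {i es k} → 1 ≤ i → i ≤ R → R ≤ i * 2 ^ s → All (_≤ i) es → i ∈ es →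
      GreedyParse w C es i k → k ≤ s + suc (length rs)
    phrases-from zero {i} 1≤i i≤R R≤ es≤ i∈ P = phrases-from-R (≤-antisym i≤R (subst (R ≤_) (*-identityʳ i) R≤)) es≤ P
    phrases-from (suc s) {i} 1≤i i≤R R≤ es≤ i∈ P with m≤n⇒m<n∨m≡n i≤R
    ... | inj₂ i≡R = ≤-trans (phrases-from-R i≡R es≤ P) (m≤n+m _ (suc s))
    ... | inj₁ i<R = go P (doubling s 1≤i i<R R≤ es≤ i∈)
      where
      Doubling : ℕ → List ℕ → Set
      Doubling i es = ∃[ l ] 1 ≤ l × i + l ≤ R × C es i l × (∀ {l′} → l ≤ l′ → R ≤ (i + l′) * 2 ^ s)
      go : ∀ {k} → GreedyParse w C _ i k → Doubling i _ → k ≤ suc s + suc (length rs)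
      go done _ = z≤n
      go (single _ none _) (l , 1≤l , i+l≤R , Cl , _) = contradiction Cl (none l 1≤l (≤-trans i+l≤R (<⇒≤ R<length)))
      go (phrase {l = l′} 1≤l′ _ cond longest P) (l , 1≤l , i+l≤R , Cl , bound) =
        s≤s (phrases-from s (≤-trans 1≤i (m≤m+n i l′)) i+l′≤R (bound (longest l (≤-trans i+l≤R (<⇒≤ R<length)) Cl)) (after-phrase es≤) (here refl) P)
        where
        -- A phrase going past `R` would copy the first one of the word from an earlier position,
        -- where there is a zero.
        i+l′≤R : i + l′ ≤ R
        i+l′≤R with i + l′ ≤? R
        ... | yes h = h
        ... | no  h with m≤n⇒∃[o]m+o≡n i≤R | earlier es≤ 1≤l′ cond
        ...   | t , i+t≡R | s₀ , s₀<i , eq = contradiction (Nth-functional {xs = w} {s₀ + t}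
                (Nth-first-run (subst (s₀ + t <_) i+t≡R (+-monoˡ-< t s₀<i)))
                (Nth-factor {w} {i} {s₀} {l′} {t} (sym eq) (+-cancelˡ-< i t l′ (subst (_< i + l′) (sym i+t≡R) (≰⇒> h)))
                  (subst (λ t → Nth w t 1) (sym i+t≡R) Nth-R))) λ ()

    greedy≤ : ∀ s {k} → R ≤ 2 ^ s → GreedyParse w C [] 0 k → k ≤ 2 + s + length rs
    greedy≤ s R≤ P = first P
      where
      first : ∀ {k} → GreedyParse w C [] 0 k → k ≤ 2 + s + length rs
      first (phrase 1≤l _ cond _ _) = contradiction (proj₁ (proj₂ (earlier [] 1≤l cond))) λ ()
      first (single _ _ P) = s≤s (≤-trans (phrases-from s ≤-refl (s≤s z≤n) (subst (R ≤_) (sym (+-identityʳ _)) R≤) (≤-refl ∷ []) (here refl) P)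
        (≤-reflexive (+-suc s (length rs))))

allowed-z : ∀ w {es i l} → All (_≤ i) es → 1 ≤ l → Condition-zₑ w es i l → Condition-z w es i l
allowed-z w = earlier-zₑ w

allowed-zₙₒ : ∀ w {es i l} → All (_≤ i) es → 1 ≤ l → Condition-zₑ w es i l → Condition-zₙₒ w es i l
allowed-zₙₒ w es≤ _ (j , j+l∈ , eq) = j , All.lookup es≤ j+l∈ , eq

-- Upper bounds for r, gᵣₗ and c

-- The potential of the lex-parse bounds runs too: each nonzero symbol pays for a run of its own and
-- for the zeros after it, and the extra 1 pays for initial zeros.
derun≤potential : ∀ xs → length (derun _≟_ xs) ≤ potential xs
derun≤potential []               = z≤n
derun≤potential (zero ∷ [])      = ≤-refl
derun≤potential (suc a ∷ [])     = s≤s z≤n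
derun≤potential (x ∷ xs@(y ∷ _)) with x ℕ.≡ᵇ y in eq | derun≤potential xs
derun≤potential (zero ∷ xs)          | true  | IH = ≤-trans IH (potential≤ xs)
derun≤potential (suc a ∷ xs)         | true  | IH = ≤-trans IH (≤-trans (potential≤ xs) (1+2*≤ a (sum xs)))
  where
  1+2*≤ : ∀ a s → 1 + 2 * s ≤ 2 * (suc a + s)
  1+2*≤ a s = ≤-trans (n≤1+n _) (≤-trans (≤-reflexive (sym (*-suc 2 s))) (*-monoʳ-≤ 2 (s≤s (m≤n+m s a))))
derun≤potential (zero ∷ suc b ∷ ys)  | false | IH = s≤s IH
derun≤potential (suc a ∷ xs)         | false | IH = ≤-trans (s≤s (≤-trans IH (potential≤ xs)))
  (≤-trans (≤-reflexive (sym (*-suc 2 (sum xs)))) (*-monoʳ-≤ 2 (s≤s (m≤n+m (sum xs) a))))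

lastSymbol≤sum : ∀ w → lastSymbol w ≤ sum w
lastSymbol≤sum []          = z≤n
lastSymbol≤sum (a ∷ [])    = m≤m+n a 0
lastSymbol≤sum (a ∷ b ∷ w) = ≤-trans (lastSymbol≤sum (b ∷ w)) (m≤n+m _ a)

applyUpTo≡tabulate : ∀ {A : Set} (f : ℕ → A) n → applyUpTo f n ≡ tabulate {n = n} (f ∘ toℕ)
applyUpTo≡tabulate f zero    = refl
applyUpTo≡tabulate f (suc n) = cong (f 0 ∷_) (applyUpTo≡tabulate (f ∘ suc) n)

-- Apart from the trivial one, each rotation ends in the symbol before its start.
sum-bwt : ∀ w → sum (bwt w) ≤ 2 * sum w
sum-bwt w = subst (_≤ 2 * sum w) (sym (trans (cong sum (bwt≡ w)) (sum-↭ (Permₚ.map⁺ lastSymbol (sort-↭ (rotations w)))))) (go w)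
  where
  open ≤-Reasoning
  rotation : String → ℕ → String
  rotation w i = drop i w ++ take i w
  before : ∀ w (i : Fin (length w)) → lastSymbol (rotation w (suc (toℕ i))) ≡ lookup w i
  before w i = trans (cong (λ x → lastSymbol (drop (suc (toℕ i)) w ++ x)) (take-suc w i))
    (trans (cong lastSymbol (sym (++-assoc (drop (suc (toℕ i)) w) (take (toℕ i) w) _))) (lastSymbol-∷ʳ (drop (suc (toℕ i)) w ++ take (toℕ i) w) (lookup w i)))
  go : ∀ w → sum (map lastSymbol (rotations w)) ≤ 2 * sum w
  go []           = z≤n
  go w@(a ∷ w′) = begin
    sum (map lastSymbol (rotations w))
      ≡⟨ cong sum (trans (sym (map-∘ (upTo (length w)))) (map-upTo f (length w))) ⟩
    f 0 + sum (applyUpTo (f ∘ suc) (length w′))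
      ≤⟨ +-mono-≤ (subst (λ x → lastSymbol x ≤ sum w) (sym (++-identityʳ w)) (lastSymbol≤sum w)) (≤-trans (m≤m+n _ (f (length w) + 0))
         (≤-reflexive (trans (sym (sum-++ (applyUpTo (f ∘ suc) (length w′)) (f (length w) ∷ []))) (cong sum (applyUpTo-∷ʳ (f ∘ suc) (length w′)))))) ⟩
    sum w + sum (applyUpTo (f ∘ suc) (length w))
      ≡⟨ cong (λ x → sum w + sum x) (trans (applyUpTo≡tabulate (f ∘ suc) (length w)) (trans (tabulate-cong (before w)) (tabulate-lookup w))) ⟩
    sum w + sum w
      ≡⟨ cong (_+_ (sum w)) (sym (+-identityʳ (sum w))) ⟩
    2 * sum w ∎
    where
    f : ℕ → ℕ
    f i = lastSymbol (rotation w i)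

r≤ : ∀ w → length (derun _≟_ (bwt w)) ≤ 1 + 4 * sum w
r≤ w = ≤-trans (derun≤potential (bwt w)) (≤-trans (potential≤ (bwt w)) (s≤s (≤-trans (*-monoʳ-≤ 2 (sum-bwt w)) (≤-reflexive (sym (*-assoc 2 2 (sum w)))))))

-- Run-length grammars with one power per run

module _ (κ : Kind) (κ≢slp : κ ≢ slp) (r₀ : ℕ) (rs : List ℕ) (1<rs : All (1 <_) (r₀ ∷ rs)) where
  private
    runs : List ℕ
    runs = r₀ ∷ rs

  blockSymbols : List (Fin (length runs)) → List (Symbol (suc (length runs)))
  blockSymbols []       = []
  blockSymbols (j ∷ js) = var (suc j) ∷ term 1 ∷ blockSymbols js

  blockRule : Fin (suc (length runs)) → Rule (suc (length runs))
  blockRule zero    = concatenation (var (suc zero) ∷ term 1 ∷ blockSymbols (tabulate suc))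
  blockRule (suc j) = power (term 0) (lookup runs j) (All.lookup 1<rs (∈-lookup j))

  blockRule-allowed : ∀ {κ} → κ ≢ slp → ∀ A → Allowed κ (blockRule A)
  blockRule-allowed {slp}     ≢slp _       = contradiction refl ≢slp
  blockRule-allowed {rlslp}   _    zero    = tt
  blockRule-allowed {rlslp}   _    (suc _) = tt
  blockRule-allowed {collage} _    zero    = tt
  blockRule-allowed {collage} _    (suc _) = tt

  blocksGrammar : Grammar κ
  blocksGrammar = record { m = suc (length runs) ; rule = blockRule ; allowed = blockRule-allowed κ≢slp ; start = zero }

  expands-run : ∀ j → Expands blocksGrammar (var (suc j)) (zeros (lookup runs j))
  expands-run j = var (subst (RuleExpands blocksGrammar (blockRule (suc j))) (concat-replicate (lookup runs j)) (power term))
    where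
    concat-replicate : ∀ k → concat (replicate k (0 ∷ [])) ≡ zeros k
    concat-replicate zero    = refl
    concat-replicate (suc k) = cong (0 ∷_) (concat-replicate k)

  expands-blockSymbols : ∀ js → SeqExpands blocksGrammar (blockSymbols js) (blocks (map (lookup runs) js))
  expands-blockSymbols []       = []
  expands-blockSymbols (j ∷ js) = expands-run j ∷ term ∷ expands-blockSymbols js

  blocksGrammar-expands : Expands blocksGrammar (var zero) (blocks runs)
  blocksGrammar-expands = var (concatenation (subst (SeqExpands blocksGrammar (blockSymbols (zero ∷ tabulate suc))) (cong blocks lookups≡) (expands-blockSymbols (zero ∷ tabulate suc))))
    where
    lookups≡ : map (lookup runs) (zero ∷ tabulate suc) ≡ runs
    lookups≡ = cong (r₀ ∷_) (trans (map-tabulate suc (lookup runs)) (tabulate-lookup rs))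

  grammarSize-blocksGrammar : grammarSize blocksGrammar ≡ 4 * length runs
  grammarSize-blocksGrammar = trans (cong₂ _+_ (trans (length-blockSymbols (zero ∷ tabulate suc)) (cong (λ k → 2 * suc k) (length-tabulate suc)))
    (trans (sum-tabulate-const (length runs) λ _ → refl) (*-comm (length runs) 2))) (sym (*-distribʳ-+ (length runs) 2 2))
    where
    length-blockSymbols : ∀ js → length (blockSymbols js) ≡ 2 * length js
    length-blockSymbols []       = refl
    length-blockSymbols (j ∷ js) = trans (cong (_+_ 2) (length-blockSymbols js)) (sym (*-suc 2 (length js)))

-- A common bound for all measures

module _ (M : ℕ) {rs : List ℕ} (bounds : All (λ r → 1 < r × r ≤ suc M) rs) (s : ℕ) (small : 2 + M ≤ 2 ^ s) where
  private
    w : String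
    w = blocks (2 + M ∷ rs)
    K bound : ℕ
    K     = length rs
    -- 4 per run is the cost in the grammars and in r, `s` pays for the doublings of the greedy
    -- parsings, and 6 covers the additive constants.
    bound = 6 + s + 4 * K

  rs≤ : All (_≤ suc M) rs
  rs≤ = All.map proj₂ bounds

  BoundedOnBlocks : Measure → Set
  BoundedOnBlocks μ = ∀ {q} → μ w q → q ℚ.≤ + bound / 1

  ≤bound : ∀ {k} a → k ≤ a + 4 * K → a ≤ 6 + s → k ≤ bound
  ≤bound a k≤ a≤ = ≤-trans k≤ (+-monoˡ-≤ (4 * K) a≤)

  small≤6 : ∀ {a} → a ≤ 6 → a ≤ 6 + s
  small≤6 a≤ = ≤-trans a≤ (m≤m+n 6 s)

  attractor≤bound : ∣ attractorOfBlocks (suc M) rs ∣ ≤ bound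
  attractor≤bound = ≤bound 2 (≤-trans (∣attractorOfBlocks∣≤ (suc M) rs) (+-monoʳ-≤ 2 (m≤n*m K 4))) (small≤6 (s≤s (s≤s z≤n)))

  4K+4≤bound : 4 * suc K ≤ bound
  4K+4≤bound = ≤bound 4 (≤-reflexive (*-suc 4 K)) (small≤6 (s≤s (s≤s (s≤s (s≤s z≤n)))))

  2K≤4K : 2 * K ≤ 4 * K
  2K≤4K = *-monoˡ-≤ K (s≤s (s≤s (z≤n {2})))

  δ-bounded : BoundedOnBlocks δ
  δ-bounded δq = ℚₚ.≤-trans (δ≤attractor {w} {Γ = attractorOfBlocks (suc M) rs} (blocks-attractor (All.map m≤n⇒m≤1+n rs≤)) δq)
    (/1-mono-≤ attractor≤bound)

  γ-bounded : BoundedOnBlocks γ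
  γ-bounded (k , (_ , k-min) , refl) = /1-mono-≤ {k} {bound}
    (≤-trans (k-min _ (attractorOfBlocks (suc M) rs , blocks-attractor (All.map m≤n⇒m≤1+n rs≤) , refl)) attractor≤bound)

  b-bounded : BoundedOnBlocks b
  b-bounded (k , (_ , k-min) , refl) = /1-mono-≤ {k} {bound} (≤-trans
    (k-min _ (blocksScheme (suc M) rs , blocksScheme-isMacroScheme (suc M) (s≤s z≤n) (All.map (λ (1<r , r≤) → <⇒≤ 1<r , r≤) bounds) , refl))
    (≤bound 3 (+-monoʳ-≤ 3 (≤-trans (≤-reflexive (length-blockPhrases rs)) 2K≤4K)) (small≤6 (s≤s (s≤s (s≤s z≤n))))))

  v-bounded : BoundedOnBlocks v
  v-bounded (k , parse , refl) = /1-mono-≤ {k} {bound} (≤bound 4 (≤-trans (v≤ (suc M) rs≤ parse) (+-monoʳ-≤ 4 2K≤4K))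
    (small≤6 (s≤s (s≤s (s≤s (s≤s z≤n))))))

  smallestGrammar-bounded : ∀ κ → κ ≢ slp → BoundedOnBlocks (smallestGrammar κ)
  smallestGrammar-bounded κ κ≢slp (k , (_ , k-min) , refl) = /1-mono-≤ {k} {bound} (≤-trans
    (k-min _ (blocksGrammar κ κ≢slp (2 + M) rs 1<rs , blocksGrammar-expands κ κ≢slp (2 + M) rs 1<rs , refl))
    (≤-trans (≤-reflexive (grammarSize-blocksGrammar κ κ≢slp (2 + M) rs 1<rs)) 4K+4≤bound))
    where
    1<rs : All (1 <_) (2 + M ∷ rs)
    1<rs = s≤s (s≤s z≤n) ∷ All.map proj₁ bounds

  greedy-bounded : ∀ C → EarlierCopy w (C w) → (∀ {es i l} → All (_≤ i) es → 1 ≤ l → Condition-zₑ w es i l → C w es i l) →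
    BoundedOnBlocks (greedy C)
  greedy-bounded C earlier allowed (k , parse , refl) = /1-mono-≤ {k} {bound}
    (≤bound (2 + s) (≤-trans (greedy≤ (suc M) rs≤ {C w} earlier allowed s small parse) (+-monoʳ-≤ (2 + s) (m≤n*m K 4)))
      (+-monoˡ-≤ s (s≤s (s≤s z≤n))))

  r-bounded : BoundedOnBlocks r
  r-bounded (k , refl , refl) = /1-mono-≤ {k} {bound} (≤bound 5
    (≤-trans (r≤ w) (≤-reflexive (cong suc (trans (cong (4 *_) (sum-blocks (2 + M ∷ rs))) (*-suc 4 K)))))
    (small≤6 (s≤s (s≤s (s≤s (s≤s (s≤s z≤n)))))))

  measures-bounded : All BoundedOnBlocks measures
  measures-bounded = δ-bounded ∷ γ-bounded ∷ b-bounded ∷ v-bounded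
    ∷ smallestGrammar-bounded collage (λ ()) ∷ smallestGrammar-bounded rlslp (λ ())
    ∷ greedy-bounded Condition-z (earlier-z w) (allowed-z w)
    ∷ greedy-bounded Condition-zₙₒ (earlier-zₙₒ w) (allowed-zₙₒ w)
    ∷ greedy-bounded Condition-zₑ (earlier-zₑ w) (λ _ _ c → c)
    ∷ r-bounded ∷ []

-- Codes of L-systems

Enumerates : ∀ {X : Set} → (X → Set) → (k : ℕ) → (Fin k → X) → Set
Enumerates P k f = ∀ {x} → P x → ∃[ c ] f c ≡ x

toℕ-enumerates : ∀ k → Enumerates (_< k) k toℕ
toℕ-enumerates k x<k = fromℕ< x<k , Finₚ.toℕ-fromℕ< x<k

pairs : ∀ {X Y : Set} {k l} → (Fin k → X) → (Fin l → Y) → Fin (k * l) → X × Y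
pairs {k = k} {l} f g c = let i , j = Fin.remQuot {k} l c in f i , g j

pairs-enumerates : ∀ {X Y : Set} {P : X → Set} {Q : Y → Set} {k l f g} → Enumerates P k f → Enumerates Q l g →
  Enumerates (λ (x , y) → P x × Q y) (k * l) (pairs f g)
pairs-enumerates {k = k} {l} {f} {g} ef eg (Px , Qy) with ef Px | eg Qy
... | i , refl | j , refl = Fin.combine i j , cong (λ (i , j) → f i , g j) (Finₚ.remQuot-combine {k} {l} i j)

words : ∀ k n → Fin (k ^ n) → List ℕ
words k zero    _ = []
words k (suc n) c = let i , j = Fin.remQuot {k} (k ^ n) c in toℕ i ∷ words k n j

words-enumerate : ∀ k n → Enumerates (λ xs → length xs ≡ n × All (_< k) xs) (k ^ n) (words k n)
words-enumerate k zero    {[]}     _                  = zero , refl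
words-enumerate k (suc n) {x ∷ xs} (len , x< ∷ xs<) with words-enumerate k n {xs} (suc-injective len , xs<)
... | j , refl = Fin.combine (fromℕ< x<) j , trans
  (cong (λ (i , j) → toℕ i ∷ words k n j) (Finₚ.remQuot-combine {k} {k ^ n} (fromℕ< x<) j)) (cong (_∷ _) (Finₚ.toℕ-fromℕ< x<))

length-words : ∀ k n c → length (words k n c) ≡ n
length-words k zero    c = refl
length-words k (suc n) c = cong suc (length-words k n _)

words< : ∀ k n c → All (_< k) (words k n c)
words< k zero    c = []
words< k (suc n) c = Finₚ.toℕ<n (proj₁ (Fin.remQuot {k} (k ^ n) c)) ∷ words< k n _

words-injective : ∀ k n {c c′} → words k n c ≡ words k n c′ → c ≡ c′
words-injective k zero    {zero} {zero} _  = refl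
words-injective k (suc n) {c}    {c′}   eq = begin
  c                                ≡⟨ sym (Finₚ.combine-remQuot {k} (k ^ n) c) ⟩
  Fin.combine {k} {k ^ n} i j      ≡⟨ cong₂ (Fin.combine {k} {k ^ n}) (Finₚ.toℕ-injective (∷-injectiveˡ eq)) (words-injective k n (∷-injectiveʳ eq)) ⟩
  Fin.combine {k} {k ^ n} i′ j′    ≡⟨ Finₚ.combine-remQuot {k} (k ^ n) c′ ⟩
  c′                               ∎
  where
  open ≡-Reasoning
  i  = proj₁ (Fin.remQuot {k} (k ^ n) c)
  j  = proj₂ (Fin.remQuot {k} (k ^ n) c)
  i′ = proj₁ (Fin.remQuot {k} (k ^ n) c′)
  j′ = proj₂ (Fin.remQuot {k} (k ^ n) c′)

-- The pigeonhole principle shows that not every `g i` is hit; decidable equality turns this into an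
-- explicit `i` that is missed.
escape : ∀ {A : Set} → (∀ (x y : A) → Dec (x ≡ y)) → ∀ {m n} (f : Fin m → A) (g : Fin n → A) →
  (∀ {i j} → g i ≡ g j → i ≡ j) → m < n → ∃[ i ] (∀ c → f c ≢ g i)
escape _≟A_ {m} {n} f g g-injective m<n =
  let i , ∄c = Finₚ.¬∀⟶∃¬ n Hit (λ i → Finₚ.any? λ c → f c ≟A g i) ¬all in i , λ c eq → ∄c (c , eq)
  where
  Hit : Fin n → Set
  Hit i = ∃[ c ] f c ≡ g i
  ¬all : ¬ (∀ i → Hit i)
  ¬all all with Finₚ.pigeonhole m<n (proj₁ ∘ all)
  ... | i , j , i<j , eq = Finₚ.<⇒≢ i<j (g-injective (trans (sym (proj₂ (all i))) (trans (cong f eq) (proj₂ (all j)))))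

-- Decoding

nth : ∀ {A : Set} → A → List A → ℕ → A
nth a []       _       = a
nth a (x ∷ xs) zero    = x
nth a (x ∷ xs) (suc i) = nth a xs i

nth-tabulate-++ : ∀ {A : Set} (a : A) {n} (f : Fin n → A) ys i → nth a (tabulate f ++ ys) (toℕ i) ≡ f i
nth-tabulate-++ a f ys zero    = refl
nth-tabulate-++ a f ys (suc i) = nth-tabulate-++ a (f ∘ suc) ys i

splitBy : List ℕ → List ℕ → List (List ℕ)
splitBy []       xs = []
splitBy (l ∷ ls) xs = take l xs ∷ splitBy ls (drop l xs)

splitBy-concat : ∀ xss ls ys → splitBy (map length xss ++ ls) (concat xss ++ ys) ≡ xss ++ splitBy ls ys
splitBy-concat []         ls ys = refl
splitBy-concat (xs ∷ xss) ls ys rewrite ++-assoc xs (concat xss) ys =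
  cong₂ _∷_ (take-++-≤ xs _) (trans (cong (splitBy (map length xss ++ ls)) (drop-++-≡ xs _)) (splitBy-concat xss ls ys))

-- Padding gives all lists of a code the same length. It does no harm to decoding: zero lengths only
-- split off empty parts behind the genuine ones, and the letters of the system never index those.
pad : ℕ → List ℕ → List ℕ
pad n xs = xs ++ zeros (n ∸ length xs)

length-pad : ∀ n xs → length xs ≤ n → length (pad n xs) ≡ n
length-pad n xs h = trans (length-++ xs) (trans (cong (_+_ (length xs)) (length-replicate _)) (m+[n∸m]≡n h))

pad-All : ∀ n {xs} {P : ℕ → Set} → P 0 → All P xs → All P (pad n xs)
pad-All n P0 Pxs = Allₚ.++⁺ Pxs (Allₚ.replicate⁺ _ P0)

Code : Set
Code = List ℕ × List ℕ × List ℕ × ℕ × ℕ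

-- lens and flat are the lengths and the concatenation of the axiom and the right-hand sides,
-- coding lists the final symbols of the letters; all three are padded to the same length.
decode : Code → String
decode (lens , flat , coding , d , n) =
  take n (map (nth 0 coding) (fold (nth [] parts 0) (concatMap (λ a → nth [] parts (suc a))) d))
  where
  parts : List (List ℕ)
  parts = splitBy lens flat

codeCount : (S D N : ℕ) → ℕ
codeCount S D N = suc S ^ S * (suc S ^ S * (suc S ^ S * (D * N)))

codes : ∀ S D N → Fin (codeCount S D N) → Code
codes S D N = pairs (words (suc S) S) (pairs (words (suc S) S) (pairs (words (suc S) S) (pairs {k = D} {N} toℕ toℕ)))

module _ (L : LSystem) {S D N : ℕ} (size≤ : lSize L ≤ S) (d<D : LSystem.d L < D) (n<N : LSystem.n L < N)
  {w : String} (binary : All (_≤ 1) w) (generates : LGenerates L w) where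
  open LSystem L

  -- The final symbols are unbounded, but on a system generating a binary word the clamping does not
  -- change the word, and it makes the codes finite in number.
  clamped : Fin σ → ℕ
  clamped a = Injection.to symbols (τ a) ⊓ 1

  parts : List (List ℕ)
  parts = map toℕ (List⁺.toList axiom) ∷ tabulate (λ a → map toℕ (List⁺.toList (φ a)))

  lens flat coding : List ℕ
  lens   = pad S (map length parts)
  flat   = pad S (concat parts)
  coding = pad S (tabulate clamped)

  code : Code
  code = lens , flat , coding , d , n

  rhsTotal : ℕ
  rhsTotal = sum (tabulate λ a → List⁺.length (φ a))

  rhs+axiom≤ : rhsTotal + List⁺.length axiom ≤ S
  rhs+axiom≤ = ≤-trans (m≤m+n _ (σ + 2)) (≤-trans (≤-reflexive (sym (+-assoc (rhsTotal + List⁺.length axiom) σ 2))) size≤)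

  σ+2≤ : σ + 2 ≤ S
  σ+2≤ = ≤-trans (m≤n+m (σ + 2) (rhsTotal + List⁺.length axiom)) (≤-trans (≤-reflexive (sym (+-assoc (rhsTotal + List⁺.length axiom) σ 2))) size≤)

  length-concat-parts : length (concat parts) ≤ S
  length-concat-parts = ≤-trans (≤-reflexive (trans (length-++ (map toℕ (List⁺.toList axiom))) (trans (cong₂ _+_
    (length-map toℕ (List⁺.toList axiom))
    (trans (length-concat-tabulate (λ a → map toℕ (List⁺.toList (φ a)))) (cong sum (tabulate-cong λ a → length-map toℕ (List⁺.toList (φ a))))))
    (+-comm (List⁺.length axiom) rhsTotal)))) rhs+axiom≤

  length-parts : length (map length parts) ≤ S
  length-parts = ≤-trans (≤-reflexive (trans (length-map length parts) (cong suc (length-tabulate _)))) (≤-trans (≤-trans (n≤1+n (suc σ)) (≤-reflexive (+-comm 2 σ))) σ+2≤)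

  1≤S : 1 ≤ S
  1≤S = ≤-trans (s≤s z≤n) (≤-trans (m≤n+m 2 σ) σ+2≤)

  letters< : ∀ (as : List (Fin σ)) → All (_< suc S) (map toℕ as)
  letters< as = Allₚ.map⁺ (All.tabulate λ {a} _ → <-trans (Finₚ.toℕ<n a) (s≤s (≤-trans (m≤m+n σ 2) σ+2≤)))

  concat≤ : ∀ {xs} (xss : List (List ℕ)) → xs ∈ xss → length xs ≤ length (concat xss)
  concat≤ (xs ∷ xss) (here refl) = ≤-trans (m≤m+n _ _) (≤-reflexive (sym (length-++ xs)))
  concat≤ (xs ∷ xss) (there xs∈) = ≤-trans (concat≤ xss xs∈) (≤-trans (m≤n+m _ (length xs)) (≤-reflexive (sym (length-++ xs))))

  code-enumerated : ∃[ c ] codes S D N c ≡ code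
  code-enumerated = pairs-enumerates (words-enumerate (suc S) S) (pairs-enumerates (words-enumerate (suc S) S)
      (pairs-enumerates (words-enumerate (suc S) S) (pairs-enumerates (toℕ-enumerates D) (toℕ-enumerates N))))
    ( (length-pad S (map length parts) length-parts , pad-All S (s≤s z≤n) (Allₚ.map⁺ (All.tabulate λ xs∈ → s≤s (≤-trans (concat≤ parts xs∈) length-concat-parts))))
    , (length-pad S (concat parts) length-concat-parts , pad-All S (s≤s z≤n) (Allₚ.concat⁺ (letters< (List⁺.toList axiom) ∷ Allₚ.tabulate⁺ λ a → letters< (List⁺.toList (φ a)))))
    , (length-pad S (tabulate clamped) (≤-trans (≤-reflexive (length-tabulate clamped)) (≤-trans (m≤m+n σ 2) σ+2≤))
        , pad-All S (s≤s z≤n) (Allₚ.tabulate⁺ λ a → s≤s (≤-trans (m⊓n≤n (Injection.to symbols (τ a)) 1) 1≤S)))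
    , d<D , n<N )

  level-decoded : ∀ {rule : ℕ → List ℕ} → (∀ a → rule (toℕ a) ≡ map toℕ (List⁺.toList (φ a))) → ∀ d →
    fold (map toℕ (List⁺.toList axiom)) (concatMap rule) d ≡ map toℕ (level φ (List⁺.toList axiom) d)
  level-decoded         rule≡ zero    = refl
  level-decoded {rule} rule≡ (suc d) = trans (cong (concatMap rule) (level-decoded rule≡ d)) (apply (level φ (List⁺.toList axiom) d))
    where
    apply : ∀ as → concatMap rule (map toℕ as) ≡ map toℕ (concatMap (λ a → List⁺.toList (φ a)) as)
    apply []       = refl
    apply (a ∷ as) = trans (cong₂ _++_ (rule≡ a) (apply as)) (sym (map-++ toℕ (List⁺.toList (φ a)) _))

  decode-code : decode code ≡ w
  decode-code = begin
    decode code
      ≡⟨ cong (λ ps → take n (map (nth 0 coding) (fold (nth [] ps 0) (concatMap (λ a → nth [] ps (suc a))) d))) (splitBy-concat parts _ _) ⟩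
    take n (map (nth 0 coding) (fold (map toℕ (List⁺.toList axiom)) (concatMap rule) d))
      ≡⟨ cong (λ u → take n (map (nth 0 coding) u)) (level-decoded (λ a → nth-tabulate-++ [] (λ a → map toℕ (List⁺.toList (φ a))) _ a) d) ⟩
    take n (map (nth 0 coding) (map toℕ final))
      ≡⟨ cong (take n) (trans (sym (map-∘ final)) (map-cong (λ a → nth-tabulate-++ 0 clamped _ a) final)) ⟩
    take n (map clamped final)
      ≡⟨ cong (take n) (map-∘ final) ⟩
    take n (map (_⊓ 1) (map (λ a → Injection.to symbols (τ a)) final))
      ≡⟨ trans (take-map n _) (cong (map (_⊓ 1)) (sym (proj₂ (proj₂ generates)))) ⟩
    map (_⊓ 1) w
      ≡⟨ clamp-binary binary ⟩
    w ∎
    where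
    open ≡-Reasoning
    final : List (Fin σ)
    final = level φ (List⁺.toList axiom) d
    rule : ℕ → List ℕ
    rule a = nth [] (parts ++ splitBy (zeros (S ∸ length (map length parts))) (zeros (S ∸ length (concat parts)))) (suc a)
    clamp-binary : ∀ {w} → All (_≤ 1) w → map (_⊓ 1) w ≡ w
    clamp-binary []       = refl
    clamp-binary (h ∷ hs) = cong₂ _∷_ (m≤n⇒m⊓n≡m h) (clamp-binary hs)

  small-system-coded : ∃[ c ] decode (codes S D N c) ≡ w
  small-system-coded = let c , eq = code-enumerated in c , trans (cong decode eq) decode-code

-- Words without small L-systems

n<2^n : ∀ n → n < 2 ^ n
n<2^n zero    = s≤s z≤n
n<2^n (suc n) = ≤-trans (+-mono-≤ (m^n>0 2 n) (n<2^n n)) (≤-reflexive (cong (_+_ (2 ^ n)) (sym (+-identityʳ (2 ^ n)))))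

blocks-injective : ∀ {rs rs′} → blocks rs ≡ blocks rs′ → rs ≡ rs′
blocks-injective {[]}     {[]}         _  = refl
blocks-injective {[]}     {zero ∷ _}   ()
blocks-injective {[]}     {suc _ ∷ _}  ()
blocks-injective {zero ∷ _}  {[]}      ()
blocks-injective {suc _ ∷ _} {[]}      ()
blocks-injective {r ∷ rs} {r′ ∷ rs′}   eq = cong₂ _∷_ r≡ (blocks-injective (tail≡ r≡ eq))
  where
  r≡ : r ≡ r′
  r≡ = trans (sym (lead-zeros r (blocks rs))) (trans (cong lead eq) (lead-zeros r′ (blocks rs′)))
  tail≡ : r ≡ r′ → zeros r ++ 1 ∷ blocks rs ≡ zeros r′ ++ 1 ∷ blocks rs′ → blocks rs ≡ blocks rs′
  tail≡ refl eq = ∷-injectiveʳ (++-cancelˡ (zeros r) _ _ eq)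

length-blocks≤ : ∀ {B rs} → All (_≤ B) rs → length (blocks rs) ≤ length rs * suc B
length-blocks≤ []                = z≤n
length-blocks≤ {B} {r ∷ rs} (r≤ ∷ h) = ≤-trans (≤-reflexive (trans (length-++ (zeros r)) (trans (cong (_+ suc (length (blocks rs))) (length-replicate r)) (+-suc r _))))
  (+-mono-≤ (s≤s r≤) (length-blocks≤ h))

blocks-binary : ∀ rs → All (_≤ 1) (blocks rs)
blocks-binary []       = []
blocks-binary (r ∷ rs) = Allₚ.++⁺ (Allₚ.replicate⁺ r z≤n) (≤-refl ∷ blocks-binary rs)

-- A bound on the word length: `suc t` blocks, each of at most 2 + Q zeros and a one.
runLengthBound : ℕ → ℕ → ℕ
runLengthBound t Q = suc t * (3 + Q)

-- With t = 64 ⋅ 8^h runs of length below Q = 2^t there are 2^(t²) words, more than codes of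
-- systems of size h t, of which there are 2^O(h t log (h t)).
FewCodes : (h t Q : ℕ) → Set
FewCodes h t Q = codeCount (h * t) (suc (runLengthBound t Q ^ h)) (suc (runLengthBound t Q)) < Q ^ t

module _ (h : ℕ) where
  private
    t Q N₀ S : ℕ
    t  = 2 ^ (6 + (h + (h + h)))
    Q  = 2 ^ t
    N₀ = runLengthBound t Q
    S  = h * t

    1≤t : 1 ≤ t
    1≤t = m^n>0 2 (6 + (h + (h + h)))

  few-codes : FewCodes h t Q
  few-codes = begin-strict
    codeCount S (suc (N₀ ^ h)) (suc N₀)
      ≤⟨ *-mono-≤ A≤ (*-mono-≤ A≤ (*-mono-≤ A≤ (*-mono-≤ D≤ N≤))) ⟩
    2 ^ (u * S) * (2 ^ (u * S) * (2 ^ (u * S) * (2 ^ suc (x * h) * 2 ^ suc x)))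
      ≡⟨ collect (u * S) (suc (x * h)) (suc x) ⟩
    2 ^ (u * S + (u * S + (u * S + (suc (x * h) + suc x))))
      <⟨ ^-monoʳ-< 2 (s≤s (s≤s z≤n)) exponent< ⟩
    2 ^ (t * t)
      ≡⟨ sym (^-*-assoc 2 t t) ⟩
    Q ^ t ∎
    where
    open ≤-Reasoning
    open +-*-Solver
    -- Bit lengths: suc S ≤ (h + 1) t ≤ 2^h t = 2^u, and N₀ ≤ 2^x.
    u x : ℕ
    u = h + (6 + (h + (h + h)))
    x = suc t + t
    A≤ : suc S ^ S ≤ 2 ^ (u * S)
    A≤ = ≤-trans (^-monoˡ-≤ S (≤-trans (+-monoˡ-≤ S 1≤t) (≤-trans (*-monoˡ-≤ t (n<2^n h))
      (≤-reflexive (sym (^-distribˡ-+-* 2 h (6 + (h + (h + h)))))))))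
      (≤-reflexive (^-*-assoc 2 u S))
    N₀≤ : N₀ ≤ 2 ^ x
    N₀≤ = begin
      suc t * (3 + Q)      ≡⟨ *-comm (suc t) (3 + Q) ⟩
      (3 + Q) * suc t      ≤⟨ *-mono-≤ (+-monoˡ-≤ Q 3≤T) (n<2^n t) ⟩
      (Q + Q) * Q          ≡⟨ cong (λ k → (Q + k) * Q) (sym (+-identityʳ Q)) ⟩
      2 ^ suc t * 2 ^ t    ≡⟨ sym (^-distribˡ-+-* 2 (suc t) t) ⟩
      2 ^ x ∎
      where
      3≤T : 3 ≤ Q
      3≤T = ≤-trans (≤-trans (s≤s (s≤s (s≤s (z≤n {1})))) (^-monoʳ-≤ 2 {2} {6 + (h + (h + h))} (s≤s (s≤s z≤n)))) (<⇒≤ (n<2^n t))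
    suc≤2* : ∀ {k} y → k ≤ 2 ^ y → suc k ≤ 2 ^ suc y
    suc≤2* y k≤ = ≤-trans (+-mono-≤ (m^n>0 2 y) k≤) (≤-reflexive (cong (_+_ (2 ^ y)) (sym (+-identityʳ (2 ^ y)))))
    N≤ : suc N₀ ≤ 2 ^ suc x
    N≤ = suc≤2* x N₀≤
    D≤ : suc (N₀ ^ h) ≤ 2 ^ suc (x * h)
    D≤ = suc≤2* (x * h) (≤-trans (^-monoˡ-≤ h N₀≤) (≤-reflexive (^-*-assoc 2 x h)))
    collect : ∀ a d n → 2 ^ a * (2 ^ a * (2 ^ a * (2 ^ d * 2 ^ n))) ≡ 2 ^ (a + (a + (a + (d + n))))
    collect a d n = sym (trans (^-distribˡ-+-* 2 a _) (cong (2 ^ a *_) (trans (^-distribˡ-+-* 2 a _) (cong (2 ^ a *_)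
      (trans (^-distribˡ-+-* 2 a _) (cong (2 ^ a *_) (^-distribˡ-+-* 2 d n)))))))
    -- The left side is the coefficient of `t` in the exponent: 3 u h gives 12h² + 18h, and the
    -- depth and length fields add at most 3h + 5. It is completed to 64 (1 + h)², which is at most
    -- 64 · 4^h.
    quadratic<t : 12 * (h * h) + 21 * h + 5 < t
    quadratic<t = begin-strict
      12 * (h * h) + 21 * h + 5
        <⟨ m<m+n _ {suc (52 * (h * h) + 107 * h + 58)} (s≤s z≤n) ⟩
      12 * (h * h) + 21 * h + 5 + suc (52 * (h * h) + 107 * h + 58)
        ≡⟨ solve 1 (λ h → con 12 :* (h :* h) :+ con 21 :* h :+ con 5 :+ (con 1 :+ (con 52 :* (h :* h) :+ con 107 :* h :+ con 58))
             := con 64 :* ((con 1 :+ h) :* ((con 1 :+ h) :* con 1))) refl h ⟩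
      64 * (suc h * (suc h * 1))
        ≤⟨ *-monoʳ-≤ 64 (*-mono-≤ (n<2^n h) (*-mono-≤ (n<2^n h) (m^n>0 2 h))) ⟩
      64 * (2 ^ h * (2 ^ h * 2 ^ h))
        ≡⟨ cong (64 *_) (sym (trans (^-distribˡ-+-* 2 h (h + h)) (cong (2 ^ h *_) (^-distribˡ-+-* 2 h h)))) ⟩
      64 * 2 ^ (h + (h + h))
        ≡⟨ sym (^-distribˡ-+-* 2 6 (h + (h + h))) ⟩
      t ∎
    exponent< : u * S + (u * S + (u * S + (suc (x * h) + suc x))) < t * t
    exponent< = ≤-<-trans (exponent≤ t 1≤t) (*-monoʳ-< t {{ℕ.>-nonZero 1≤t}} quadratic<t)
      where
      exponent≤ : ∀ t → 1 ≤ t → u * (h * t) + (u * (h * t) + (u * (h * t) + (suc ((suc t + t) * h) + suc (suc t + t)))) ≤ t * (12 * (h * h) + 21 * h + 5)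
      exponent≤ (suc k) _ = ≤-trans (m≤m+n _ (k * h + 3 * k)) (≤-reflexive (solve 2 (λ h k →
        let t = con 1 :+ k ; u = h :+ (con 6 :+ (h :+ (h :+ h))) ; a = u :* (h :* t) in
        a :+ (a :+ (a :+ (con 1 :+ (con 1 :+ t :+ t) :* h :+ (con 1 :+ (con 1 :+ t :+ t))))) :+ (k :* h :+ con 3 :* k)
        := t :* (con 12 :* (h :* h) :+ con 21 :* h :+ con 5)) refl h k))

module _ (h t Q : ℕ) (few : FewCodes h t Q) where
  private
    N₀ : ℕ
    N₀ = runLengthBound t Q

  -- The shift by 2 makes every run a legal exponent of a power and still leaves it shorter than the
  -- first run.
  runsOf : Fin (Q ^ t) → List ℕ
  runsOf c = map (_+_ 2) (words Q t c)

  wordOf : Fin (Q ^ t) → String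
  wordOf c = blocks (2 + Q ∷ runsOf c)

  wordOf-injective : ∀ {c c′} → wordOf c ≡ wordOf c′ → c ≡ c′
  wordOf-injective {c} {c′} eq = words-injective Q t (map-injective (λ eq → suc-injective (suc-injective eq)) (∷-injectiveʳ (blocks-injective {2 + Q ∷ runsOf c} {2 + Q ∷ runsOf c′} eq)))

  runsOf-bounds : ∀ c → All (λ r → 1 < r × r ≤ suc Q) (runsOf c)
  runsOf-bounds c = Allₚ.map⁺ (All.map (λ v<Q → s≤s (s≤s z≤n) , s≤s v<Q) (words< Q t c))

  length-runsOf : ∀ c → length (runsOf c) ≡ t
  length-runsOf c = trans (length-map (_+_ 2) (words Q t c)) (length-words Q t c)

  length-wordOf≤ : ∀ c → length (wordOf c) ≤ N₀
  length-wordOf≤ c = ≤-trans (length-blocks≤ {rs = 2 + Q ∷ runsOf c} (≤-refl ∷ All.map (λ (_ , r≤) → m≤n⇒m≤1+n r≤) (runsOf-bounds c)))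
    (≤-reflexive (cong (λ k → suc k * (3 + Q)) (length-runsOf c)))

  -- The codes allow depths up to N₀^h, and d ≤ n^e ≤ N₀^h for every `e` up to `h`; so a single word
  -- missed by all codes serves all these exponents.
  complexRuns : ∃[ rs ] length rs ≡ t × All (λ r → 1 < r × r ≤ suc Q) rs
    × (∀ {e} → e ≤ h → ∀ L → LBounded e L → LGenerates L (blocks (2 + Q ∷ rs)) → h * t ≤ lSize L)
  complexRuns = let c , avoids = escape (≡-dec _≟_) (decode ∘ codes (h * t) (suc (N₀ ^ h)) (suc N₀)) wordOf wordOf-injective few
                in runsOf c , length-runsOf c , runsOf-bounds c , λ {e} → complex c avoids {e}
    where
    complex : ∀ c → (∀ i → decode (codes (h * t) (suc (N₀ ^ h)) (suc N₀) i) ≢ wordOf c) →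
      ∀ {e} → e ≤ h → ∀ L → LBounded e L → LGenerates L (wordOf c) → h * t ≤ lSize L
    complex c avoids {e} e≤h L (d≤ , _) generates@(n≡ , _) with lSize L ≤? h * t
    ... | no  ≰ = <⇒≤ (≰⇒> ≰)
    ... | yes size≤ = let i , eq = small-system-coded L size≤ (s≤s d≤N₀^h) (s≤s n≤N₀) (blocks-binary (2 + Q ∷ runsOf c)) generates
                      in contradiction eq (avoids i)
      where
      n≤N₀ : LSystem.n L ≤ N₀
      n≤N₀ = ≤-trans (≤-reflexive n≡) (length-wordOf≤ c)
      d≤N₀^h : LSystem.d L ≤ N₀ ^ h
      d≤N₀^h = ≤-trans d≤ (≤-trans (^-monoˡ-≤ e n≤N₀) (^-monoʳ-≤ N₀ e≤h))

abstract
  -- From here on the parameters are known only through these inequalities. `7 ≤ t` absorbs additive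
  -- constants into 6 t, `h ≤ t ≤ Q` makes the words long, and the last one allows `suc t` doublings
  -- to fill the first run.
  runParameters : ∀ h → ∃[ t ] ∃[ Q ] (h ≤ t × 7 ≤ t × t ≤ Q × 2 + Q ≤ 2 ^ suc t) × FewCodes h t Q
  runParameters h = 2 ^ x , 2 ^ 2 ^ x , large x (m≤m+n 6 (h + (h + h))) (≤-trans (m≤m+n h (h + h)) (m≤n+m (h + (h + h)) 6)) , few-codes h
    where
    x : ℕ
    x = 6 + (h + (h + h))
    large : ∀ x → 6 ≤ x → h ≤ x → h ≤ 2 ^ x × 7 ≤ 2 ^ x × 2 ^ x ≤ 2 ^ 2 ^ x × 2 + 2 ^ 2 ^ x ≤ 2 ^ suc (2 ^ x)
    large x 6≤x h≤x = ≤-trans h≤x (<⇒≤ (n<2^n x)) , ≤-trans (s≤s 6≤x) (n<2^n x) , <⇒≤ (n<2^n (2 ^ x))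
      , +-mono-≤ (^-monoʳ-≤ 2 {1} {2 ^ x} (m^n>0 2 x)) (m≤m+n (2 ^ 2 ^ x) 0)

  complexBlocks : ∀ h → ∃[ t ] ∃[ Q ] ∃[ rs ] h ≤ t × 7 ≤ t × t ≤ Q × 2 + Q ≤ 2 ^ suc t
    × length rs ≡ t × All (λ r → 1 < r × r ≤ suc Q) rs
    × (∀ {e} → e ≤ h → ∀ L → LBounded e L → LGenerates L (blocks (2 + Q ∷ rs)) → h * t ≤ lSize L)
  complexBlocks h = let t , Q , (h≤t , 7≤t , t≤Q , 2+Q≤) , few = runParameters h
                        rs , len , bounds , complex = complexRuns h t Q few
                    in t , Q , rs , h≤t , 7≤t , t≤Q , 2+Q≤ , len , bounds , λ {e} → complex {e}

-- The family on which the measures are small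

module _ (h : ℕ) where
  private
    t Q : ℕ
    t = proj₁ (complexBlocks h)
    Q = proj₁ (proj₂ (complexBlocks h))
    rs : List ℕ
    rs = proj₁ (proj₂ (proj₂ (complexBlocks h)))

  V : String
  V = blocks (2 + Q ∷ rs)

  V-long : h ≤ length V
  V-long = let h≤t , _ , t≤Q , _ = proj₂ (proj₂ (proj₂ (complexBlocks h)))
           in ≤-trans (≤-trans h≤t (≤-trans t≤Q (m≤n+m Q 2))) (<⇒≤ (∈⇒<length-blocks {rs = 2 + Q ∷ rs} (here refl)))

  V-bounded : ∀ {μ} → μ ∈ measures → ∀ {q} → μ V q → q ℚ.≤ + (6 * t) / 1
  V-bounded μ∈ μq = let _ , 7≤t , _ , 2+Q≤ , len , bounds , _ = proj₂ (proj₂ (proj₂ (complexBlocks h))) in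
    ℚₚ.≤-trans (All.lookup (measures-bounded Q bounds (suc t) 2+Q≤) μ∈ μq)
      (/1-mono-≤ {6 + suc t + 4 * length rs} {6 * t} (subst (λ k → 6 + suc t + 4 * k ≤ 6 * t) (sym len) (7+5t≤ t 7≤t)))
    where
    open +-*-Solver
    7+5t≤ : ∀ t → 7 ≤ t → 6 + suc t + 4 * t ≤ 6 * t
    7+5t≤ t 7≤t = ≤-trans (≤-reflexive (solve 1 (λ t → con 6 :+ (con 1 :+ t) :+ con 4 :* t := con 7 :+ con 5 :* t) refl t)) (+-monoˡ-≤ (5 * t) 7≤t)

  V-complex : ∀ {e} → e ≤ h → ∀ L → LBounded e L → LGenerates L V → h * t ≤ lSize L
  V-complex {e} = let _ , _ , _ , _ , _ , _ , complex = proj₂ (proj₂ (proj₂ (complexBlocks h))) in complex {e}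

μ=oℓ : ∀ {μ} → μ ∈ measures → ∃[ F ] (∀ e → 1 ≤ e → μ =o[ F ] ℓ e)
-- The threshold is the exponent itself: words of index at least `e` resist the systems of exponent
-- `e`. The ratio is at most 6 t / (h t) = 6 / h.
μ=oℓ {μ} μ∈ = sequenceFamily V V-long , λ e _ → =o-sequence {μ} {ℓ e} V V-long 6 e bound
  where
  bound : ∀ {e h p q} → e ≤ h → μ (V h) p → ℓ e (V h) q → ∃[ a ] ∃[ b ] p ℚ.≤ + a / 1 × + b / 1 ℚ.≤ q × h * a ≤ 6 * b
  bound {e} {h} e≤h μp (_ , ((L , bounded , generates , refl) , _) , refl) =
    6 * proj₁ (complexBlocks h) , lSize L , V-bounded h μ∈ μp , ℚₚ.≤-refl
    , ≤-trans (≤-reflexive (swap h (proj₁ (complexBlocks h)))) (*-monoʳ-≤ 6 (V-complex h {e} e≤h L bounded generates))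
    where
    open +-*-Solver
    swap : ∀ h t → h * (6 * t) ≡ 6 * (h * t)
    swap = solve 2 (λ h t → h :* (con 6 :* t) := con 6 :* (h :* t)) refl

theorem1 : All (λ μ → (∃[ F ] (∀ e → 1 ≤ e → ℓ e =o[ F ] μ))
    × (∃[ F ] (∀ e → 1 ≤ e → μ =o[ F ] ℓ e)))
    measures
    × (∀ F e → 1 ≤ e → ℓ e =O[ F ] g)
    × (∀ F e → 1 ≤ e → ℓ e =Ω[ F ] ν e)
theorem1 = All.tabulate (λ μ∈ → ℓ=o (All.lookup measures-grow μ∈) , μ=oℓ μ∈) , ℓ=Og , λ F e _ → ℓ=Ων F e
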